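{- Let $G$ be a $6$-edge-connected $6$-regular signed graph with an odd number of negative edges which contains two edge-disjoint unbalanced circuits. Then $G$ has a rooted $3$-odd decomposition, i.e.\ there exist three subgraphs $G_1,G_2,G_3$ whose edge sets partition $E(G)$, each $G_i$ being an eulerian subgraph with an odd number of negative edges, and a vertex of $G$ lying in all of $G_1,G_2,G_3$.
   Context: Graphs are finite and may have multiple edges and loops (a loop contributes $2$ to the degree). A signed graph is a graph with a signature assigning $+1$ (positive) or $-1$ (negative) to each edge. A circuit (closed trail with distinct inner vertices; a loop is a circuit) is unbalanced if it contains an odd number of negative edges. A graph is eulerian if it is connected and all degrees are even. A graph is $k$-edge-connected if removing fewer than $k$ edges leaves it connected; by convention, a graph with a single vertex and $d$ loops has edge-connectivity $2d$ (so the one-vertex graph with three loops counts as $6$-edge-connected). -}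

module Defs where

open import Data.Nat using (ℕ; zero; suc; _+_; _<_; _%_)
open import Data.Nat.DivMod using (m%n<n)
open import Data.Bool using (Bool; true; false; _∧_; if_then_else_)
open import Data.Fin using (Fin; toℕ; fromℕ<; _≟_)
open import Data.Product using (_×_; Σ; ∃; _,_; proj₁; proj₂)
open import Data.Sum using (_⊎_)
open import Relation.Nullary using (¬_)
open import Relation.Nullary.Decidable using (⌊_⌋)
open import Relation.Binary.PropositionalEquality using (_≡_; _≢_)
open import Function.Definitions using (Injective)

-- A finite signed graph with multiple edges and loops allowed.
-- Vertices are Fin n, edges are Fin m; edge e has (unordered) ends
-- (proj₁ (ends e), proj₂ (ends e)); a loop has equal ends.
-- negative e ≡ true  means e is a negative edge (sign -1).
record SignedGraph : Set where
  field
    n        : ℕ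
    m        : ℕ
    ends     : Fin m → Fin n × Fin n
    negative : Fin m → Bool
open SignedGraph public

count : ∀ {k} → (Fin k → Bool) → ℕ
count {zero}  p = 0
count {suc k} p = (if p Fin.zero then 1 else 0) + count (λ i → p (Fin.suc i))

Odd : ℕ → Set
Odd k = k % 2 ≡ 1

Even : ℕ → Set
Even k = k % 2 ≡ 0

module _ (G : SignedGraph) where

  Joins : Fin (m G) → Fin (n G) → Fin (n G) → Set
  Joins e u w = (proj₁ (ends G e) ≡ u × proj₂ (ends G e) ≡ w)
              ⊎ (proj₁ (ends G e) ≡ w × proj₂ (ends G e) ≡ u)

  -- degree of v in the spanning subgraph with edge set S (a loop counts 2)
  degIn : (Fin (m G) → Bool) → Fin (n G) → ℕ
  degIn S v = count (λ e → S e ∧ ⌊ proj₁ (ends G e) ≟ v ⌋)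
            + count (λ e → S e ∧ ⌊ proj₂ (ends G e) ≟ v ⌋)

  negCount : (Fin (m G) → Bool) → ℕ
  negCount S = count (λ e → S e ∧ negative G e)

  data Reach (S : Fin (m G) → Bool) : Fin (n G) → Fin (n G) → Set where
    here : ∀ {u} → Reach S u u
    step : ∀ {u w v} (e : Fin (m G)) → S e ≡ true → Joins e u w →
           Reach S w v → Reach S u v

  ConnectedSub : (Fin (n G) → Bool) → (Fin (m G) → Bool) → Set
  ConnectedSub V S = (∃ λ v → V v ≡ true)
                   × (∀ u v → V u ≡ true → V v ≡ true → Reach S u v)

  IsSubgraph : (Fin (n G) → Bool) → (Fin (m G) → Bool) → Set
  IsSubgraph V S = ∀ e → S e ≡ true →
                   V (proj₁ (ends G e)) ≡ true × V (proj₂ (ends G e)) ≡ true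

  EulerianSub : (Fin (n G) → Bool) → (Fin (m G) → Bool) → Set
  EulerianSub V S = IsSubgraph V S × ConnectedSub V S
                  × (∀ v → V v ≡ true → Even (degIn S v))

  allEdges : Fin (m G) → Bool
  allEdges _ = true

  Regular : ℕ → Set
  Regular d = ∀ v → degIn allEdges v ≡ d

  allVertices : Fin (n G) → Bool
  allVertices _ = true

  Connected : Set
  Connected = ConnectedSub allVertices allEdges

  EdgeConnected : ℕ → Set
  EdgeConnected k = ∀ (R : Fin (m G) → Bool) → count R < k →
                    ConnectedSub allVertices (λ e → if R e then false else true)

  csuc : ∀ {j} → Fin (suc j) → Fin (suc j)
  csuc {j} i = fromℕ< (m%n<n (suc (toℕ i)) (suc j))

  -- a circuit of length suc j: closed trail v₀ e₀ v₁ e₁ … v_j e_j v₀ with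
  -- distinct edges and distinct vertices (a loop is a circuit of length 1)
  record Circuit : Set where
    field
      len      : ℕ
      verts    : Fin (suc len) → Fin (n G)
      edges    : Fin (suc len) → Fin (m G)
      vinj     : Injective _≡_ _≡_ verts
      einj     : Injective _≡_ _≡_ edges
      joins    : ∀ i → Joins (edges i) (verts i) (verts (csuc i))

  Unbalanced : Circuit → Set
  Unbalanced C = Odd (count (λ i → negative G (Circuit.edges C i)))

  EdgeDisjoint : Circuit → Circuit → Set
  EdgeDisjoint C D = ∀ i j → Circuit.edges C i ≢ Circuit.edges D j

  Rooted3OddDecomposition : Set
  Rooted3OddDecomposition =
    Σ (Fin (m G) → Fin 3) λ part →
    Σ (Fin (n G)) λ root →
    ∀ (i : Fin 3) → Σ (Fin (n G) → Bool) λ V →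
      let S = λ e → ⌊ part e ≟ i ⌋ in
      EulerianSub V S × Odd (negCount S) × V root ≡ true

{-# OPTIONS --safe #-}
module Submission where

-- Induct on the number of vertices, keeping three edge-disjoint odd even-degree
-- subgraphs ("parts") in a graph all of whose cuts have at least six edges.
-- Splitting off a vertex t (Lovász) preserves the cuts, and it preserves the parts as
-- long as only edges of the same part are paired.  At a vertex t where this fails,
-- either the three parts through t can be completed to the wanted decomposition, or t
-- lies on two odd closed trails each of whose edge pairs at t enters a tight set
-- (a 6-edge cut) avoiding t.  Uncrossing shows that minimal such sets are single
-- vertices, so there are two parallel edges of opposite sign (an odd digon); in fact
-- there are two distinct odd digons.  Let s be an end of the first.  If s also lies on
-- the second, then the two digons and the rest of the graph are the decomposition.
-- Otherwise all vertices but s and the ends of the second digon are split off in the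
-- graph without the first; on these three vertices two odd parts through s are visible.

open import Defs
open import Data.Bool using (Bool; true; false; not; _∧_; _∨_; _xor_; if_then_else_; T)
open import Data.Bool.Properties
  using (not-involutive; xor-assoc; xor-comm; xor-same; xor-identityʳ; ∧-zeroʳ; ∧-identityʳ; ¬-not)
  renaming (_≟_ to _≟ᵇ_)
open import Data.Empty using (⊥; ⊥-elim)
open import Data.Fin using (Fin; toℕ; inject₁; fromℕ; finToFun; funToFin; _≟_)
open import Data.Fin.Properties
  using (any?; all?; suc-injective; toℕ-injective; toℕ-fromℕ<; toℕ-inject₁; toℕ-fromℕ; toℕ<n; finToFun-funToFin)
open import Data.List using (List; []; _∷_; _++_; length; concat; map; tabulate; allFin)
open import Data.List.Properties
  using (length-++; ++-assoc; ++-identityʳ; concat-++; map-++; ∷-injectiveˡ; ∷-injectiveʳ)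
open import Data.List.Membership.Propositional using (_∈_)
open import Data.List.Membership.Propositional.Properties
  using (∈-∃++; ∈-++⁻; ∈-++⁺ˡ; ∈-++⁺ʳ; ∈-map⁺; ∈-allFin; ∈-tabulate⁻)
open import Data.List.Relation.Unary.Any using (here; there)
open import Data.List.Relation.Unary.All using (All; []; _∷_)
open import Data.List.Relation.Unary.All.Properties using () renaming (++⁺ to All-++⁺)
open import Data.List.Relation.Unary.AllPairs using ([]; _∷_)
open import Data.List.Relation.Unary.Unique.Propositional.Properties using (allFin⁺)
import Data.List.Relation.Binary.Permutation.Propositional as ↭
open ↭ using (_↭_; prep; swap; ↭-sym; ↭-trans; ↭-refl; ↭-reflexive)
open import Data.List.Relation.Binary.Permutation.Propositional.Properties
  using (∈-resp-↭; ++⁺ˡ; ++⁺ʳ; ++⁺; shift; shifts; drop-∷; ++-comm; ++-commutativeMonoid; ↭-length; ↭-map-inv)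
  renaming (map⁺ to ↭-map⁺)
import Data.List.Relation.Binary.Permutation.Setoid.Properties as ↭ₛ
open import Data.Nat using (ℕ; zero; suc; _+_; _*_; _≤_; _<_; _≤?_; _≤ᵇ_; _%_; z≤n; s≤s; s≤s⁻¹)
open import Data.Nat.DivMod using (m%n<n; m<n⇒m%n≡m; n%n≡0)
open import Data.Nat.Properties hiding (_≟_; suc-injective)
import Data.Nat.Properties as ℕ
open import Data.Nat.Solver using (module +-*-Solver)
open import Data.Product using (_×_; Σ; ∃; ∃₂; _,_; proj₁; proj₂)
open import Data.Sum using (_⊎_; inj₁; inj₂; [_,_])
open import Function.Definitions using (Injective)
open import Relation.Binary.PropositionalEquality
  using (_≡_; _≢_; refl; sym; trans; cong; cong₂; subst; setoid; module ≡-Reasoning)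
open import Relation.Nullary using (¬_; Dec; yes; no)
open import Relation.Nullary.Decidable using (⌊_⌋; _×-dec_; _→-dec_; decidable-stable)

-- Lovász's theorem chooses the pairs at `t` itself, so it respects the parts only when all edges at
-- `t` lie in one part. If two odd parts miss `t`, the rest may be split freely: its parity is
-- forced, because the whole graph is odd. The local arguments therefore aim at two odd parts
-- missing `t`. The degree six enters as three closed trails through `t` with two edges each: if the
-- four edges of two of them entered one tight set, moving `t` into that set would leave a cut of at
-- most four. This count excludes most positions of tight sets. Two disjoint circuits need not stay
-- circuits under splitting. Edge sets with even cuts and odd sign do stay such sets, and
-- connectedness, phrased by cuts, pulls back when a splitting is undone. Hence everything is said
-- of lists of edges up to permutation, with vertex sets as Boolean functions. Many statements end
-- in `⊥` with a continuation: tight sets and good pairs arise by refuting their absence, not from a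
-- search through all vertex sets.

private variable
  ν : ℕ

-- Parity, cuts and degrees

contra : {b : Bool} {A : Set} → b ≡ true → b ≡ false → A
contra refl ()

odd : ℕ → Bool
odd zero    = false
odd (suc k) = not (odd k)

not-xorˡ : ∀ a b → not (a xor b) ≡ not a xor b
not-xorˡ true  b = not-involutive b
not-xorˡ false b = refl

odd-+ : ∀ a b → odd (a + b) ≡ odd a xor odd b
odd-+ zero    b = refl
odd-+ (suc a) b = trans (cong not (odd-+ a b)) (not-xorˡ (odd a) (odd b))

even-sum : ∀ a b → odd a ≡ false → odd b ≡ false → odd (a + b) ≡ false
even-sum a b p q = trans (odd-+ a b) (cong₂ _xor_ p q)

even-diff : ∀ a b → odd (a + b) ≡ false → odd a ≡ false → odd b ≡ false
even-diff a b p q = trans (sym (cong (_xor odd b) q)) (trans (sym (odd-+ a b)) p)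

even<⇒2+≤ : ∀ {a b} → odd a ≡ false → odd b ≡ false → a < b → 2 + a ≤ b
even<⇒2+≤ {a} {b} p q a<b with m≤n⇒m<n∨m≡n a<b
... | inj₁ lt = lt
... | inj₂ refl = contra (trans (cong not p) refl) q

bit : Bool → ℕ
bit b = if b then 1 else 0

odd-bit : ∀ b → odd (bit b) ≡ b
odd-bit true  = refl
odd-bit false = refl

VSet : ℕ → Set
VSet ν = Fin ν → Bool

⁅_⁆ : Fin ν → VSet ν
⁅ t ⁆ v = ⌊ v ≟ t ⌋

∁ : VSet ν → VSet ν
∁ X v = not (X v)

infixr 7 _∩_
infixr 6 _∪_
_∩_ _∪_ : VSet ν → VSet ν → VSet ν
(X ∩ Y) v = X v ∧ Y v
(X ∪ Y) v = X v ∨ Y v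

∈⁅⁆ : (t : Fin ν) → ⁅ t ⁆ t ≡ true
∈⁅⁆ t with t ≟ t
... | yes _ = refl
... | no ¬p = ⊥-elim (¬p refl)

∉⁅⁆ : {v t : Fin ν} → v ≢ t → ⁅ t ⁆ v ≡ false
∉⁅⁆ {v = v} {t} ¬p with v ≟ t
... | yes p = ⊥-elim (¬p p)
... | no _ = refl

∈⁅⁆⁻ : {v t : Fin ν} → ⁅ t ⁆ v ≡ true → v ≡ t
∈⁅⁆⁻ {v = v} {t} p with v ≟ t
... | yes q = q

∧-true⁻ : ∀ {a b} → a ∧ b ≡ true → a ≡ true × b ≡ true
∧-true⁻ {true} {true} refl = refl , refl

∨-false⁻ : ∀ {a b} → a ∨ b ≡ false → a ≡ false × b ≡ false
∨-false⁻ {false} {false} refl = refl , refl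

∨-introˡ : ∀ {a b} → a ≡ true → a ∨ b ≡ true
∨-introˡ refl = refl

∨-introʳ : ∀ {a b} → b ≡ true → a ∨ b ≡ true
∨-introʳ {true} refl = refl
∨-introʳ {false} refl = refl

not-false⁻ : ∀ {a} → not a ≡ false → a ≡ true
not-false⁻ {true} refl = refl

not-true⁻ : ∀ {a} → not a ≡ true → a ≡ false
not-true⁻ {false} refl = refl

record Edge (ν : ℕ) : Set where
  constructor edge
  field
    fstEnd sndEnd : Fin ν
    sign          : Bool
open Edge public

-- Reads an edge from either end, so that the stored order of the ends never matters.
data Inc {ν : ℕ} : Edge ν → Fin ν → Fin ν → Set where
  fwd : ∀ {w x σ} → Inc (edge w x σ) w x
  bwd : ∀ {w x σ} → Inc (edge x w σ) w x

Inc-sym : ∀ {e : Edge ν} {w x} → Inc e w x → Inc e x w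
Inc-sym fwd = bwd
Inc-sym bwd = fwd

cross : Bool → Bool → ℕ
cross a b = bit (a xor b)

cross-comm : ∀ a b → cross a b ≡ cross b a
cross-comm true  true  = refl
cross-comm true  false = refl
cross-comm false true  = refl
cross-comm false false = refl

cross-same : ∀ a → cross a a ≡ 0
cross-same true  = refl
cross-same false = refl

cross-0 : ∀ {a b} → cross a b ≡ 0 → a ≡ b
cross-0 {true}  {true}  _ = refl
cross-0 {false} {false} _ = refl

cross-not : ∀ a b → cross (not a) (not b) ≡ cross a b
cross-not true  true  = refl
cross-not true  false = refl
cross-not false true  = refl
cross-not false false = refl

odd-cross : ∀ a b → odd (cross a b) ≡ a xor b
odd-cross a b = odd-bit (a xor b)

cutE : VSet ν → Edge ν → ℕ
cutE X e = cross (X (fstEnd e)) (X (sndEnd e))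

cutE-Inc : ∀ (X : VSet ν) {e w x} → Inc e w x → cutE X e ≡ cross (X w) (X x)
cutE-Inc X fwd = refl
cutE-Inc X (bwd {w} {x}) = cross-comm (X x) (X w)

total : {E : Set} → (E → ℕ) → List E → ℕ
total f []      = 0
total f (e ∷ A) = f e + total f A

module _ {E : Set} where

  total-++ : (f : E → ℕ) → ∀ A B → total f (A ++ B) ≡ total f A + total f B
  total-++ f []      B = refl
  total-++ f (e ∷ A) B = trans (cong (f e +_) (total-++ f A B)) (sym (+-assoc (f e) _ _))

  total-↭ : (f : E → ℕ) → ∀ {A B} → A ↭ B → total f A ≡ total f B
  total-↭ f ↭.refl = refl
  total-↭ f (prep e p) = cong (f e +_) (total-↭ f p)
  total-↭ f (swap {xs} {ys} e e′ p) = begin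
    f e + (f e′ + total f xs) ≡⟨ sym (+-assoc (f e) _ _) ⟩
    f e + f e′ + total f xs   ≡⟨ cong₂ _+_ (+-comm (f e) (f e′)) (total-↭ f p) ⟩
    f e′ + f e + total f ys   ≡⟨ +-assoc (f e′) _ _ ⟩
    f e′ + (f e + total f ys) ∎
    where open ≡-Reasoning
  total-↭ f (↭.trans p q) = trans (total-↭ f p) (total-↭ f q)

  interchange : ∀ a b c d → (a + b) + (c + d) ≡ (a + c) + (b + d)
  interchange = solve 4 (λ a b c d → (a :+ b) :+ (c :+ d) := (a :+ c) :+ (b :+ d)) refl
    where open +-*-Solver

  total-+ : (f g : E → ℕ) → ∀ A → total (λ e → f e + g e) A ≡ total f A + total g A
  total-+ f g []      = refl
  total-+ f g (e ∷ A) = trans (cong (f e + g e +_) (total-+ f g A)) (interchange (f e) (g e) _ _)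

  total-≤ : {f g : E → ℕ} → ∀ A → (∀ {e} → e ∈ A → f e ≤ g e) → total f A ≤ total g A
  total-≤ []      p = z≤n
  total-≤ (e ∷ A) p = +-mono-≤ (p (here refl)) (total-≤ A (λ e∈ → p (there e∈)))

  total-≡ : {f g : E → ℕ} → ∀ A → (∀ {e} → e ∈ A → f e ≡ g e) → total f A ≡ total g A
  total-≡ []      p = refl
  total-≡ (e ∷ A) p = cong₂ _+_ (p (here refl)) (total-≡ A (λ e∈ → p (there e∈)))

  total-0 : {f : E → ℕ} → ∀ A → total f A ≡ 0 → ∀ {e} → e ∈ A → f e ≡ 0
  total-0 {f} (e ∷ A) p (here refl) = m+n≡0⇒m≡0 (f e) p
  total-0 {f} (e ∷ A) p (there e∈) = total-0 A (m+n≡0⇒n≡0 (f e) p) e∈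

  0-total : {f : E → ℕ} → ∀ A → (∀ {e} → e ∈ A → f e ≡ 0) → total f A ≡ 0
  0-total []      p = refl
  0-total (e ∷ A) p = cong₂ _+_ (p (here refl)) (0-total A (λ e∈ → p (there e∈)))

  ∈⇒↭ : ∀ {e : E} {A} → e ∈ A → ∃ λ B → A ↭ e ∷ B
  ∈⇒↭ {e} e∈ with ∈-∃++ e∈
  ... | (B , C , refl) = B ++ C , shift e B C

cut : VSet ν → List (Edge ν) → ℕ
cut X = total (cutE X)

-- A loop at `t` counts twice here and not at all in `cut ⁅ t ⁆`; this gap later rules out loops.
deg : Fin ν → List (Edge ν) → ℕ
deg t = total (λ e → bit (⁅ t ⁆ (fstEnd e)) + bit (⁅ t ⁆ (sndEnd e)))

par : List (Edge ν) → Bool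
par []      = false
par (e ∷ A) = sign e xor par A

par-++ : (A B : List (Edge ν)) → par (A ++ B) ≡ par A xor par B
par-++ []      B = refl
par-++ (e ∷ A) B = trans (cong (sign e xor_) (par-++ A B)) (sym (xor-assoc (sign e) (par A) (par B)))

xor-swap : ∀ a b c → a xor (b xor c) ≡ b xor (a xor c)
xor-swap a b c = trans (sym (xor-assoc a b c)) (trans (cong (_xor c) (xor-comm a b)) (xor-assoc b a c))

par-↭ : {A B : List (Edge ν)} → A ↭ B → par A ≡ par B
par-↭ ↭.refl = refl
par-↭ (prep e p) = cong (sign e xor_) (par-↭ p)
par-↭ (swap {xs = xs} e e′ p) =
  trans (xor-swap (sign e) (sign e′) (par xs)) (cong (λ z → sign e′ xor (sign e xor z)) (par-↭ p))
par-↭ (↭.trans p q) = trans (par-↭ p) (par-↭ q)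

cut-↭ : (X : VSet ν) {A B : List (Edge ν)} → A ↭ B → cut X A ≡ cut X B
cut-↭ X = total-↭ (cutE X)

cut-++ : (X : VSet ν) (A B : List (Edge ν)) → cut X (A ++ B) ≡ cut X A + cut X B
cut-++ X = total-++ (cutE X)

cut-∁ : (X : VSet ν) (A : List (Edge ν)) → cut (∁ X) A ≡ cut X A
cut-∁ X A = total-≡ A (λ {e} _ → cross-not (X (fstEnd e)) (X (sndEnd e)))

-- between X Y e counts an edge joining X ∖ Y to Y ∖ X
between : VSet ν → VSet ν → Edge ν → ℕ
between X Y (edge u v _) =
  bit ((X u ∧ not (Y u) ∧ not (X v) ∧ Y v) ∨ (not (X u) ∧ Y u ∧ X v ∧ not (Y v)))

submodular-bool : ∀ a b c d →
  cross (a ∧ c) (b ∧ d) + cross (a ∨ c) (b ∨ d)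
    + 2 * bit ((a ∧ not c ∧ not b ∧ d) ∨ (not a ∧ c ∧ b ∧ not d))
  ≡ cross a b + cross c d
submodular-bool true  true  true  true  = refl
submodular-bool true  true  true  false = refl
submodular-bool true  true  false true  = refl
submodular-bool true  true  false false = refl
submodular-bool true  false true  true  = refl
submodular-bool true  false true  false = refl
submodular-bool true  false false true  = refl
submodular-bool true  false false false = refl
submodular-bool false true  true  true  = refl
submodular-bool false true  true  false = refl
submodular-bool false true  false true  = refl
submodular-bool false true  false false = refl
submodular-bool false false true  true  = refl
submodular-bool false false true  false = refl
submodular-bool false false false true  = refl
submodular-bool false false false false = refl

total-2* : {E : Set} (f : E → ℕ) → ∀ A → total (λ e → 2 * f e) A ≡ 2 * total f A
total-2* f []      = refl
total-2* f (e ∷ A) = trans (cong (2 * f e +_) (total-2* f A)) (sym (*-distribˡ-+ 2 (f e) _))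

-- Kept as an identity: the term with `between` is the slack of the usual inequality, and for tight
-- sets its vanishing is needed as much as the inequality.
submodular : (X Y : VSet ν) (A : List (Edge ν)) →
  cut (X ∩ Y) A + cut (X ∪ Y) A + 2 * total (between X Y) A ≡ cut X A + cut Y A
submodular X Y A = begin
  cut (X ∩ Y) A + cut (X ∪ Y) A + 2 * total (between X Y) A
    ≡⟨ cong₂ _+_ (sym (total-+ (cutE (X ∩ Y)) (cutE (X ∪ Y)) A)) (sym (total-2* (between X Y) A)) ⟩
  total (λ e → cutE (X ∩ Y) e + cutE (X ∪ Y) e) A + total (λ e → 2 * between X Y e) A
    ≡⟨ sym (total-+ (λ e → cutE (X ∩ Y) e + cutE (X ∪ Y) e) (λ e → 2 * between X Y e) A) ⟩
  total (λ e → cutE (X ∩ Y) e + cutE (X ∪ Y) e + 2 * between X Y e) A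
    ≡⟨ total-≡ A (λ { {edge u v _} _ → submodular-bool (X u) (X v) (Y u) (Y v) }) ⟩
  total (λ e → cutE X e + cutE Y e) A
    ≡⟨ total-+ (cutE X) (cutE Y) A ⟩
  cut X A + cut Y A ∎
  where open ≡-Reasoning

between-Inc : (X Y : VSet ν) {e : Edge ν} {u v : Fin ν} → Inc e u v →
  X u ≡ true → Y u ≡ false → X v ≡ false → Y v ≡ true → between X Y e ≡ 1
between-Inc X Y fwd p q r s rewrite p | q | r | s = refl
between-Inc X Y bwd p q r s rewrite p | q | r | s = refl

-- Even edge sets, connectivity and splitting

-- Equivalent to even degrees, by `odd-cut`, but in the form that splitting and uncrossing use.
EvenCuts : List (Edge ν) → Set
EvenCuts A = ∀ X → odd (cut X A) ≡ false

EvenCuts-↭ : {A B : List (Edge ν)} → A ↭ B → EvenCuts A → EvenCuts B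
EvenCuts-↭ p ev X = trans (sym (cong odd (cut-↭ X p))) (ev X)

EvenCuts-++ : {A B : List (Edge ν)} → EvenCuts A → EvenCuts B → EvenCuts (A ++ B)
EvenCuts-++ {A = A} {B} evA evB X =
  trans (cong odd (cut-++ X A B)) (even-sum (cut X A) (cut X B) (evA X) (evB X))

EvenCuts-++⁻ʳ : (A : List (Edge ν)) {B : List (Edge ν)} → EvenCuts (A ++ B) → EvenCuts A → EvenCuts B
EvenCuts-++⁻ʳ A {B} ev evA X =
  even-diff (cut X A) (cut X B) (trans (sym (cong odd (cut-++ X A B))) (ev X)) (evA X)

Inside : VSet ν → Edge ν → Set
Inside X e = X (fstEnd e) ≡ true × X (sndEnd e) ≡ true

Within : VSet ν → List (Edge ν) → Set
Within X A = ∀ {e} → e ∈ A → Inside X e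

-- Connectedness through `r` without walks: all edges lie in the component of `r`. The empty list
-- qualifies, and vertices on no edge of `A` are ignored.
Conn : Fin ν → List (Edge ν) → Set
Conn r A = ∀ X → X r ≡ true → cut X A ≡ 0 → Within X A

inside⁺ : (X : VSet ν) {e : Edge ν} {w x : Fin ν} → Inc e w x → X w ≡ true → X x ≡ true → Inside X e
inside⁺ X fwd p q = p , q
inside⁺ X bwd p q = q , p

inside⁻ : (X : VSet ν) {e : Edge ν} {w x : Fin ν} → Inc e w x → Inside X e → X w ≡ true × X x ≡ true
inside⁻ X fwd (p , q) = p , q
inside⁻ X bwd (p , q) = q , p

uncut : (X : VSet ν) {e : Edge ν} {w x : Fin ν} → Inc e w x → cutE X e ≡ 0 → X w ≡ X x
uncut X i p = cross-0 (trans (sym (cutE-Inc X i)) p)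

Within-↭ : {X : VSet ν} {A B : List (Edge ν)} → A ↭ B → Within X A → Within X B
Within-↭ p w e∈ = w (∈-resp-↭ (↭-sym p) e∈)

Within-∷ : {X : VSet ν} {e : Edge ν} {A : List (Edge ν)} → Inside X e → Within X A → Within X (e ∷ A)
Within-∷ p w (here refl) = p
Within-∷ p w (there e∈) = w e∈

Within-++ : {X : VSet ν} (A : List (Edge ν)) {B : List (Edge ν)} → Within X A → Within X B → Within X (A ++ B)
Within-++ A wA wB e∈ with ∈-++⁻ A e∈
... | inj₁ p = wA p
... | inj₂ p = wB p

Conn-↭ : {r : Fin ν} {A B : List (Edge ν)} → A ↭ B → Conn r A → Conn r B
Conn-↭ p c X Xr z = Within-↭ p (c X Xr (trans (cut-↭ X p) z))

Conn-++ : {r : Fin ν} (A : List (Edge ν)) {B : List (Edge ν)} → Conn r A → Conn r B → Conn r (A ++ B)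
Conn-++ A {B} cA cB X Xr z =
  Within-++ A (cA X Xr (m+n≡0⇒m≡0 (cut X A) z′)) (cB X Xr (m+n≡0⇒n≡0 (cut X A) z′))
  where z′ = trans (sym (cut-++ X A B)) z

splice : Fin ν → Fin ν → Edge ν → Edge ν → Edge ν
splice x y e f = edge x y (sign e xor sign f)

-- A ⇒ B: a sequence of splittings w x, w y ↦ x y turns A into B.
infix 4 _⇒_
data _⇒_ {ν : ℕ} : List (Edge ν) → List (Edge ν) → Set where
  done  : ∀ {A B} → A ↭ B → A ⇒ B
  split : ∀ {A B C e f w x y} → A ↭ e ∷ f ∷ B → Inc e w x → Inc f w y → splice x y e f ∷ B ⇒ C → A ⇒ C

⇒-↭ : {A B C : List (Edge ν)} → A ↭ B → B ⇒ C → A ⇒ C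
⇒-↭ p (done q)        = done (↭-trans p q)
⇒-↭ p (split q i j r) = split (↭-trans p q) i j r

⇒-refl : {A : List (Edge ν)} → A ⇒ A
⇒-refl = done ↭-refl

⇒-trans : {A B C : List (Edge ν)} → A ⇒ B → B ⇒ C → A ⇒ C
⇒-trans (done p)        r = ⇒-↭ p r
⇒-trans (split p i j q) r = split p i j (⇒-trans q r)

⇒-++ : {A B : List (Edge ν)} → A ⇒ B → ∀ N → A ++ N ⇒ B ++ N
⇒-++ (done p)        N = done (++⁺ʳ N p)
⇒-++ (split p i j r) N = split (++⁺ʳ N p) i j (⇒-++ r N)

⇒-par : {A B : List (Edge ν)} → A ⇒ B → par A ≡ par B
⇒-par (done p) = par-↭ p
⇒-par (split {B = B} {e = e} {f} p i j r) =
  trans (par-↭ p) (trans (sym (xor-assoc (sign e) (sign f) (par B))) (⇒-par r))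

-- Modulo two, `cross` is addition, so the common end `a` cancels. Hence a splitting keeps the
-- parity of every cut.
splice-odd : ∀ a b c k → odd (cross a b + (cross a c + k)) ≡ odd (cross b c + k)
splice-odd true  true  true  k = refl
splice-odd true  true  false k = refl
splice-odd true  false true  k = refl
splice-odd true  false false k = not-involutive (odd k)
splice-odd false true  true  k = not-involutive (odd k)
splice-odd false true  false k = refl
splice-odd false false true  k = refl
splice-odd false false false k = refl

⇒-odd : {A B : List (Edge ν)} → A ⇒ B → ∀ X → odd (cut X A) ≡ odd (cut X B)
⇒-odd (done p) X = cong odd (cut-↭ X p)
⇒-odd {A = A} {D} (split {B = B} {e = e} {f} {w} {x} {y} p i j r) X = begin
  odd (cut X A)                                             ≡⟨ cong odd (cut-↭ X p) ⟩
  odd (cutE X e + (cutE X f + cut X B))                     ≡⟨ cong₂ (λ a b → odd (a + (b + cut X B)))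
      (cutE-Inc X i) (cutE-Inc X j) ⟩
  odd (cross (X w) (X x) + (cross (X w) (X y) + cut X B))   ≡⟨ splice-odd (X w) (X x) (X y) (cut X B) ⟩
  odd (cross (X x) (X y) + cut X B)                         ≡⟨ ⇒-odd r X ⟩
  odd (cut X D)                                             ∎
  where open ≡-Reasoning

⇒-EvenCuts : {A B : List (Edge ν)} → A ⇒ B → EvenCuts A → EvenCuts B
⇒-EvenCuts r ev X = trans (sym (⇒-odd r X)) (ev X)

⇒-EvenCuts⁻ : {A B : List (Edge ν)} → A ⇒ B → EvenCuts B → EvenCuts A
⇒-EvenCuts⁻ r ev X = trans (⇒-odd r X) (ev X)

⇒-Within : {U : VSet ν} {A B : List (Edge ν)} → A ⇒ B → Within U A → Within U B
⇒-Within (done p) w = Within-↭ p w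
⇒-Within {U = U} (split p i j r) w =
  ⇒-Within r (Within-∷ (proj₂ (inside⁻ U i (w′ (here refl))) , proj₂ (inside⁻ U j (w′ (there (here refl)))))
                       (λ z → w′ (there (there z))))
  where w′ = Within-↭ p w

-- If `X` cuts neither edge of a pair at `w`, then `w`, `x` and `y` are on one side and the spliced
-- edge is uncut as well. It then lies inside `X`, which brings `w` inside too.
⇒-Conn : {r : Fin ν} {A B : List (Edge ν)} → A ⇒ B → Conn r B → Conn r A
⇒-Conn (done p) c = Conn-↭ (↭-sym p) c
⇒-Conn (split {B = B} {e = e} {f} {w} {x} {y} p i j s) c X Xr z =
  Within-↭ (↭-sym p) (Within-∷ (inside⁺ X i Xw Xx) (Within-∷ (inside⁺ X j Xw Xy) (λ g∈ → inB (there g∈))))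
  where
  z′ : cutE X e + (cutE X f + cut X B) ≡ 0
  z′ = trans (sym (cut-↭ X p)) z
  wx = uncut X i (m+n≡0⇒m≡0 (cutE X e) z′)
  z″ = m+n≡0⇒n≡0 (cutE X e) z′
  wy = uncut X j (m+n≡0⇒m≡0 (cutE X f) z″)
  inB : Within X (splice x y e f ∷ B)
  inB = ⇒-Conn s c X Xr
    (cong₂ _+_ (trans (cong₂ cross (sym wx) (sym wy)) (cross-same (X w))) (m+n≡0⇒n≡0 (cutE X f) z″))
  Xx = proj₁ (inB (here refl))
  Xy = proj₂ (inB (here refl))
  Xw = trans wx Xx

deg-Inc : (t : Fin ν) {e : Edge ν} {w x : Fin ν} → Inc e w x →
  bit (⁅ t ⁆ (fstEnd e)) + bit (⁅ t ⁆ (sndEnd e)) ≡ bit (⁅ t ⁆ w) + bit (⁅ t ⁆ x)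
deg-Inc t fwd = refl
deg-Inc t (bwd {w} {x}) = +-comm (bit (⁅ t ⁆ x)) _

⇒-deg : {A B : List (Edge ν)} → A ⇒ B → ∀ t → deg t B ≤ deg t A
⇒-deg (done p) t = ≤-reflexive (total-↭ _ (↭-sym p))
⇒-deg {A = A} {D} (split {B = B} {e = e} {f} {w} {x} {y} p i j r) t = begin
  deg t D                         ≤⟨ ⇒-deg r t ⟩
  (δ x + δ y) + deg t B           ≤⟨ m≤n+m _ (δ w + δ w) ⟩
  (δ w + δ w) + ((δ x + δ y) + deg t B)
    ≡⟨ solve 4 (λ w x y b → (w :+ w) :+ ((x :+ y) :+ b) := (w :+ x) :+ ((w :+ y) :+ b)) refl (δ w) (δ x)
        (δ y) (deg t B) ⟩
  (δ w + δ x) + ((δ w + δ y) + deg t B)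
    ≡⟨ cong₂ (λ a b → a + (b + deg t B)) (sym (deg-Inc t i)) (sym (deg-Inc t j)) ⟩
  deg t (e ∷ f ∷ B)               ≡⟨ total-↭ _ (↭-sym p) ⟩
  deg t A                         ∎
  where
  open ≤-Reasoning
  open +-*-Solver
  δ : Fin _ → ℕ
  δ v = bit (⁅ t ⁆ v)

-- A spliced edge lies in one of the two parts, and the pair it came from goes to that part. This
-- lifts a decomposition back through splittings.
⇒-split : {A B : List (Edge ν)} → A ⇒ B → ∀ {B₁ B₂} → B ↭ B₁ ++ B₂ →
  ∃₂ λ A₁ A₂ → A ↭ A₁ ++ A₂ × A₁ ⇒ B₁ × A₂ ⇒ B₂
⇒-split (done p) q = _ , _ , ↭-trans p q , ⇒-refl , ⇒-refl
⇒-split (split {B = B} {e = e} {f} {x = x} {y} p i j r) q with ⇒-split r q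
... | A₁ , A₂ , s , r₁ , r₂ with ∈-++⁻ A₁ (∈-resp-↭ s (here refl))
... | inj₁ g∈ with ∈⇒↭ g∈
... | C , t = e ∷ f ∷ C , A₂ , ↭-trans p (prep e (prep f (drop-∷ (↭-trans s (++⁺ʳ A₂ t)))))
            , split ↭-refl i j (⇒-↭ (↭-sym t) r₁) , r₂
⇒-split (split {B = B} {e = e} {f} {x = x} {y} p i j r) q | A₁ , A₂ , s , r₁ , r₂ | inj₂ g∈ with ∈⇒↭ g∈
... | C , t = A₁ , e ∷ f ∷ C
            , ↭-trans p (↭-trans (prep e (prep f (drop-∷ (↭-trans s (↭-trans (++⁺ˡ A₁ t) (shift _ A₁ C))))))
                                  (↭-sym (↭-trans (shift e A₁ (f ∷ C)) (prep e (shift f A₁ C)))))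
            , r₁ , split ↭-refl i j (⇒-↭ (↭-sym t) r₂)

-- Tight sets

Separates : VSet ν → VSet ν → Set
Separates U X = (∃ λ u → U u ≡ true × X u ≡ true) × (∃ λ u → U u ≡ true × X u ≡ false)

-- Only sets that divide `U` are tested, so a vertex removed from `U` may be on either side without
-- imposing a bound of its own.
CutsAtLeast : ℕ → VSet ν → List (Edge ν) → Set
CutsAtLeast k U H = ∀ X → Separates U X → k ≤ cut X H

CutsAtLeast-↭ : ∀ {k} {U : VSet ν} {A B} → A ↭ B → CutsAtLeast k U A → CutsAtLeast k U B
CutsAtLeast-↭ p c X s = ≤-trans (c X s) (≤-reflexive (cut-↭ X p))

Separates-∁ : {U X : VSet ν} → Separates U X → Separates U (∁ X)
Separates-∁ ((u , Uu , Xu) , (v , Uv , Xv)) = (v , Uv , cong not Xv) , (u , Uu , cong not Xu)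

Inc-unique : {e : Edge ν} {w x y : Fin ν} → Inc e w x → Inc e w y → x ≡ y
Inc-unique fwd fwd = refl
Inc-unique fwd bwd = refl
Inc-unique bwd fwd = refl
Inc-unique bwd bwd = refl

incident? : (w : Fin ν) (e : Edge ν) → (∃ λ y → Inc e w y) ⊎ (fstEnd e ≢ w × sndEnd e ≢ w)
incident? w (edge a b σ) with a ≟ w | b ≟ w
... | yes refl | _        = inj₁ (b , fwd)
... | no _     | yes refl = inj₁ (a , bwd)
... | no p     | no q     = inj₂ (p , q)

cut⁅⁆-Inc : {w x : Fin ν} {e : Edge ν} → Inc e w x → x ≢ w → cutE ⁅ w ⁆ e ≡ 1
cut⁅⁆-Inc {w = w} i p = trans (cutE-Inc ⁅ w ⁆ i) (cong₂ cross (∈⁅⁆ w) (∉⁅⁆ p))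

cut⁅⁆-loop : (z : Fin ν) {w : Fin ν} {e : Edge ν} → Inc e w w → cutE ⁅ z ⁆ e ≡ 0
cut⁅⁆-loop z {w} i = trans (cutE-Inc ⁅ z ⁆ i) (cross-same (⁅ z ⁆ w))

cut⁅⁆-avoid : {w : Fin ν} {e : Edge ν} → fstEnd e ≢ w × sndEnd e ≢ w → cutE ⁅ w ⁆ e ≡ 0
cut⁅⁆-avoid (p , q) = cong₂ cross (∉⁅⁆ p) (∉⁅⁆ q)

cut⁅⁆-incident : (w : Fin ν) (A : List (Edge ν)) → 1 ≤ cut ⁅ w ⁆ A →
  ∃₂ λ e y → ∃ λ B → A ↭ e ∷ B × Inc e w y × y ≢ w
cut⁅⁆-incident w (e ∷ A) p with incident? w e
cut⁅⁆-incident w (e ∷ A) p | inj₁ (y , i) with y ≟ w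
... | no q = e , y , A , ↭-refl , i , q
... | yes refl with cut⁅⁆-incident w A (subst (λ z → 1 ≤ z + cut ⁅ w ⁆ A) (cut⁅⁆-loop w i) p)
... | f , z , B , r , j , q = f , z , e ∷ B , ↭-trans (prep e r) (swap e f ↭-refl) , j , q
cut⁅⁆-incident w (e ∷ A) p | inj₂ a with cut⁅⁆-incident w A (subst (λ z → 1 ≤ z + cut ⁅ w ⁆ A) (cut⁅⁆-avoid {e = e} a) p)
... | f , z , B , r , j , q = f , z , e ∷ B , ↭-trans (prep e r) (swap e f ↭-refl) , j , q

odd⇒1≤ : ∀ {k} → odd k ≡ true → 1 ≤ k
odd⇒1≤ {suc k} _ = s≤s z≤n

EvenCuts-partner : {w x : Fin ν} {e : Edge ν} {A : List (Edge ν)} → EvenCuts (e ∷ A) → Inc e w x → x ≢ w →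
  ∃₂ λ f y → ∃ λ B → A ↭ f ∷ B × Inc f w y × y ≢ w
EvenCuts-partner {w = w} {x} {e} {A} ev i p = cut⁅⁆-incident w A (odd⇒1≤ (not-false⁻ odd-A))
  where
  odd-A : not (odd (cut ⁅ w ⁆ A)) ≡ false
  odd-A = trans (cong (λ z → odd (z + cut ⁅ w ⁆ A)) (sym (cut⁅⁆-Inc i p))) (ev ⁅ w ⁆)

splice-arith : ∀ a b k m → odd k ≡ false →
  odd (cross false a + (cross false b + m)) ≡ false → k ≤ cross false a + (cross false b + m) →
  (a ≡ true → b ≡ true → cross false a + (cross false b + m) ≤ k → ⊥) → k ≤ cross a b + m
splice-arith false false k m ek em c none = c
splice-arith false true  k m ek em c none = c
splice-arith true  false k m ek em c none = c
splice-arith true  true  k m ek em c none with k ≤? m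
... | yes p = p
-- With both far ends inside, the cut loses exactly two edges. All numbers are even, so below `k`
-- afterwards means at most `k` before: a tight set.
... | no ¬p = ⊥-elim (none refl refl (even<⇒2+≤ (trans (sym (not-involutive (odd m))) em) ek (≰⇒> ¬p)))

-- A splitting that lowers a cut below k is blocked by a tight set avoiding w.
splice-cuts : ∀ {k} {U : VSet ν} {w x y e f B} → odd k ≡ false →
  EvenCuts (e ∷ f ∷ B) → Inc e w x → Inc f w y → CutsAtLeast k U (e ∷ f ∷ B) →
  (∀ Y → Separates U Y → Y w ≡ false → Y x ≡ true → Y y ≡ true → cut Y (e ∷ f ∷ B) ≤ k → ⊥) →
  CutsAtLeast k U (splice x y e f ∷ B)
splice-cuts {k = k} {U} {w} {x} {y} {e} {f} {B} ek ev i j c none X s = go (X w) refl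
  where
  aux : ∀ X → X w ≡ false → Separates U X → k ≤ cross (X x) (X y) + cut X B
  aux X Xw s = splice-arith (X x) (X y) k (cut X B) ek
    (subst (λ z → odd z ≡ false) eq (ev X)) (subst (k ≤_) eq (c X s))
    (λ p q le → none X s Xw p q (subst (_≤ k) (sym eq) le))
    where
    eq : cut X (e ∷ f ∷ B) ≡ cross false (X x) + (cross false (X y) + cut X B)
    eq = trans (cong₂ (λ a b → a + (b + cut X B)) (cutE-Inc X i) (cutE-Inc X j))
               (cong (λ z → cross z (X x) + (cross z (X y) + cut X B)) Xw)
  go : ∀ b → X w ≡ b → k ≤ cut X (splice x y e f ∷ B)
  go false p = aux X p s
  -- A set and its complement have the same cut, so `w` may be taken to lie outside.
  go true  p = ≤-trans (aux (∁ X) (cong not p) (Separates-∁ s)) (≤-reflexive (cut-∁ X (splice x y e f ∷ B)))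

-- The right side is at most `2 * k` and `a + b` is at least that, so there is no room for slack.
uncross-arith : ∀ {k a b c p q} → a + b + 2 * c ≡ p + q → p ≤ k → q ≤ k → k ≤ a → k ≤ b →
  a ≤ k × b ≤ k × c ≡ 0
uncross-arith {k} {a} {b} {c} {p} {q} eq p≤ q≤ ≤a ≤b = a≤ , b≤ , c≡0
  where
  all≤ : a + b + 2 * c ≤ k + k
  all≤ = ≤-trans (≤-reflexive eq) (+-mono-≤ p≤ q≤)
  ab≤ : a + b ≤ k + k
  ab≤ = ≤-trans (m≤m+n (a + b) (2 * c)) all≤
  a≤ : a ≤ k
  a≤ = +-cancelʳ-≤ k a k (≤-trans (+-monoʳ-≤ a ≤b) ab≤)
  b≤ : b ≤ k
  b≤ = +-cancelˡ-≤ k b k (≤-trans (+-monoˡ-≤ b ≤a) ab≤)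
  c≡0 : c ≡ 0
  c≡0 = m+n≡0⇒m≡0 c (n≤0⇒n≡0 (+-cancelˡ-≤ (k + k) (2 * c) 0
    (≤-trans (≤-trans (+-monoˡ-≤ (2 * c) (+-mono-≤ ≤a ≤b)) all≤) (≤-reflexive (sym (+-identityʳ (k + k)))))))

uncross : ∀ {k} (X Y : VSet ν) (H : List (Edge ν)) → cut X H ≤ k → cut Y H ≤ k →
  k ≤ cut (X ∩ Y) H → k ≤ cut (X ∪ Y) H →
  cut (X ∩ Y) H ≤ k × cut (X ∪ Y) H ≤ k × total (between X Y) H ≡ 0
uncross X Y H = uncross-arith (submodular X Y H)

no-between : (X Y : VSet ν) {H : List (Edge ν)} → total (between X Y) H ≡ 0 →
  ∀ {e u v} → e ∈ H → Inc e u v → X u ≡ true → Y u ≡ false → X v ≡ false → Y v ≡ true → ⊥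
no-between X Y {H} z e∈ i p q r s with trans (sym (between-Inc X Y i p q r s)) (total-0 H z e∈)
... | ()

-- Every edge of `A` from `w` to another vertex leads into `Y`: these edges leave the cut when `w`
-- moves into `Y`, and no edge enters it.
absorb : (Y : VSet ν) {w : Fin ν} (A : List (Edge ν)) → Y w ≡ false →
  (∀ {e y} → e ∈ A → Inc e w y → y ≢ w → Y y ≡ true) → cut (Y ∪ ⁅ w ⁆) A + cut ⁅ w ⁆ A ≡ cut Y A
absorb Y {w} A Yw nbr = trans (sym (total-+ (cutE (Y ∪ ⁅ w ⁆)) (cutE ⁅ w ⁆) A)) (total-≡ A edgewise)
  where
  edgewise : ∀ {e} → e ∈ A → cutE (Y ∪ ⁅ w ⁆) e + cutE ⁅ w ⁆ e ≡ cutE Y e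
  edgewise {e} e∈ with incident? w e
  edgewise {edge a b σ} e∈ | inj₂ (p , q)
    rewrite ∉⁅⁆ p | ∉⁅⁆ q with Y a | Y b
  ... | true  | true  = refl
  ... | true  | false = refl
  ... | false | true  = refl
  ... | false | false = refl
  edgewise {e} e∈ | inj₁ (y , i)
    rewrite cutE-Inc (Y ∪ ⁅ w ⁆) i | cutE-Inc ⁅ w ⁆ i | cutE-Inc Y i | Yw | ∈⁅⁆ w with y ≟ w
  ... | yes refl rewrite Yw = refl
  ... | no q rewrite nbr e∈ i q = refl

absorb-≤ : (Y : VSet ν) {w : Fin ν} (A : List (Edge ν)) → cut (Y ∪ ⁅ w ⁆) A ≤ cut Y A + cut ⁅ w ⁆ A
absorb-≤ Y {w} A = ≤-trans (total-≤ A edgewise) (≤-reflexive (total-+ (cutE Y) (cutE ⁅ w ⁆) A))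
  where
  bool : ∀ a b c d → cross (a ∨ c) (b ∨ d) ≤ cross a b + cross c d
  bool true  true  c     d     = z≤n
  bool true  false c     true  = z≤n
  bool true  false true  false = s≤s z≤n
  bool true  false false false = s≤s z≤n
  bool false true  true  d     = z≤n
  bool false true  false true  = s≤s z≤n
  bool false true  false false = s≤s z≤n
  bool false false c     d     = ≤-refl
  edgewise : ∀ {e} → e ∈ A → cutE (Y ∪ ⁅ w ⁆) e ≤ cutE Y e + cutE ⁅ w ⁆ e
  edgewise {edge a b σ} _ = bool (Y a) (Y b) (⁅ w ⁆ a) (⁅ w ⁆ b)

cutE≤1 : (X : VSet ν) (e : Edge ν) → cutE X e ≤ 1
cutE≤1 X (edge a b _) with X a | X b
... | true  | true  = z≤n
... | true  | false = ≤-refl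
... | false | true  = ≤-refl
... | false | false = z≤n

cut-pair≤2 : (X : VSet ν) (e f : Edge ν) → cut X (e ∷ f ∷ []) ≤ 2
cut-pair≤2 X e f = +-mono-≤ (cutE≤1 X e) (+-monoˡ-≤ 0 (cutE≤1 X f))

-- Splitting off a vertex

member? : (X Y : VSet ν) → Dec (∃ λ u → X u ≡ true × Y u ≡ true)
member? X Y = any? (λ u → (X u ≟ᵇ true) ×-dec (Y u ≟ᵇ true))

infixl 8 _∖_
_∖_ : VSet ν → Fin ν → VSet ν
(U ∖ w) v = U v ∧ not (⁅ w ⁆ v)

∖-not : (U : VSet ν) (w : Fin ν) → (U ∖ w) w ≡ false
∖-not U w rewrite ∈⁅⁆ w with U w
... | true = refl
... | false = refl

∈-∖ : (U : VSet ν) {w v : Fin ν} → U v ≡ true → v ≢ w → (U ∖ w) v ≡ true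
∈-∖ U p q rewrite p | ∉⁅⁆ q = refl

∖-⊆ : (U : VSet ν) (w : Fin ν) {v : Fin ν} → (U ∖ w) v ≡ true → U v ≡ true
∖-⊆ U w p = proj₁ (∧-true⁻ p)

∖-≢ : (U : VSet ν) (w : Fin ν) {v : Fin ν} → (U ∖ w) v ≡ true → v ≢ w
∖-≢ U w p refl = contra p (∖-not U w)

CutsAtLeast-∖ : ∀ {k} {U : VSet ν} {w A} → CutsAtLeast k U A → CutsAtLeast k (U ∖ w) A
CutsAtLeast-∖ {U = U} {w} c X ((u , p , q) , (v , r , s)) = c X ((u , ∖-⊆ U w p , q) , (v , ∖-⊆ U w r , s))

module _ {k} {U : VSet ν} {w x : Fin ν} {e : Edge ν} {R : List (Edge ν)}
  (ek : odd k ≡ false) (U∌w : U w ≡ false) (ev : EvenCuts (e ∷ R)) (sup : Within (U ∪ ⁅ w ⁆) (e ∷ R))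
  (c : CutsAtLeast k U (e ∷ R)) (i : Inc e w x) (x≢w : x ≢ w) where

  private
    Tight : VSet ν → Set
    Tight Y = Separates U Y × Y w ≡ false × Y x ≡ true × cut Y (e ∷ R) ≤ k

    U∋x : U x ≡ true
    U∋x with U x | proj₂ (inside⁻ (U ∪ ⁅ w ⁆) i (sup (here refl)))
    ... | true  | _ = refl
    ... | false | p = ⊥-elim (x≢w (∈⁅⁆⁻ p))

    -- If the union misses a vertex of `U`, uncrossing `Y` and `Z` makes it tight. If not, uncross
    -- `Y` with the complement of `Z`: the edge `e` joins `x`, in `Y` and `Z`, to `w`, in neither,
    -- and so would lie between the two differences.
    tight-∪ : ∀ {Y Z} → Tight Y → Tight Z → Tight (Y ∪ Z)
    tight-∪ {Y} {Z} (sY , Yw , Yx , Y≤) (sZ , Zw , Zx , Z≤)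
      with member? U (∁ (Y ∪ Z))
    ... | yes (u , Uu , out) = s∪ , cong₂ _∨_ Yw Zw , ∨-introˡ Yx , proj₁ (proj₂ un)
      where
      s∪ : Separates U (Y ∪ Z)
      s∪ = (x , U∋x , ∨-introˡ Yx) , (u , Uu , not-true⁻ out)
      s∩ : Separates U (Y ∩ Z)
      s∩ = (x , U∋x , cong₂ _∧_ Yx Zx)
         , (u , Uu , cong (_∧ Z u) (proj₁ (∨-false⁻ {Y u} (not-true⁻ out))))
      un = uncross Y Z (e ∷ R) Y≤ Z≤ (c _ s∩) (c _ s∪)
    ... | no all∪ = ⊥-elim (no-between Y (∁ Z) {e ∷ R} (proj₂ (proj₂ un)) (here refl) (Inc-sym i)
                              Yx (cong not Zx) Yw (cong not Zw))
      where
      covered : ∀ {u} → U u ≡ true → Y u ≡ false → Z u ≡ true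
      covered {u} Uu q with Z u in r
      ... | true  = refl
      ... | false = ⊥-elim (all∪ (u , Uu , cong not (cong₂ _∨_ q r)))
      covered′ : ∀ {u} → U u ≡ true → Z u ≡ false → Y u ≡ true
      covered′ {u} Uu q with Y u in r
      ... | true  = refl
      ... | false = contra (covered Uu r) q
      s∩ : Separates U (Y ∩ ∁ Z)
      s∩ with proj₂ sZ
      ... | u , Uu , Zu = (u , Uu , cong₂ _∧_ (covered′ Uu Zu) (cong not Zu)) , (x , U∋x , cong₂ _∧_ Yx
          (cong not Zx))
      s∪ : Separates U (Y ∪ ∁ Z)
      s∪ with proj₂ sY
      ... | u , Uu , Yu = (x , U∋x , ∨-introˡ Yx) , (u , Uu , cong₂ _∨_ Yu (cong not (covered Uu Yu)))
      un = uncross Y (∁ Z) (e ∷ R) Y≤ (≤-trans (≤-reflexive (cut-∁ Z (e ∷ R))) Z≤) (c _ s∩) (c _ s∪)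

  -- Lovász's splitting theorem for eulerian graphs: the tight sets blocking the
  -- pairs (e , f) would unite to a tight set containing all neighbours of w.
  lovász : (∀ {f y B} → R ↭ f ∷ B → Inc f w y → y ≢ w → CutsAtLeast k U (splice x y e f ∷ B) → ⊥) → ⊥
  lovász none with EvenCuts-partner ev i x≢w
  ... | f₀ , y₀ , B₀ , r₀ , i₀ , y₀≢w =
    blocked r₀ i₀ y₀≢w λ Y₀ t₀ _ → gather Y₀ t₀ R (λ p → p) finish
    where
    blocked : ∀ {f y B} → R ↭ f ∷ B → Inc f w y → y ≢ w → (∀ Y → Tight Y → Y y ≡ true → ⊥) → ⊥
    blocked {f} {y} {B} r j y≢w k′ = none r j y≢w
      (splice-cuts {e = e} {f} {B} ek (EvenCuts-↭ (prep e r) ev) i j (CutsAtLeast-↭ (prep e r) c)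
        λ Y s Yw Yx Yy le → k′ Y (s , Yw , Yx , subst (_≤ k) (sym (cut-↭ Y (prep e r))) le) Yy)

    -- Runs through the edges of `R`; each blocked partner contributes its tight set to the union.
    -- `Y₀` is the start, supplied by the first partner.
    gather : ∀ Y₀ → Tight Y₀ → ∀ L → (∀ {f} → f ∈ L → f ∈ R) →
      (∀ Y → Tight Y → (∀ {f y} → f ∈ L → Inc f w y → y ≢ w → Y y ≡ true) → ⊥) → ⊥
    gather Y₀ t₀ []      sub k′ = k′ Y₀ t₀ (λ ())
    gather Y₀ t₀ (f ∷ L) sub k′ = gather Y₀ t₀ L (λ p → sub (there p)) extend
      where
      extend : ∀ Y → Tight Y → (∀ {f y} → f ∈ L → Inc f w y → y ≢ w → Y y ≡ true) → ⊥
      extend Y t nbr with incident? w f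
      ... | inj₂ (p , q) = k′ Y t λ { (here refl) fwd _ → ⊥-elim (p refl)
                                    ; (here refl) bwd _ → ⊥-elim (q refl)
                                    ; (there f∈) j y≢w → nbr f∈ j y≢w }
      ... | inj₁ (y , j) with y ≟ w
      ... | yes refl = k′ Y t λ { (here refl) j′ y≢w → ⊥-elim (y≢w (Inc-unique j′ j))
                                ; (there f∈) j′ y≢w → nbr f∈ j′ y≢w }
      ... | no y≢w with ∈⇒↭ (sub (here refl))
      ... | B , r = blocked r j y≢w λ Z tZ Zy → k′ (Y ∪ Z) (tight-∪ t tZ)
                      λ { (here refl) j′ _ → trans (cong (Y ∪ Z) (Inc-unique j′ j)) (∨-introʳ {Y y} Zy)
                        ; (there f∈) j′ q → ∨-introˡ (nbr f∈ j′ q) }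

    finish : ∀ Y → Tight Y → (∀ {f y} → f ∈ R → Inc f w y → y ≢ w → Y y ≡ true) → ⊥
    finish Y (((u , Uu , Yu) , (v , Uv , Yv)) , Yw , Yx , Y≤) nbr = <⇒≱ small (c (Y ∪ ⁅ w ⁆) s)
      where
      s : Separates U (Y ∪ ⁅ w ⁆)
      s = (u , Uu , ∨-introˡ Yu) , (v , Uv , cong₂ _∨_ Yv (∉⁅⁆ λ { refl → contra Uv U∌w }))
      total-eq = absorb Y {w} (e ∷ R) Yw
        λ { (here refl) j _ → trans (cong Y (Inc-unique j i)) Yx ; (there f∈) j q → nbr f∈ j q }
      small : cut (Y ∪ ⁅ w ⁆) (e ∷ R) < k
      small = begin-strict
        cut (Y ∪ ⁅ w ⁆) (e ∷ R)                             <⟨ m<m+n _ (subst (λ z → 0 < z + cut ⁅ w ⁆ R)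
            (sym (cut⁅⁆-Inc i x≢w)) (s≤s z≤n)) ⟩
        cut (Y ∪ ⁅ w ⁆) (e ∷ R) + cut ⁅ w ⁆ (e ∷ R)         ≡⟨ total-eq ⟩
        cut Y (e ∷ R)                                       ≤⟨ Y≤ ⟩
        k ∎
        where open ≤-Reasoning

Avoids : Fin ν → List (Edge ν) → Set
Avoids w A = ∀ {e} → e ∈ A → fstEnd e ≢ w × sndEnd e ≢ w

Loopless : Fin ν → List (Edge ν) → Set
Loopless w A = ∀ {e} → e ∈ A → Inc e w w → ⊥

Loopless-↭ : {w : Fin ν} {A B : List (Edge ν)} → A ↭ B → Loopless w A → Loopless w B
Loopless-↭ p l e∈ = l (∈-resp-↭ (↭-sym p) e∈)

uncut-Avoids : {w : Fin ν} {A : List (Edge ν)} → Loopless w A → cut ⁅ w ⁆ A ≡ 0 → Avoids w A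
uncut-Avoids {w = w} {A} l z {e} e∈ with incident? w e
... | inj₂ p = p
... | inj₁ (y , i) with y ≟ w
... | yes refl = ⊥-elim (l e∈ i)
... | no y≢w with trans (sym (cut⁅⁆-Inc i y≢w)) (total-0 A z e∈)
... | ()

-- Since `N` has no edge at `w`, the partner given by `lovász` always lies in `A`, so `A` and `N`
-- are never mixed. Each splitting shortens `A` and creates no loop at `w`, as both far ends differ
-- from `w`.
complete-split : ∀ {k} {U : VSet ν} {w N} → odd k ≡ false → U w ≡ false → Avoids w N →
  ∀ m A → length A ≤ m → Loopless w A →
  Within (U ∪ ⁅ w ⁆) (A ++ N) → EvenCuts (A ++ N) → CutsAtLeast k U (A ++ N) →
  (∀ A′ → A ⇒ A′ → Avoids w A′ → CutsAtLeast k U (A′ ++ N) → ⊥) → ⊥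
complete-split {w = w} ek U∌w avN m A len l sup ev c k′ with cut ⁅ w ⁆ A in eq
... | zero = k′ A ⇒-refl (uncut-Avoids l eq) c
complete-split {w = w} ek U∌w avN zero [] len l sup ev c k′ | suc d with () ← eq
complete-split {U = U} {w} {N} ek U∌w avN (suc m) A len l sup ev c k′ | suc d
  with cut⁅⁆-incident w A (subst (1 ≤_) (sym eq) (s≤s z≤n))
... | e , x , R , p , i , x≢w =
  lovász ek U∌w (EvenCuts-↭ pN ev) (Within-↭ pN sup) (CutsAtLeast-↭ pN c) i x≢w next
  where
  pN = ++⁺ʳ N p
  next : ∀ {f y B} → R ++ N ↭ f ∷ B → Inc f w y → y ≢ w → CutsAtLeast _ U (splice x y e f ∷ B) → ⊥
  next {f} {y} {B} q j y≢w c′ with ∈-++⁻ R (∈-resp-↭ (↭-sym q) (here refl))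
  ... | inj₂ f∈N with avN f∈N | j
  ... | a , b | fwd = a refl
  ... | a , b | bwd = b refl
  next {f} {y} {B} q j y≢w c′ | inj₁ f∈R with ∈⇒↭ f∈R
  ... | R′ , r = complete-split ek U∌w avN m (g ∷ R′) len′ l′ (⇒-Within r⇒ sup) (⇒-EvenCuts r⇒ ev)
      (CutsAtLeast-↭ (prep g B↭) c′) λ A′ s → k′ A′ (split pr i j s)
    where
    g = splice x y e f
    pr : A ↭ e ∷ f ∷ R′
    pr = ↭-trans p (prep e r)
    B↭ : B ↭ R′ ++ N
    B↭ = drop-∷ (↭-trans (↭-sym q) (++⁺ʳ N r))
    r⇒ : A ++ N ⇒ (g ∷ R′) ++ N
    r⇒ = ⇒-++ (split pr i j ⇒-refl) N
    len′ : suc (length R′) ≤ m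
    len′ = s≤s⁻¹ (≤-trans (≤-reflexive (sym (↭-length pr))) len)
    l′ : Loopless w (g ∷ R′)
    l′ (here refl) fwd = x≢w refl
    l′ (here refl) bwd = x≢w refl
    l′ (there g∈) j′ = Loopless-↭ pr l (there (there g∈)) j′

find-loop : (w : Fin ν) (A : List (Edge ν)) → (∃₂ λ l B → A ↭ l ∷ B × Inc l w w) ⊎ Loopless w A
find-loop w [] = inj₂ λ ()
find-loop w (e ∷ A) with find-loop w A
... | inj₁ (l , B , p , i) = inj₁ (l , e ∷ B , ↭-trans (prep e p) (swap e l ↭-refl) , i)
... | inj₂ none with incident? w e
... | inj₂ (p , q) = inj₂ λ { (here refl) fwd → p refl ; (here refl) bwd → q refl ; (there e∈) i → none e∈ i }
... | inj₁ (y , i) with y ≟ w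
... | yes refl = inj₁ (e , A , ↭-refl , i)
... | no y≢w = inj₂ λ { (here refl) j → y≢w (Inc-unique i j) ; (there e∈) j → none e∈ j }

merge-cut : {w x : Fin ν} {e l : Edge ν} (C : List (Edge ν)) → Inc e w x → Inc l w w →
  ∀ X → cut X (splice x w e l ∷ C) ≡ cut X (e ∷ l ∷ C)
merge-cut {w = w} {x} {e} {l} C i j X = begin
  cross (X x) (X w) + cut X C   ≡⟨ cong₂ _+_ (trans (cross-comm (X x) (X w)) (sym (cutE-Inc X i)))
      (cong (_+ cut X C) (sym l≡0)) ⟩
  cutE X e + (cutE X l + cut X C) ∎
  where
  open ≡-Reasoning
  l≡0 : cutE X l ≡ 0
  l≡0 = trans (cutE-Inc X j) (cross-same (X w))

MergedAt : Fin ν → List (Edge ν) → Set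
MergedAt w A =
  ∃ λ A′ → A ⇒ A′ × Loopless w A′ × (∀ X → cut X A′ ≡ cut X A) × (∀ z → Loopless z A → Loopless z A′)

-- Splicing a loop at `w` into a proper edge at `w` changes no cut; the bound on the cut provides
-- such an edge. No loop appears at another vertex, so this can be done at one vertex after another.
merge-loops : (w : Fin ν) → ∀ m A → length A ≤ m → 1 ≤ cut ⁅ w ⁆ A → MergedAt w A
merge-loops w m A len c with find-loop w A
... | inj₂ none = A , ⇒-refl , (λ {e} → none {e}) , (λ _ → refl) , (λ _ lz {e} → lz {e})
merge-loops w zero [] len () | inj₁ _
merge-loops w (suc m) A len c | inj₁ (l , B , p , j)
  with cut⁅⁆-incident w B (subst (1 ≤_) (trans (cut-↭ ⁅ w ⁆ p) (cong (_+ cut ⁅ w ⁆ B) (cut⁅⁆-loop w j))) c)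
... | e , x , C , q , i , x≢w = recurse (merge-loops w m (splice x w e l ∷ C) len′ (subst (1 ≤_)
    (sym (cut-same ⁅ w ⁆)) c))
  where
  pr : A ↭ e ∷ l ∷ C
  pr = ↭-trans p (↭-trans (prep l q) (swap l e ↭-refl))
  len′ : suc (length C) ≤ m
  len′ = s≤s⁻¹ (≤-trans (≤-reflexive (sym (↭-length pr))) len)
  cut-same : ∀ X → cut X (splice x w e l ∷ C) ≡ cut X A
  cut-same X = trans (merge-cut C i j X) (sym (cut-↭ X pr))
  recurse : MergedAt w (splice x w e l ∷ C) → MergedAt w A
  recurse (A′ , r , ll , same , keep) =
    A′ , split pr i j r , ll , (λ X → trans (same X) (cut-same X)) ,
    (λ z lz → keep z λ { (here refl) fwd → x≢w refl ; (here refl) bwd → x≢w refl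
                       ; (there g∈) k → Loopless-↭ {w = z} pr lz (there (there g∈)) k })

-- Closed trails

-- The last equation says that the trail passes `t` only once: if `e` is not a loop, exactly one
-- proper edge of `K` returns to `t`.
Trail : Fin ν → Edge ν → List (Edge ν) → Set
Trail t e A = ∃₂ λ K B → A ↭ K ++ B × EvenCuts (e ∷ K) × EvenCuts B × Conn t
    (e ∷ K) × cut ⁅ t ⁆ K ≡ cutE ⁅ t ⁆ e

-- The trail starting with e = t x is continued by splitting at x, until the first edge has become a loop at t.
closed-trail : ∀ m {A : List (Edge ν)} {e t x} → length A ≤ m → EvenCuts (e ∷ A) → Inc e t x → Trail t e A
closed-trail m {A} {e} {t} {x} len ev i with x ≟ t
... | yes refl = [] , A , ↭-refl , ev-e , EvenCuts-++⁻ʳ (e ∷ []) {A} ev ev-e , conn , sym (cut⁅⁆-loop t i)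
  where
  ev-e : EvenCuts (e ∷ [])
  ev-e X = cong (λ z → odd (z + 0)) (trans (cutE-Inc X i) (cross-same (X x)))
  conn : Conn x (e ∷ [])
  conn X Xr _ (here refl) = inside⁺ X i Xr Xr
... | no x≢t with EvenCuts-partner {A = A} ev (Inc-sym i) (λ t≡x → x≢t (sym t≡x))
closed-trail zero {[]} len ev i | no x≢t | f , y , B , p , j , y≢x with () ← ↭-length p
closed-trail (suc m) {A} {e} {t} {x} len ev i | no x≢t | f , y , B , p , j , y≢x
  with closed-trail m {B} {splice t y e f} {t} {y} (s≤s⁻¹ (≤-trans (≤-reflexive (sym (↭-length p))) len))
         (⇒-EvenCuts {A = e ∷ A} {B = splice t y e f ∷ B} (split (prep e p) (Inc-sym i) j ⇒-refl) ev) fwd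
... | K , C , q , evK , evC , conn , eq =
  f ∷ K , C , ↭-trans p (prep f q) , ⇒-EvenCuts⁻ {B = splice t y e f ∷ K} s evK , evC , ⇒-Conn s conn , cut-t
  where
  s : e ∷ f ∷ K ⇒ splice t y e f ∷ K
  s = split ↭-refl (Inc-sym i) j ⇒-refl
  bool : ∀ b → cross false b + cross true b ≡ cross true false
  bool true  = refl
  bool false = refl
  cut-t : cutE ⁅ t ⁆ f + cut ⁅ t ⁆ K ≡ cutE ⁅ t ⁆ e
  cut-t = begin
    cutE ⁅ t ⁆ f + cut ⁅ t ⁆ K ≡⟨ cong₂ _+_ (cutE-Inc ⁅ t ⁆ j) eq ⟩
    cross (⁅ t ⁆ x) (⁅ t ⁆ y) + cross (⁅ t ⁆ t) (⁅ t ⁆ y)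
      ≡⟨ cong₂ (λ a b → cross a (⁅ t ⁆ y) + cross b (⁅ t ⁆ y)) (∉⁅⁆ x≢t) (∈⁅⁆ t) ⟩
    cross false (⁅ t ⁆ y) + cross true (⁅ t ⁆ y) ≡⟨ bool (⁅ t ⁆ y) ⟩
    1 ≡⟨ sym (cut⁅⁆-Inc i x≢t) ⟩
    cutE ⁅ t ⁆ e ∎
    where open ≡-Reasoning

record TrailAt {ν : ℕ} (t : Fin ν) (K : List (Edge ν)) : Set where
  constructor trailAt
  field
    even  : EvenCuts K
    cut≡2 : cut ⁅ t ⁆ K ≡ 2
    conn  : Conn t K

trails-at : (t : Fin ν) → ∀ m A → length A ≤ m → EvenCuts A →
  ∃₂ λ Ks M → A ↭ concat Ks ++ M × All (TrailAt t) Ks × EvenCuts M × cut ⁅ t ⁆ M ≡ 0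
trails-at t m A len ev with cut ⁅ t ⁆ A in eq
... | zero = [] , A , ↭-refl , [] , ev , eq
trails-at t zero [] len ev | suc d with () ← eq
trails-at t (suc m) A len ev | suc d with cut⁅⁆-incident t A (subst (1 ≤_) (sym eq) (s≤s z≤n))
... | e , x , B , p , i , x≢t with closed-trail (length B) {B} {e} ≤-refl (EvenCuts-↭ p ev) i
... | K , C , q , evK , evC , connK , eqK
  with trails-at t m C (≤-trans (m≤n+m (length C) (length K))
      (≤-trans (≤-reflexive (sym (trans (↭-length q) (length-++ K))))
      (s≤s⁻¹ (≤-trans (≤-reflexive (sym (↭-length p))) len)))) evC
... | Ks , M , r , all , evM , zM =
  (e ∷ K) ∷ Ks , M
  , ↭-trans p (prep e (↭-trans q (↭-trans (++⁺ˡ K r) (↭-reflexive (sym (++-assoc K (concat Ks) M))))))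
  , trailAt evK (trans (cong (cutE ⁅ t ⁆ e +_) eqK) (cong₂ _+_ (cut⁅⁆-Inc i x≢t) (cut⁅⁆-Inc i x≢t))) connK ∷ all
  , evM , zM

-- Odd parts and decomposability

OddPart : List (Edge ν) → Set
OddPart A = EvenCuts A × par A ≡ true

RootedPart : Fin ν → List (Edge ν) → Set
RootedPart r A = OddPart A × Conn r A

ThreeParts : (List (Edge ν) → Set) → List (Edge ν) → Set
ThreeParts P H = ∃₂ λ A B → ∃ λ C → H ↭ A ++ B ++ C × P A × P B × P C

Decomposable : List (Edge ν) → Set
Decomposable H = ∃ λ r → ThreeParts (RootedPart r) H

⇒-RootedPart : {r : Fin ν} {A B : List (Edge ν)} → A ⇒ B → RootedPart r B → RootedPart r A
⇒-RootedPart s ((ev , odd-B) , conn) = (⇒-EvenCuts⁻ s ev , trans (⇒-par s) odd-B) , ⇒-Conn s conn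

⇒-Decomposable : {H H′ : List (Edge ν)} → H ⇒ H′ → Decomposable H′ → Decomposable H
⇒-Decomposable s (r , A , B , C , p , a , b , c) with ⇒-split s p
... | A₁ , BC , q , sA , sBC with ⇒-split sBC ↭-refl
... | B₁ , C₁ , q′ , sB , sC =
  r , A₁ , B₁ , C₁ , ↭-trans q (++⁺ˡ A₁ q′) , ⇒-RootedPart sA a , ⇒-RootedPart sB b , ⇒-RootedPart sC c

count-mono : ∀ {k} (X Y : Fin k → Bool) → (∀ v → X v ≡ true → Y v ≡ true) → count X ≤ count Y
count-mono {zero} X Y sub = z≤n
count-mono {suc k} X Y sub with X Fin.zero in p | Y Fin.zero in q
... | true  | true  = s≤s (count-mono (λ i → X (Fin.suc i)) (λ i → Y (Fin.suc i)) (λ v → sub (Fin.suc v)))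
... | true  | false = contra (sub Fin.zero p) q
... | false | true  = m≤n⇒m≤1+n (count-mono (λ i → X (Fin.suc i)) (λ i → Y (Fin.suc i)) (λ v → sub (Fin.suc v)))
... | false | false = count-mono (λ i → X (Fin.suc i)) (λ i → Y (Fin.suc i)) (λ v → sub (Fin.suc v))

count-strict : ∀ {k} (X Y : Fin k → Bool) → (∀ v → X v ≡ true → Y v ≡ true) →
  ∀ w → X w ≡ false → Y w ≡ true → count X < count Y
count-strict {suc k} X Y sub Fin.zero p q rewrite p | q =
  s≤s (count-mono (λ i → X (Fin.suc i)) (λ i → Y (Fin.suc i)) (λ v → sub (Fin.suc v)))
count-strict {suc k} X Y sub (Fin.suc w) p q with X Fin.zero in p₀ | Y Fin.zero in q₀
... | true  | true  = s≤s (count-strict (λ i → X (Fin.suc i)) (λ i → Y (Fin.suc i))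
    (λ v → sub (Fin.suc v)) w p q)
... | true  | false = contra (sub Fin.zero p₀) q₀
... | false | true  = m≤n⇒m≤1+n (count-strict (λ i → X (Fin.suc i)) (λ i → Y (Fin.suc i))
    (λ v → sub (Fin.suc v)) w p q)
... | false | false = count-strict (λ i → X (Fin.suc i)) (λ i → Y (Fin.suc i)) (λ v → sub (Fin.suc v)) w p q

Within-⊆ : {U X : VSet ν} {A : List (Edge ν)} → (∀ {v} → U v ≡ true → X v ≡ true) → Within U A → Within X A
Within-⊆ sub w e∈ = sub (proj₁ (w e∈)) , sub (proj₂ (w e∈))

⊆-∖∪ : (U : VSet ν) (w : Fin ν) → ∀ {v} → U v ≡ true → ((U ∖ w) ∪ ⁅ w ⁆) v ≡ true
⊆-∖∪ U w {v} p with v ≟ w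
... | yes refl rewrite p = refl
... | no _     rewrite p = refl

Within-∖ : {U : VSet ν} {w : Fin ν} {A : List (Edge ν)} → Within U A → Avoids w A → Within (U ∖ w) A
Within-∖ {U = U} sup av e∈ = ∈-∖ U (proj₁ (sup e∈)) (proj₁ (av e∈)) , ∈-∖ U (proj₂ (sup e∈)) (proj₂ (av e∈))

-- Moving t into a tight set Y containing the other ends of four of its at most six edges makes the cut too small.
push : ∀ {U Y : VSet ν} {t A B H} → CutsAtLeast 6 U H → H ↭ A ++ B →
  Separates U Y → (∃ λ u → U u ≡ true × u ≢ t × Y u ≡ false) → Y t ≡ false → cut Y H ≤ 6 →
  (∀ {e y} → e ∈ A → Inc e t y → y ≢ t → Y y ≡ true) → cut ⁅ t ⁆ A ≡ 4 → cut ⁅ t ⁆ B ≡ 2 → ⊥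
push {U = U} {Y} {t} {A} {B} {H} c p ((u , Uu , Yu) , _) (v , Uv , v≢t , Yv) Yt le nbr cA cB =
  <⇒≱ (≤-trans (s≤s (+-cancelʳ-≤ 4 (cut (Y ∪ ⁅ t ⁆) H) 4 small)) (s≤s (s≤s (s≤s (s≤s (s≤s z≤n))))))
      (c (Y ∪ ⁅ t ⁆) ((u , Uu , ∨-introˡ Yu) , (v , Uv , cong₂ _∨_ Yv (∉⁅⁆ v≢t))))
  where
  open ≤-Reasoning
  small : cut (Y ∪ ⁅ t ⁆) H + 4 ≤ 8
  small = begin
    cut (Y ∪ ⁅ t ⁆) H + 4
      ≡⟨ cong₂ _+_ (trans (cut-↭ (Y ∪ ⁅ t ⁆) p) (cut-++ (Y ∪ ⁅ t ⁆) A B)) (sym cA) ⟩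
    (cut (Y ∪ ⁅ t ⁆) A + cut (Y ∪ ⁅ t ⁆) B) + cut ⁅ t ⁆ A
      ≤⟨ +-monoˡ-≤ (cut ⁅ t ⁆ A) (+-monoʳ-≤ (cut (Y ∪ ⁅ t ⁆) A) (absorb-≤ Y B)) ⟩
    (cut (Y ∪ ⁅ t ⁆) A + (cut Y B + cut ⁅ t ⁆ B)) + cut ⁅ t ⁆ A
      ≡⟨ solve 4 (λ a b c d → (a :+ (b :+ c)) :+ d := (a :+ d) :+ b :+ c) refl (cut (Y ∪ ⁅ t ⁆) A) (cut Y B)
          (cut ⁅ t ⁆ B) (cut ⁅ t ⁆ A) ⟩
    (cut (Y ∪ ⁅ t ⁆) A + cut ⁅ t ⁆ A) + cut Y B + cut ⁅ t ⁆ B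
      ≡⟨ cong₂ (λ a b → a + cut Y B + b) (absorb Y A Yt nbr) cB ⟩
    cut Y A + cut Y B + 2
      ≡⟨ cong (_+ 2) (sym (trans (cut-↭ Y p) (cut-++ Y A B))) ⟩
    cut Y H + 2
      ≤⟨ +-monoˡ-≤ 2 le ⟩
    8 ∎
    where open +-*-Solver

-- Two parts through a vertex

-- Each part stays connected when `N` is added to it, so that `N` can later go to whichever part has
-- the wrong parity.
TwoParts : Fin ν → List (Edge ν) → List (Edge ν) → Set
TwoParts s N H = ∃₂ λ A B → H ↭ A ++ B × Part A × Part B
  where
  Part : List (Edge _) → Set
  Part A = EvenCuts A × Conn s A × Conn s (A ++ N)

⇒-TwoParts : {s : Fin ν} {N H H′ : List (Edge ν)} → H ⇒ H′ → TwoParts s N H′ → TwoParts s N H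
⇒-TwoParts {N = N} r (A , B , p , (evA , cA , cAN) , (evB , cB , cBN)) with ⇒-split r p
... | A₁ , B₁ , q , rA , rB = A₁ , B₁ , q ,
  (⇒-EvenCuts⁻ rA evA , ⇒-Conn rA cA , ⇒-Conn (⇒-++ rA N) cAN) ,
  (⇒-EvenCuts⁻ rB evB , ⇒-Conn rB cB , ⇒-Conn (⇒-++ rB N) cBN)

EvenCuts-digon : {w x : Fin ν} {e f : Edge ν} → Inc e w x → Inc f w x → EvenCuts (e ∷ f ∷ [])
EvenCuts-digon {w = w} {x} i j X = trans (cong₂ (λ a b → odd (a + (b + 0))) (cutE-Inc X i) (cutE-Inc X j))
    (bool (X w) (X x))
  where
  bool : ∀ a b → odd (cross a b + (cross a b + 0)) ≡ false
  bool true  true  = refl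
  bool true  false = refl
  bool false true  = refl
  bool false false = refl

Conn-digon : {w x : Fin ν} {e f : Edge ν} → Inc e w x → Inc f w x → Conn w (e ∷ f ∷ [])
Conn-digon {e = e} i j X Xw z = Within-∷ (inside⁺ X i Xw Xx) (Within-∷ (inside⁺ X j Xw Xx) λ ())
  where
  Xx = trans (sym (uncut X i (m+n≡0⇒m≡0 (cutE X e) z))) Xw

module _ {U : VSet ν} {s z y : Fin ν} {a₁ a₂ e f : Edge ν} {L : List (Edge ν)}
  (only : ∀ {v} → U v ≡ true → v ≡ s ⊎ v ≡ z ⊎ v ≡ y)
  (Us : U s ≡ true) (Uz : U z ≡ true) (Uy : U y ≡ true)
  (i₁ : Inc a₁ s z) (i₂ : Inc a₂ s z) (j₁ : Inc e z y) (j₂ : Inc f z y)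
  (sup : Within U (a₁ ∷ a₂ ∷ L)) (ev : EvenCuts (a₁ ∷ a₂ ∷ L)) (l : Loopless z L)
  (c : CutsAtLeast 4 U ((a₁ ∷ a₂ ∷ L) ++ e ∷ f ∷ [])) where

  private
    N : List (Edge ν)
    N = e ∷ f ∷ []

    cut-eq : ∀ X → X s ≡ true → cut X L ≡ 0 → cut X ((a₁ ∷ a₂ ∷ L) ++ N)
      ≡ (cross true (X z) + cross true (X z)) + (cross (X z) (X y) + cross (X z) (X y))
    cut-eq X Xs zL = begin
      cutE X a₁ + (cutE X a₂ + cut X (L ++ N))
        ≡⟨ cong (λ k → cutE X a₁ + (cutE X a₂ + k)) (trans (cut-++ X L N) (cong (_+ cut X N) zL)) ⟩
      cutE X a₁ + (cutE X a₂ + (cutE X e + (cutE X f + 0)))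
        ≡⟨ cong₂ (λ k m → k + (m + (cutE X e + (cutE X f + 0)))) (at-s i₁) (at-s i₂) ⟩
      cross true (X z) + (cross true (X z) + (cutE X e + (cutE X f + 0)))
        ≡⟨ cong₂ (λ k m → cross true (X z) + (cross true (X z) + (k + (m + 0)))) (cutE-Inc X j₁)
            (cutE-Inc X j₂) ⟩
      cross true (X z) + (cross true (X z) + (cross (X z) (X y) + (cross (X z) (X y) + 0)))
        ≡⟨ solve 2 (λ a b → a :+ (a :+ (b :+ (b :+ con 0))) := (a :+ a) :+ (b :+ b)) refl (cross true (X z))
            (cross (X z) (X y)) ⟩
      (cross true (X z) + cross true (X z)) + (cross (X z) (X y) + cross (X z) (X y)) ∎
      where
      open ≡-Reasoning
      open +-*-Solver
      at-s : ∀ {a} → Inc a s z → cutE X a ≡ cross true (X z)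
      at-s i = trans (cutE-Inc X i) (cong (λ b → cross b (X z)) Xs)

    ¬4≤2 : ¬ 4 ≤ 2
    ¬4≤2 (s≤s (s≤s ()))

    bound : ∀ X → X s ≡ true → cut X L ≡ 0 → ∀ {a b} → X z ≡ a → X y ≡ b → a ∧ b ≡ false →
      4 ≤ (cross true a + cross true a) + (cross a b + cross a b)
    bound X Xs zL {a} {b} refl refl ab = subst (4 ≤_) (cut-eq X Xs zL) (c X ((s , Us , Xs) , out (X z) refl ab))
      where
      out : ∀ a → X z ≡ a → a ∧ X y ≡ false → ∃ λ u → U u ≡ true × X u ≡ false
      out true  _ q = y , Uy , q
      out false p q = z , Uz , p

    all-in : ∀ (X : VSet ν) → X s ≡ true → X z ≡ true → X y ≡ true → ∀ {v} → U v ≡ true → X v ≡ true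
    all-in X Xs Xz Xy Uv with only Uv
    ... | inj₁ refl = Xs
    ... | inj₂ (inj₁ refl) = Xz
    ... | inj₂ (inj₂ refl) = Xy

    sup-L : Within U L
    sup-L p = sup (there (there p))

    -- If no edge of `L` leaves `X`, only the double edges from `s` to `z` and from `z` to `y` can,
    -- and one of them alone gives a cut of two, less than four. If both do, `X` misses only `z`,
    -- and `L`, being loopless at `z`, has no edge there.
    conn-L : Conn s L
    conn-L X Xs zL with X z in Xz | X y in Xy
    ... | true  | true  = Within-⊆ {U = U} {X} (all-in X Xs Xz Xy) sup-L
    ... | true  | false = ⊥-elim (¬4≤2 (bound X Xs zL Xz Xy refl))
    ... | false | false = ⊥-elim (¬4≤2 (bound X Xs zL Xz Xy refl))
    ... | false | true  = λ g∈ → inside _ g∈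
      where
      not-z : ∀ {v} → U v ≡ true → v ≢ z → X v ≡ true
      not-z Uv v≢z with only Uv
      ... | inj₁ refl = Xs
      ... | inj₂ (inj₁ refl) = ⊥-elim (v≢z refl)
      ... | inj₂ (inj₂ refl) = Xy
      is-z : ∀ {v} → U v ≡ true → X v ≡ false → v ≡ z
      is-z {v} Uv Xv with v ≟ z
      ... | yes p = p
      ... | no ¬p = contra (not-z Uv ¬p) Xv
      inside : ∀ g → g ∈ L → Inside X g
      inside g g∈ with incident? z g
      ... | inj₂ (p , q) = not-z (proj₁ (sup-L g∈)) p , not-z (proj₂ (sup-L g∈)) q
      ... | inj₁ (v , i) with is-z (proj₂ (inside⁻ U i (sup-L g∈)))
          (trans (sym (uncut X i (total-0 L zL g∈))) Xz)
      ... | refl = ⊥-elim (l g∈ i)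

    conn-LN : Conn s (L ++ N)
    conn-LN X Xs zLN = go (X z) (X y) refl refl
      where
      zL = m+n≡0⇒m≡0 (cut X L) (trans (sym (cut-++ X L N)) zLN)
      zN = m+n≡0⇒n≡0 (cut X L) (trans (sym (cut-++ X L N)) zLN)
      same : X z ≡ X y
      same = uncut X j₁ (m+n≡0⇒m≡0 (cutE X e) zN)
      go : ∀ a b → X z ≡ a → X y ≡ b → Within X (L ++ N)
      go true  true  p q = Within-++ L (Within-⊆ {U = U} {X} (all-in X Xs p q) sup-L)
                             (Within-∷ (inside⁺ X j₁ p q) (Within-∷ (inside⁺ X j₂ p q) λ ()))
      go true  false p q = contra p (trans same q)
      go false true  p q = contra q (trans (sym same) p)
      go false false p q = ⊥-elim (¬4≤2 (bound X Xs zL p q refl))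

    conn-aN : Conn s ((a₁ ∷ a₂ ∷ []) ++ N)
    conn-aN X Xs z′ = Within-++ (a₁ ∷ a₂ ∷ []) wa
      (Conn-digon j₁ j₂ X (proj₂ (inside⁻ X i₁ (wa (here refl)))) (m+n≡0⇒n≡0 (cut X (a₁ ∷ a₂ ∷ [])) z″))
      where
      z″ = trans (sym (cut-++ X (a₁ ∷ a₂ ∷ []) N)) z′
      wa = Conn-digon i₁ i₂ X Xs (m+n≡0⇒m≡0 (cut X (a₁ ∷ a₂ ∷ [])) z″)

  twoParts-of-pair : TwoParts s N (a₁ ∷ a₂ ∷ L)
  twoParts-of-pair = a₁ ∷ a₂ ∷ [] , L , ↭-refl
    , (EvenCuts-digon i₁ i₂ , Conn-digon i₁ i₂ , conn-aN)
    , (EvenCuts-++⁻ʳ (a₁ ∷ a₂ ∷ []) {L} ev (EvenCuts-digon i₁ i₂) , conn-L , conn-LN)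

cut-Avoids : {w : Fin ν} (A : List (Edge ν)) → Avoids w A → cut ⁅ w ⁆ A ≡ 0
cut-Avoids A av = 0-total A λ {g} g∈ → cut⁅⁆-avoid {e = g} (av g∈)

avoid-digon : {v u w : Fin ν} {g : Edge ν} → w ≢ v → w ≢ u → Inc g v u → fstEnd g ≢ w × sndEnd g ≢ w
avoid-digon p q fwd = (λ r → p (sym r)) , (λ r → q (sym r))
avoid-digon p q bwd = (λ r → q (sym r)) , (λ r → p (sym r))

Avoids-digon : {v u w : Fin ν} {e f : Edge ν} → Inc e v u → Inc f v u → w ≢ v → w ≢ u → Avoids w (e ∷ f ∷ [])
Avoids-digon j₁ j₂ p q (here refl)         = avoid-digon p q j₁
Avoids-digon j₁ j₂ p q (there (here refl)) = avoid-digon p q j₂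

module _ {U : VSet ν} {s v u : Fin ν} {e f : Edge ν}
  (s≢v : s ≢ v) (s≢u : s ≢ u) (v≢u : v ≢ u)
  (Us : U s ≡ true) (Uv : U v ≡ true) (Uu : U u ≡ true) (j₁ : Inc e v u) (j₂ : Inc f v u) where

  private
    N : List (Edge ν)
    N = e ∷ f ∷ []

  -- The digon `N` misses `s`, so `H` alone has at least four edges from `s` to `v` or `u`. Among
  -- three of them two have the same other end.
  twoParts-triangle : ∀ {H} → (∀ {x} → U x ≡ true → x ≡ s ⊎ x ≡ v ⊎ x ≡ u) →
    Within U H → EvenCuts H → Loopless v H → Loopless u H → CutsAtLeast 4 U (H ++ N) → TwoParts s N H
  twoParts-triangle {H} only sup ev lv lu c = three (cut⁅⁆-incident s H (≤-trans (s≤s z≤n) cut-s))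
    where
    cut-s : 4 ≤ cut ⁅ s ⁆ H
    cut-s = subst (4 ≤_) (trans (cut-++ ⁅ s ⁆ H N) (trans (cong (cut ⁅ s ⁆ H +_) (cut-Avoids N
        (Avoids-digon j₁ j₂ s≢v s≢u))) (+-identityʳ _)))
              (c ⁅ s ⁆ ((s , Us , ∈⁅⁆ s) , (v , Uv , ∉⁅⁆ (λ p → s≢v (sym p)))))
    fewer : ∀ {k g x A B} → A ↭ g ∷ B → Inc g s x → x ≢ s → suc k ≤ cut ⁅ s ⁆ A → k ≤ cut ⁅ s ⁆ B
    fewer {B = B} p i x≢s le = s≤s⁻¹ (subst (_ ≤_) (trans (cut-↭ ⁅ s ⁆ p) (cong (_+ cut ⁅ s ⁆ B)
        (cut⁅⁆-Inc i x≢s))) le)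
    end : ∀ {g x} → g ∈ H → Inc g s x → x ≢ s → x ≡ v ⊎ x ≡ u
    end g∈ i x≢s with only (proj₂ (inside⁻ U i (sup g∈)))
    ... | inj₁ p = ⊥-elim (x≢s p)
    ... | inj₂ q = q
    toV : ∀ {a₁ a₂ L} → H ↭ a₁ ∷ a₂ ∷ L → Inc a₁ s v → Inc a₂ s v → TwoParts s N H
    toV p i₁ i₂ = ⇒-TwoParts (done p) (twoParts-of-pair only Us Uv Uu i₁ i₂ j₁ j₂ (Within-↭ p sup)
        (EvenCuts-↭ p ev)
      (λ g∈ → Loopless-↭ p lv (there (there g∈))) (CutsAtLeast-↭ (++⁺ʳ N p) c))
    toU : ∀ {a₁ a₂ L} → H ↭ a₁ ∷ a₂ ∷ L → Inc a₁ s u → Inc a₂ s u → TwoParts s N H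
    toU p i₁ i₂ = ⇒-TwoParts (done p) (twoParts-of-pair only′ Us Uu Uv i₁ i₂ (Inc-sym j₁) (Inc-sym j₂)
        (Within-↭ p sup) (EvenCuts-↭ p ev)
      (λ g∈ → Loopless-↭ p lu (there (there g∈))) (CutsAtLeast-↭ (++⁺ʳ N p) c))
      where
      only′ : ∀ {x} → U x ≡ true → x ≡ s ⊎ x ≡ u ⊎ x ≡ v
      only′ Ux with only Ux
      ... | inj₁ p = inj₁ p
      ... | inj₂ (inj₁ p) = inj₂ (inj₂ p)
      ... | inj₂ (inj₂ p) = inj₂ (inj₁ p)
    three : (∃₂ λ g x → ∃ λ B → H ↭ g ∷ B × Inc g s x × x ≢ s) → TwoParts s N H
    three (a₁ , x₁ , B₁ , p₁ , i₁ , q₁) with cut⁅⁆-incident s B₁ (≤-trans (s≤s z≤n) (fewer p₁ i₁ q₁ cut-s))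
    ... | a₂ , x₂ , B₂ , p₂ , i₂ , q₂ with cut⁅⁆-incident s B₂ (≤-trans (s≤s z≤n) (fewer p₂ i₂ q₂
        (fewer p₁ i₁ q₁ cut-s)))
    ... | a₃ , x₃ , B₃ , p₃ , i₃ , q₃ =
      choose (end (in-H (here refl)) i₁ q₁) (end (in-H (there (here refl))) i₂ q₂)
          (end (in-H (there (there (here refl)))) i₃ q₃)
      where
      H↭ : H ↭ a₁ ∷ a₂ ∷ a₃ ∷ B₃
      H↭ = ↭-trans p₁ (prep a₁ (↭-trans p₂ (prep a₂ p₃)))
      H↭₁₃ : H ↭ a₁ ∷ a₃ ∷ a₂ ∷ B₃
      H↭₁₃ = ↭-trans H↭ (prep a₁ (swap a₂ a₃ ↭-refl))
      H↭₂₃ : H ↭ a₂ ∷ a₃ ∷ a₁ ∷ B₃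
      H↭₂₃ = ↭-trans H↭ (↭-trans (swap a₁ a₂ ↭-refl) (prep a₂ (swap a₁ a₃ ↭-refl)))
      in-H : ∀ {g} → g ∈ a₁ ∷ a₂ ∷ a₃ ∷ B₃ → g ∈ H
      in-H = ∈-resp-↭ (↭-sym H↭)
      choose : x₁ ≡ v ⊎ x₁ ≡ u → x₂ ≡ v ⊎ x₂ ≡ u → x₃ ≡ v ⊎ x₃ ≡ u → TwoParts s N H
      choose (inj₁ refl) (inj₁ refl) _           = toV H↭ i₁ i₂
      choose (inj₁ refl) (inj₂ refl) (inj₁ refl) = toV H↭₁₃ i₁ i₃
      choose (inj₁ refl) (inj₂ refl) (inj₂ refl) = toU H↭₂₃ i₂ i₃
      choose (inj₂ refl) (inj₂ refl) _           = toU H↭ i₁ i₂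
      choose (inj₂ refl) (inj₁ refl) (inj₂ refl) = toU H↭₁₃ i₁ i₃
      choose (inj₂ refl) (inj₁ refl) (inj₁ refl) = toV H↭₂₃ i₂ i₃

module _ {s v u : Fin ν} {e f : Edge ν} (s≢v : s ≢ v) (s≢u : s ≢ u) (v≢u : v ≢ u)
  (j₁ : Inc e v u) (j₂ : Inc f v u) where

  private
    N : List (Edge ν)
    N = e ∷ f ∷ []

    -- At most two of the four edges belong to `N`, so `H` keeps a proper edge at `w`, as
    -- `merge-loops` demands.
    cut-at : ∀ {U : VSet ν} H {w} → CutsAtLeast 4 U (H ++ N) → U w ≡ true → (∃ λ x → U x ≡ true × x ≢ w) →
        1 ≤ cut ⁅ w ⁆ H
    cut-at {U = U} H {w} c Uw (x , Ux , x≢w) = +-cancelʳ-≤ 2 1 (cut ⁅ w ⁆ H) (≤-trans (s≤s (s≤s (s≤s z≤n)))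
      (≤-trans (c ⁅ w ⁆ ((w , Uw , ∈⁅⁆ w) , (x , Ux , ∉⁅⁆ x≢w)))
        (≤-trans (≤-reflexive (cut-++ ⁅ w ⁆ H N)) (+-monoʳ-≤ (cut ⁅ w ⁆ H) (cut-pair≤2 ⁅ w ⁆ e f)))))

    same-cuts : ∀ {U : VSet ν} {H H′} → (∀ X → cut X H′ ≡ cut X H) → CutsAtLeast 4 U (H ++ N) →
        CutsAtLeast 4 U (H′ ++ N)
    same-cuts {H = H} {H′} eq c X sep = ≤-trans (c X sep)
      (≤-reflexive (trans (cut-++ X H N) (trans (cong (_+ cut X N) (sym (eq X))) (sym (cut-++ X H′ N)))))

  -- All vertices but s, v, u are split off, keeping the digon N; then two edges from s
  -- to the same end of N form one part.
  twoParts : ∀ m {U : VSet ν} {H} → count U ≤ m → U s ≡ true → U v ≡ true → U u ≡ true →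
    Within U H → EvenCuts H → CutsAtLeast 4 U (H ++ N) → (TwoParts s N H → ⊥) → ⊥
  twoParts m {U} {H} size Us Uv Uu sup ev c k
    with any? (λ w → (((U ∖ s) ∖ v) ∖ u) w ≟ᵇ true)
  -- Splittings may have left loops at `v` and `u`, which the triangle case excludes.
  ... | no none with merge-loops v (length H) H ≤-refl (cut-at {U = U} H c Uv (s , Us , s≢v))
  ... | H₁ , r₁ , lv , eq₁ , _
    with merge-loops u (length H₁) H₁ ≤-refl (subst (1 ≤_) (sym (eq₁ ⁅ u ⁆)) (cut-at {U = U} H c Uu
        (s , Us , s≢u)))
  ... | H₂ , r₂ , lu , eq₂ , keep =
    k (⇒-TwoParts r (twoParts-triangle s≢v s≢u v≢u Us Uv Uu j₁ j₂ only (⇒-Within r sup) (⇒-EvenCuts {A = H} r ev) (keep v lv) lu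
      (same-cuts {U = U} {H} {H₂} (λ X → trans (eq₂ X) (eq₁ X)) c)))
    where
    r = ⇒-trans r₁ r₂
    only : ∀ {x} → U x ≡ true → x ≡ s ⊎ x ≡ v ⊎ x ≡ u
    only {x} Ux with x ≟ s | x ≟ v | x ≟ u
    ... | yes p | _ | _ = inj₁ p
    ... | no _ | yes p | _ = inj₂ (inj₁ p)
    ... | no _ | no _ | yes p = inj₂ (inj₂ p)
    ... | no p | no q | no r = ⊥-elim (none (x , ∈-∖ ((U ∖ s) ∖ v) (∈-∖ (U ∖ s) (∈-∖ U Ux p) q) r))
  twoParts zero {U} size Us Uv Uu sup ev c k | yes (w , w∈) =
    <⇒≱ (count-strict (λ _ → false) U (λ _ ()) w refl (∖-⊆ U s (∖-⊆ (U ∖ s) v (∖-⊆ ((U ∖ s) ∖ v) u w∈))))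
        (≤-trans size z≤n)
  twoParts (suc m) {U} {H} size Us Uv Uu sup ev c k | yes (w , w∈)
    with merge-loops w (length H) H ≤-refl (cut-at {U = U} H c
        (∖-⊆ U s (∖-⊆ (U ∖ s) v (∖-⊆ ((U ∖ s) ∖ v) u w∈))) (s , Us , λ p → ∖-≢ U s (∖-⊆ (U ∖ s) v
        (∖-⊆ ((U ∖ s) ∖ v) u w∈)) (sym p)))
  ... | H₁ , r₁ , lw , eq₁ , _ =
    complete-split {U = U ∖ w} refl (∖-not U w) (Avoids-digon j₁ j₂ w≢v w≢u) (length H₁) H₁ ≤-refl lw
      (Within-⊆ {U = U} (⊆-∖∪ U w) (Within-++ H₁ (⇒-Within r₁ sup) sup-N))
      (EvenCuts-++ {A = H₁} (⇒-EvenCuts {A = H} r₁ ev) (EvenCuts-digon j₁ j₂))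
      (CutsAtLeast-∖ {U = U} {w} {H₁ ++ N} (same-cuts {U = U} {H} {H₁} eq₁ c))
      λ H₂ r₂ av c₂ → twoParts m size′ (∈-∖ U Us (λ p → w≢s (sym p))) (∈-∖ U Uv (λ p → w≢v (sym p)))
          (∈-∖ U Uu (λ p → w≢u (sym p)))
        (Within-∖ (⇒-Within r₂ (⇒-Within r₁ sup)) av) (⇒-EvenCuts {A = H₁} r₂ (⇒-EvenCuts {A = H} r₁ ev)) c₂
        λ two → k (⇒-TwoParts (⇒-trans r₁ r₂) two)
    where
    w∈₂ = ∖-⊆ ((U ∖ s) ∖ v) u w∈
    w∈₁ = ∖-⊆ (U ∖ s) v w∈₂
    Uw  = ∖-⊆ U s w∈₁
    w≢s = ∖-≢ U s w∈₁
    w≢v = ∖-≢ (U ∖ s) v w∈₂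
    w≢u = ∖-≢ ((U ∖ s) ∖ v) u w∈
    sup-N : Within U N
    sup-N (here refl)         = inside⁺ U j₁ Uv Uu
    sup-N (there (here refl)) = inside⁺ U j₂ Uv Uu
    size′ : count (U ∖ w) ≤ m
    size′ = s≤s⁻¹ (≤-trans (count-strict (U ∖ w) U (λ x → ∖-⊆ U w) w (∖-not U w) Uw) size)

-- A minimal counterexample

endpoints : List (Edge ν) → VSet ν
endpoints []      v = false
endpoints (e ∷ A) v = ⁅ fstEnd e ⁆ v ∨ (⁅ sndEnd e ⁆ v ∨ endpoints A v)

endpoints-Within : (A : List (Edge ν)) → Within (endpoints A) A
endpoints-Within (e ∷ A) (here refl) = ∨-introˡ (∈⁅⁆ (fstEnd e)) , ∨-introʳ {⁅ fstEnd e ⁆ (sndEnd e)}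
    (∨-introˡ (∈⁅⁆ (sndEnd e)))
endpoints-Within (e ∷ A) (there f∈) with endpoints-Within A f∈
... | p , q = weaken p , weaken q
  where
  weaken : ∀ {v} → endpoints A v ≡ true → endpoints (e ∷ A) v ≡ true
  weaken {v} r = ∨-introʳ {⁅ fstEnd e ⁆ v} (∨-introʳ {⁅ sndEnd e ⁆ v} r)

endpoints⁻ : (A : List (Edge ν)) {v : Fin ν} → endpoints A v ≡ true → ∃₂ λ e y → e ∈ A × Inc e v y
endpoints⁻ (e ∷ A) {v} p with ⁅ fstEnd e ⁆ v in q | ⁅ sndEnd e ⁆ v in r
... | true  | _ rewrite ∈⁅⁆⁻ {v = v} q = e , sndEnd e , here refl , fwd
... | false | true rewrite ∈⁅⁆⁻ {v = v} r = e , fstEnd e , here refl , bwd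
... | false | false with endpoints⁻ A p
... | f , y , f∈ , i = f , y , there f∈ , i

find-touching : (X : VSet ν) (M : List (Edge ν)) →
  (∃₂ λ e x → ∃₂ λ y B → M ↭ e ∷ B × Inc e x y × X x ≡ true) ⊎ (∀ {e} → e ∈ M → X (fstEnd e) ≡ false × X
      (sndEnd e) ≡ false)
find-touching X [] = inj₂ λ ()
find-touching X (e ∷ M) with X (fstEnd e) in p | X (sndEnd e) in q
... | true  | _     = inj₁ (e , fstEnd e , sndEnd e , M , ↭-refl , fwd , p)
... | false | true  = inj₁ (e , sndEnd e , fstEnd e , M , ↭-refl , bwd , q)
... | false | false with find-touching X M
... | inj₁ (f , x , y , B , r , i , t) = inj₁ (f , x , y , e ∷ B , ↭-trans (prep e r)
    (↭.swap e f ↭-refl) , i , t)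
... | inj₂ none = inj₂ λ { (here refl) → p , q ; (there f∈) → none f∈ }

cut-Within : {X : VSet ν} (A : List (Edge ν)) → Within X A → cut X A ≡ 0
cut-Within A w = 0-total A λ e∈ → cong₂ cross (proj₁ (w e∈)) (proj₂ (w e∈))

attach : {t x : Fin ν} (W : List (Edge ν)) {K : List (Edge ν)} → Conn t W → Conn x K →
  x ≡ t ⊎ (∃₂ λ g y → g ∈ W × Inc g x y) → Conn t (W ++ K)
attach W {K} cW cK (inj₁ refl) = Conn-++ W cW cK
attach W {K} cW cK (inj₂ (g , y , g∈ , i)) X Xt z = Within-++ W wW
  (cK X (proj₁ (inside⁻ X i (wW g∈))) (m+n≡0⇒n≡0 (cut X W) z′))
  where
  z′ = trans (sym (cut-++ X W K)) z
  wW = cW X Xt (m+n≡0⇒m≡0 (cut X W) z′)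

-- The invariant of the induction. Degrees are only bounded above because a vertex split off has no
-- edges left; on `U` the cuts supply the lower bound as long as two vertices remain.
record Standing (U : VSet ν) (H : List (Edge ν)) : Set where
  constructor standing
  field
    within : Within U H
    even   : EvenCuts H
    odd-H  : par H ≡ true
    degree : ∀ t → deg t H ≤ 6

xor-true : ∀ {a b} → a xor b ≡ true → b ≡ false → a ≡ true
xor-true {a} p refl = trans (sym (xor-identityʳ a)) p

oddPieces : List (List (Edge ν)) → ℕ
oddPieces []       = 0
oddPieces (K ∷ Ks) = bit (par K) + oddPieces Ks

par-concat : (Ks : List (List (Edge ν))) → par (concat Ks) ≡ odd (oddPieces Ks)
par-concat []       = refl
par-concat (K ∷ Ks) = trans (par-++ K (concat Ks))
  (trans (cong₂ _xor_ (sym (odd-bit (par K))) (par-concat Ks)) (sym (odd-+ (bit (par K)) (oddPieces Ks))))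

oddPieces-++ : (Ks Ls : List (List (Edge ν))) → oddPieces (Ks ++ Ls) ≡ oddPieces Ks + oddPieces Ls
oddPieces-++ []       Ls = refl
oddPieces-++ (K ∷ Ks) Ls = trans (cong (bit (par K) +_) (oddPieces-++ Ks Ls)) (sym (+-assoc (bit (par K)) _ _))

cut-trails : {t : Fin ν} {Ks : List (List (Edge ν))} → All (TrailAt t) Ks → cut ⁅ t ⁆
    (concat Ks) ≡ 2 * length Ks
cut-trails [] = refl
cut-trails {t = t} {K ∷ Ks} (k ∷ ks) =
  trans (cut-++ ⁅ t ⁆ K (concat Ks)) (trans (cong₂ _+_ (TrailAt.cut≡2 k) (cut-trails ks))
      (sym (*-suc 2 (length Ks))))

cut≤deg : (t : Fin ν) (A : List (Edge ν)) → cut ⁅ t ⁆ A ≤ deg t A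
cut≤deg t A = total-≤ A λ {e} _ → bool (⁅ t ⁆ (fstEnd e)) (⁅ t ⁆ (sndEnd e))
  where
  bool : ∀ a b → cross a b ≤ bit a + bit b
  bool true  true  = z≤n
  bool true  false = ≤-refl
  bool false true  = ≤-refl
  bool false false = z≤n

-- Obstructions at a vertex of a minimal counterexample

module Stuck {U : VSet ν} {H : List (Edge ν)} (st : Standing U H) (cuts : CutsAtLeast 6 U H)
  (three-odd : ThreeParts OddPart H) (indecomposable : ¬ Decomposable H)
  (smaller : ∀ {U′ : VSet ν} {H′ : List (Edge ν)} → count U′ < count U → Standing U′ H′ →
      CutsAtLeast 6 U′ H′ → ThreeParts OddPart H′ →
             (Decomposable H′ → ⊥) → ⊥) where

  open Standing st
  open import Algebra.Solver.CommutativeMonoid (++-commutativeMonoid {A = Edge ν}) using (solve; _⊜_; _⊕_; id)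

  module At {t : Fin ν} (Ut : U t ≡ true) (another : ∃ λ u → U u ≡ true × u ≢ t) where

    separates-t : Separates U ⁅ t ⁆
    separates-t = (t , Ut , ∈⁅⁆ t) , (proj₁ another , proj₁ (proj₂ another) , ∉⁅⁆ (proj₂ (proj₂ another)))

    cut-t : cut ⁅ t ⁆ H ≡ 6
    cut-t = ≤-antisym (≤-trans (cut≤deg t H) (degree t)) (cuts ⁅ t ⁆ separates-t)

    -- A loop would add two to the degree, which is at most six, and nothing to the cut, which is
    -- already six.
    loopless : Loopless t H
    loopless {e} e∈ i with ∈⇒↭ e∈
    ... | R , p = <⇒≱ {deg t H} {8} (s≤s (m≤n⇒m≤1+n (degree t))) (begin
      8                      ≡⟨ cong (2 +_) (sym cut-t) ⟩
      2 + cut ⁅ t ⁆ H        ≡⟨ cong (2 +_) (trans (cut-↭ ⁅ t ⁆ p) (cong (_+ cut ⁅ t ⁆ R) (cut⁅⁆-loop t i))) ⟩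
      2 + cut ⁅ t ⁆ R        ≤⟨ +-monoʳ-≤ 2 (cut≤deg t R) ⟩
      2 + deg t R            ≡⟨ cong (_+ deg t R) (sym (trans (deg-Inc t i) (cong₂ (λ a b → bit a + bit b)
          (∈⁅⁆ t) (∈⁅⁆ t)))) ⟩
      deg t (e ∷ R)          ≡⟨ total-↭ _ (↭-sym p) ⟩
      deg t H                ∎)
      where open ≤-Reasoning

    avoids : ∀ A {B} → H ↭ A ++ B → cut ⁅ t ⁆ A ≡ 0 → Avoids t A
    avoids A p z = uncut-Avoids (λ e∈ → loopless (∈-resp-↭ (↭-sym p) (∈-++⁺ˡ e∈))) z

    -- The third part A may be split at t in any way: it stays odd because H is.
    split-off : ∀ {H′} A B C → H ⇒ H′ → CutsAtLeast 6 (U ∖ t) H′ → H′ ↭ A ++ B ++ C → Loopless t A →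
      OddPart B → OddPart C → Avoids t B → Avoids t C → ⊥
    split-off {H′} A B C r c p lA (evB , oddB) (evC , oddC) avB avC =
      complete-split {U = U ∖ t} {N = B ++ C} refl (∖-not U t) avBC (length A) A ≤-refl lA
        (Within-⊆ {U = U} (⊆-∖∪ U t) withinABC) evABC (CutsAtLeast-↭ p c)
        λ A′ s av c′ →
          let s′ : A ++ B ++ C ⇒ A′ ++ B ++ C
              s′ = ⇒-++ s (B ++ C)
              q = ⇒-trans r′ s′
          in smaller (count-strict (U ∖ t) U (λ _ → ∖-⊆ U t) t (∖-not U t) Ut)
               (standing (Within-∖ (⇒-Within q within)
                            (λ e∈ → [ av , avBC ] (∈-++⁻ A′ e∈)))
                         (⇒-EvenCuts q even) (trans (sym (⇒-par q)) odd-H) (λ z → ≤-trans (⇒-deg q z)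
                             (degree z)))
               c′ (A′ , B , C , ↭-refl , (⇒-EvenCuts s evA , trans (sym (⇒-par s)) oddA) , (evB , oddB) ,
                   (evC , oddC))
               λ d → indecomposable (⇒-Decomposable q d)
      where
      avBC : Avoids t (B ++ C)
      avBC e∈ = [ avB , avC ] (∈-++⁻ B e∈)
      r′ : H ⇒ A ++ B ++ C
      r′ = ⇒-trans r (done p)
      withinABC : Within U (A ++ B ++ C)
      withinABC = ⇒-Within r′ within
      evABC : EvenCuts (A ++ B ++ C)
      evABC = ⇒-EvenCuts r′ even
      evA : EvenCuts A
      evA = EvenCuts-++⁻ʳ (B ++ C) (EvenCuts-↭ (++-comm A (B ++ C)) evABC) (EvenCuts-++ {A = B} evB evC)
      oddA : par A ≡ true
      oddA = xor-true (trans (sym (par-++ A (B ++ C))) (trans (sym (⇒-par r′)) odd-H))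
               (trans (par-++ B C) (cong₂ _xor_ oddB oddC))

    two-odd-parts-miss-t : ∀ A B C → H ↭ A ++ B ++ C → OddPart B → OddPart C → cut ⁅ t ⁆ B ≡ 0 →
        cut ⁅ t ⁆ C ≡ 0 → ⊥
    two-odd-parts-miss-t A B C p oB oC zB zC =
      split-off A B C ⇒-refl (CutsAtLeast-∖ {U = U} {t} {H} cuts) p (λ e∈ → loopless (∈-resp-↭ (↭-sym p)
          (∈-++⁺ˡ e∈))) oB oC
        (avoids B (↭-trans p (solve 3 (λ a b c → a ⊕ b ⊕ c ⊜ b ⊕ a ⊕ c) ↭-refl A B C)) zB)
        (avoids C (↭-trans p (solve 3 (λ a b c → a ⊕ b ⊕ c ⊜ c ⊕ a ⊕ b) ↭-refl A B C)) zC)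

    record Tight (K : List (Edge ν)) (Y : VSet ν) : Set where
      constructor tight
      field
        separates : Separates (U ∖ t) Y
        t∉        : Y t ≡ false
        cut≤6     : cut Y H ≤ 6
        ends∈     : ∀ {e y} → e ∈ K → Inc e t y → y ≢ t → Y y ≡ true

    -- If the two edges of `K` at `t` could be spliced, `K` and `C` would be two odd parts missing
    -- `t`, and `split-off` would apply. So a tight set blocks this pair.
    tight-set : ∀ K A C → H ↭ K ++ A ++ C → OddPart K → cut ⁅ t ⁆ K ≡ 2 → OddPart C → cut ⁅ t ⁆ C ≡ 0 →
      (∀ Y → Tight K Y → ⊥) → ⊥
    tight-set K A C p (evK , oddK) cK (evC , oddC) zC k = first (cut⁅⁆-incident t K (≤-trans (s≤s z≤n)
        (≤-reflexive (sym cK))))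
      where
      first : (∃₂ λ e x → ∃ λ K₁ → K ↭ e ∷ K₁ × Inc e t x × x ≢ t) → ⊥
      first (e , x , K₁ , p₁ , i , x≢t) = second (EvenCuts-partner (EvenCuts-↭ p₁ evK) i x≢t)
        where
        second : (∃₂ λ f y → ∃ λ K₂ → K₁ ↭ f ∷ K₂ × Inc f t y × y ≢ t) → ⊥
        second (f , y , K₂ , p₂ , j , y≢t) =
          split-off A (g ∷ K₂) C (split q i j ⇒-refl)
            (splice-cuts {e = e} {f} {K₂ ++ A ++ C} refl (EvenCuts-↭ q even) i j (CutsAtLeast-↭ q
                (CutsAtLeast-∖ {U = U} {t} {H} cuts))
              λ Y s Yt Yx Yy le → k Y (tight s Yt (subst (_≤ 6) (sym (cut-↭ Y q)) le) (leads Y Yx Yy)))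
            (solve 3 (λ k a c → k ⊕ a ⊕ c ⊜ a ⊕ k ⊕ c) ↭-refl (g ∷ K₂) A C)
            (λ e∈ → loopless (∈-resp-↭ (↭-sym p) (∈-++⁺ʳ K (∈-++⁺ˡ e∈))))
            (⇒-EvenCuts s evK , trans (sym (⇒-par s)) oddK) (evC , oddC)
            (λ { (here refl) → x≢t , y≢t ; (there g∈) → avK₂ g∈ })
            (avoids C (↭-trans p (solve 3 (λ k a c → k ⊕ a ⊕ c ⊜ c ⊕ k ⊕ a) ↭-refl K A C)) zC)
          where
          g = splice x y e f
          q₂ : K ↭ e ∷ f ∷ K₂
          q₂ = ↭-trans p₁ (prep e p₂)
          q : H ↭ e ∷ f ∷ K₂ ++ A ++ C
          q = ↭-trans p (++⁺ʳ (A ++ C) q₂)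
          s : K ⇒ g ∷ K₂
          s = split q₂ i j ⇒-refl
          zK₂ : cut ⁅ t ⁆ K₂ ≡ 0
          zK₂ = +-cancelˡ-≡ 2 _ _ (trans (cong₂ (λ a b → a + (b + cut ⁅ t ⁆ K₂)) (sym (cut⁅⁆-Inc i x≢t))
              (sym (cut⁅⁆-Inc j y≢t)))
                 (trans (sym (cut-↭ ⁅ t ⁆ q₂)) cK))
          avK₂ : Avoids t K₂
          avK₂ = uncut-Avoids (λ g∈ → loopless (∈-resp-↭ (↭-sym q) (there (there (∈-++⁺ˡ g∈))))) zK₂
          leads : ∀ Y → Y x ≡ true → Y y ≡ true → ∀ {h z} → h ∈ K → Inc h t z → z ≢ t → Y z ≡ true
          leads Y Yx Yy h∈ l z≢t with ∈-resp-↭ q₂ h∈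
          ... | here refl = trans (cong Y (Inc-unique l i)) Yx
          ... | there (here refl) = trans (cong Y (Inc-unique l j)) Yy
          ... | there (there h∈₂) with avK₂ h∈₂ | l
          ... | a , b | fwd = ⊥-elim (a refl)
          ... | a , b | bwd = ⊥-elim (b refl)

    -- A closed trail K of M touching some Wᵢ is absorbed by it if even; if K is odd,
    -- then K and the rest of M are two odd parts missing t.
    absorb-rest : ∀ m W₁ W₂ W₃ M → length M ≤ m → H ↭ W₁ ++ W₂ ++ W₃ ++ M →
      RootedPart t W₁ → RootedPart t W₂ → RootedPart t W₃ → EvenCuts M → par M ≡ false → cut ⁅ t ⁆ M ≡ 0 → ⊥
    absorb-rest m W₁ W₂ W₃ [] len p w₁ w₂ w₃ evM parM zM =
      indecomposable (t , W₁ , W₂ , W₃ , subst (λ z → H ↭ W₁ ++ W₂ ++ z) (++-identityʳ W₃) p , w₁ , w₂ , w₃)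
    absorb-rest (suc m) W₁ W₂ W₃
        (e₀ ∷ M₀) len p w₁@((ev₁ , o₁) , c₁) w₂@((ev₂ , o₂) , c₂) w₃@((ev₃ , o₃) , c₃) evM parM zM =
      cases (find-touching X M)
      where
      M = e₀ ∷ M₀
      W = W₁ ++ W₂ ++ W₃
      X = ⁅ t ⁆ ∪ endpoints W
      H↭ : H ↭ W ++ M
      H↭ = ↭-trans p (solve 4 (λ a b c m → a ⊕ b ⊕ c ⊕ m ⊜ (a ⊕ b ⊕ c) ⊕ m) ↭-refl W₁ W₂ W₃ M)

      -- Then no edge of `H` leaves `X`, although `X` separates `t` from an end of `e₀`.
      untouched : (∀ {e} → e ∈ M → X (fstEnd e) ≡ false × X (sndEnd e) ≡ false) → ⊥
      untouched none = <⇒≱ (subst (_< 6) (sym zero-cut) (s≤s z≤n))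
        (cuts X ((t , Ut , ∨-introˡ (∈⁅⁆ t)) , (fstEnd e₀ , proj₁ (within (∈-resp-↭ (↭-sym H↭)
            (∈-++⁺ʳ W (here refl)))) , proj₁ (none (here refl)))))
        where
        zero-cut : cut X H ≡ 0
        zero-cut = trans (cut-↭ X H↭) (trans (cut-++ X W M) (cong₂ _+_
          (cut-Within W (Within-⊆ {U = endpoints W} (λ {v} q → ∨-introʳ {⁅ t ⁆ v} q) (endpoints-Within W)))
          (0-total M λ e∈ → cong₂ cross (proj₁ (none e∈)) (proj₂ (none e∈)))))

      touching : (∃₂ λ e x → ∃₂ λ y B → M ↭ e ∷ B × Inc e x y × X x ≡ true) → ⊥
      touching (e , x , y , B , q , i , Xx) = grow (closed-trail (length B) {B} {e} ≤-refl (EvenCuts-↭ q evM) i)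
        where
        grow : Trail x e B → ⊥
        grow (K₀ , C , r , evK , evC , cK , _) with par (e ∷ K₀) in parK
        ... | true = two-odd-parts-miss-t W K C
              (↭-trans H↭ (++⁺ˡ W M↭)) (evK , parK) (evC , parC) (proj₁ zeros) (proj₂ zeros)
          where
          K = e ∷ K₀
          M↭ : M ↭ K ++ C
          M↭ = ↭-trans q (prep e r)
          zeros : cut ⁅ t ⁆ K ≡ 0 × cut ⁅ t ⁆ C ≡ 0
          zeros = m+n≡0⇒m≡0 (cut ⁅ t ⁆ K) z , m+n≡0⇒n≡0 (cut ⁅ t ⁆ K) z
            where z = trans (sym (trans (cut-↭ ⁅ t ⁆ M↭) (cut-++ ⁅ t ⁆ K C))) zM
          parC : par C ≡ true
          parC = not-false⁻ (trans (sym (trans (par-++ K C) (cong (_xor par C) parK)))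
              (trans (sym (par-↭ M↭)) parM))
        ... | false = choose (at-t-or-W (⁅ t ⁆ x) refl Xx)
          where
          K = e ∷ K₀
          M↭ : M ↭ K ++ C
          M↭ = ↭-trans q (prep e r)
          zC : cut ⁅ t ⁆ C ≡ 0
          zC = m+n≡0⇒n≡0 (cut ⁅ t ⁆ K) (trans (sym (trans (cut-↭ ⁅ t ⁆ M↭) (cut-++ ⁅ t ⁆ K C))) zM)
          parC : par C ≡ false
          parC = trans (sym (trans (par-++ K C) (cong (_xor par C) parK))) (trans (sym (par-↭ M↭)) parM)
          len′ : length C ≤ m
          len′ = s≤s⁻¹ (≤-trans (s≤s (m≤n+m (length C) (length K₀)))
            (≤-trans (≤-reflexive (sym (trans (↭-length M↭) (length-++ K)))) len))
          with-K : ∀ W → RootedPart t W → x ≡ t ⊎ (∃₂ λ g y → g ∈ W × Inc g x y) → RootedPart t (W ++ K)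
          with-K W ((evW , oW) , cW) near =
            (EvenCuts-++ {A = W} evW evK , trans (par-++ W K) (cong₂ _xor_ oW parK)) , attach W cW cK near
          H↭′ : H ↭ W ++ K ++ C
          H↭′ = ↭-trans H↭ (++⁺ˡ W M↭)
          into₁ : x ≡ t ⊎ (∃₂ λ g y → g ∈ W₁ × Inc g x y) → ⊥
          into₁ near = absorb-rest m (W₁ ++ K) W₂ W₃ C len′
            (↭-trans H↭′ (solve 5 (λ a b c k d → (a ⊕ b ⊕ c) ⊕ k ⊕ d ⊜
                (a ⊕ k) ⊕ b ⊕ c ⊕ d) ↭-refl W₁ W₂ W₃ K C))
            (with-K W₁ w₁ near) w₂ w₃ evC parC zC
          into₂ : x ≡ t ⊎ (∃₂ λ g y → g ∈ W₂ × Inc g x y) → ⊥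
          into₂ near = absorb-rest m W₁ (W₂ ++ K) W₃ C len′
            (↭-trans H↭′ (solve 5 (λ a b c k d → (a ⊕ b ⊕ c) ⊕ k ⊕ d ⊜ a ⊕
                (b ⊕ k) ⊕ c ⊕ d) ↭-refl W₁ W₂ W₃ K C))
            w₁ (with-K W₂ w₂ near) w₃ evC parC zC
          into₃ : x ≡ t ⊎ (∃₂ λ g y → g ∈ W₃ × Inc g x y) → ⊥
          into₃ near = absorb-rest m W₁ W₂ (W₃ ++ K) C len′
            (↭-trans H↭′ (solve 5 (λ a b c k d → (a ⊕ b ⊕ c) ⊕ k ⊕ d ⊜ a ⊕ b ⊕
                (c ⊕ k) ⊕ d) ↭-refl W₁ W₂ W₃ K C))
            w₁ w₂ (with-K W₃ w₃ near) evC parC zC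
          at-t-or-W : ∀ b → ⁅ t ⁆ x ≡ b → b ∨ endpoints W x ≡ true → x ≡ t ⊎ (∃₂ λ g y → g ∈ W × Inc g x y)
          at-t-or-W true  xt _ = inj₁ (∈⁅⁆⁻ xt)
          at-t-or-W false _  q = inj₂ (endpoints⁻ W q)
          choose : x ≡ t ⊎ (∃₂ λ g y → g ∈ W × Inc g x y) → ⊥
          choose (inj₁ x≡t) = into₁ (inj₁ x≡t)
          choose (inj₂ (g , z , g∈ , j)) with ∈-++⁻ W₁ g∈
          ... | inj₁ g∈₁ = into₁ (inj₂ (g , z , g∈₁ , j))
          ... | inj₂ g∈₂₃ with ∈-++⁻ W₂ g∈₂₃
          ... | inj₁ g∈₂ = into₂ (inj₂ (g , z , g∈₂ , j))
          ... | inj₂ g∈₃ = into₃ (inj₂ (g , z , g∈₃ , j))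

      cases : (∃₂ λ e x → ∃₂ λ y B → M ↭ e ∷ B × Inc e x y × X x ≡ true) ⊎
              (∀ {e} → e ∈ M → X (fstEnd e) ≡ false × X (sndEnd e) ≡ false) → ⊥
      cases (inj₁ found) = touching found
      cases (inj₂ none)  = untouched none

    -- The bad configuration at `t`: three trails pass `t`, but only `P` and `R` are odd, and the
    -- third odd part `M` misses `t`. The trail `Q` is even because `H` is odd.
    record Crossing (P R : List (Edge ν)) : Set where
      constructor crossing
      field
        {Q M}  : List (Edge ν)
        parts  : H ↭ P ++ R ++ Q ++ M
        odd-P  : OddPart P
        odd-R  : OddPart R
        odd-M  : OddPart M
        cut-P  : cut ⁅ t ⁆ P ≡ 2
        cut-R  : cut ⁅ t ⁆ R ≡ 2
        cut-Q  : cut ⁅ t ⁆ Q ≡ 2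
        cut-M  : cut ⁅ t ⁆ M ≡ 0

    Crossing-sym : ∀ {P R} → Crossing P R → Crossing R P
    Crossing-sym {P} {R} (crossing {Q} {M} p oP oR oM cP cR cQ cM) =
      crossing {Q = Q} {M} (↭-trans p
          (solve 4 (λ a b c d → a ⊕ b ⊕ c ⊕ d ⊜ b ⊕ a ⊕ c ⊕ d) ↭-refl P R Q M)) oR oP oM cR cP cQ cM

    Crossing-tight : ∀ {P R} → Crossing P R → (∀ Y → Tight P Y → ⊥) → ⊥
    Crossing-tight {P} {R} (crossing {Q} {M} p oP oR oM cP cR cQ cM) =
      tight-set P (R ++ Q) M (↭-trans p (solve 4 (λ a b c d → a ⊕ b ⊕ c ⊕ d ⊜ a ⊕
          (b ⊕ c) ⊕ d) ↭-refl P R Q M)) oP cP oM cM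

    -- At least three of the four pieces are odd, hence exactly three, as `H` is odd. If `M` is the
    -- even one, `absorb-rest` completes the three trails; otherwise one trail is even. The bound is
    -- a Boolean test so that the impossible cases vanish by computation.
    by-parity : ∀ P Q R M → H ↭ P ++ Q ++ R ++ M → TrailAt t P → TrailAt t Q → TrailAt t R → EvenCuts M →
        cut ⁅ t ⁆ M ≡ 0 →
      T (3 ≤ᵇ (bit (par P) + (bit (par Q) + (bit (par R) + 0))) + bit (par M)) → (∀ {P R} → Crossing P R →
          ⊥) → ⊥
    by-parity P Q R M p (trailAt eP cP nP) (trailAt eQ cQ nQ) (trailAt eR cR nR) evM zM le k
      with par P in oP | par Q in oQ | par R in oR | par M in oM
    ... | true  | true  | true  | false = absorb-rest (length M) P Q R M ≤-refl p ((eP , oP) , nP)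
        ((eQ , oQ) , nQ) ((eR , oR) , nR) evM oM zM
    ... | true  | true  | false | true  = k {P} {Q} (crossing {Q = R} {M} p (eP , oP) (eQ , oQ)
        (evM , oM) cP cQ cR zM)
    ... | true  | false | true  | true  = k {P} {R} (crossing {Q = Q} {M}
        (↭-trans p (solve 4 (λ a b c d → a ⊕ b ⊕ c ⊕ d ⊜ a ⊕ c ⊕ b ⊕ d) ↭-refl P Q R M)) (eP , oP) (eR , oR)
        (evM , oM) cP cR cQ zM)
    ... | false | true  | true  | true  = k {Q} {R} (crossing {Q = P} {M}
        (↭-trans p (solve 4 (λ a b c d → a ⊕ b ⊕ c ⊕ d ⊜ b ⊕ c ⊕ a ⊕ d) ↭-refl P Q R M)) (eQ , oQ) (eR , oR)
        (evM , oM) cQ cR cP zM)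
    ... | true  | true  | true  | true  = contra odd-H (trans (par-↭ p) (trans (par-++ P _) (cong₂ _xor_ oP
        (trans (par-++ Q _) (cong₂ _xor_ oQ (trans (par-++ R M) (cong₂ _xor_ oR oM)))))))
    by-parity P Q R M p _ _ _ evM zM () k | true  | false | false | true
    by-parity P Q R M p _ _ _ evM zM () k | true  | false | false | false
    by-parity P Q R M p _ _ _ evM zM () k | true  | true  | false | false
    by-parity P Q R M p _ _ _ evM zM () k | true  | false | true  | false
    by-parity P Q R M p _ _ _ evM zM () k | false | true  | true  | false
    by-parity P Q R M p _ _ _ evM zM () k | false | true  | false | true
    by-parity P Q R M p _ _ _ evM zM () k | false | true  | false | false
    by-parity P Q R M p _ _ _ evM zM () k | false | false | true  | true
    by-parity P Q R M p _ _ _ evM zM () k | false | false | true  | false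
    by-parity P Q R M p _ _ _ evM zM () k | false | false | false | true
    by-parity P Q R M p _ _ _ evM zM () k | false | false | false | false

    -- Each odd part has an odd piece, either a trail through `t` or the remainder missing `t`. Two
    -- odd remainders are excluded by `two-odd-parts-miss-t`, so uniting the three remainders loses
    -- no odd piece.
    crossing-of : ThreeParts OddPart H → (∀ {P R} → Crossing P R → ⊥) → ⊥
    crossing-of (A₁ , A₂ , A₃ , p , (ev₁ , o₁) , (ev₂ , o₂) , (ev₃ , o₃)) k
      with trails-at t (length A₁) A₁ ≤-refl ev₁ | trails-at t (length A₂) A₂ ≤-refl ev₂ | trails-at t
          (length A₃) A₃ ≤-refl ev₃
    ... | Ks₁ , M₁ , p₁ , all₁ , evM₁ , z₁ | Ks₂ , M₂ , p₂ , all₂ , evM₂ , z₂ | Ks₃ , M₃ , p₃ , all₃ , evM₃ , z₃ =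
      -- Each trail uses two of the six edges at `t`, so there are exactly three.
      three Ks refl all-Ks (*-cancelˡ-≡ (length Ks) 3 2 length-Ks)
      where
      Ks = Ks₁ ++ Ks₂ ++ Ks₃
      M = M₁ ++ M₂ ++ M₃
      concat-Ks : concat Ks ≡ concat Ks₁ ++ concat Ks₂ ++ concat Ks₃
      concat-Ks = sym (trans (cong (concat Ks₁ ++_) (concat-++ Ks₂ Ks₃)) (concat-++ Ks₁ (Ks₂ ++ Ks₃)))
      H↭₁ : H ↭ (concat Ks₁ ++ concat Ks₂ ++ concat Ks₃) ++ M
      H↭₁ = ↭-trans p (↭-trans (++⁺ p₁ (++⁺ p₂ p₃))
        (solve 6 (λ a b c d e f → (a ⊕ d) ⊕ (b ⊕ e) ⊕ (c ⊕ f) ⊜ (a ⊕ b ⊕ c) ⊕ d ⊕ e ⊕ f) ↭-refl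
          (concat Ks₁) (concat Ks₂) (concat Ks₃) M₁ M₂ M₃))
      H↭ : H ↭ concat Ks ++ M
      H↭ = subst (λ z → H ↭ z ++ M) (sym concat-Ks) H↭₁
      evM : EvenCuts M
      evM = EvenCuts-++ {A = M₁} evM₁ (EvenCuts-++ {A = M₂} evM₂ evM₃)
      zM : cut ⁅ t ⁆ M ≡ 0
      zM = trans (cut-++ ⁅ t ⁆ M₁ (M₂ ++ M₃)) (cong₂ _+_ z₁ (trans (cut-++ ⁅ t ⁆ M₂ M₃) (cong₂ _+_ z₂ z₃)))
      one : ∀ {A Ks′ M′} → A ↭ concat Ks′ ++ M′ → par A ≡ true → 1 ≤ oddPieces Ks′ + bit (par M′)
      one {A} {Ks′} {M′} q o = odd⇒1≤ (trans (odd-+ (oddPieces Ks′) (bit (par M′)))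
        (trans (cong₂ _xor_ (sym (par-concat Ks′)) (odd-bit (par M′))) (trans (sym (par-++ (concat Ks′) M′))
            (trans (sym (par-↭ q)) o))))
      many : 3 ≤ oddPieces Ks + (bit (par M₁) + (bit (par M₂) + bit (par M₃)))
      many = ≤-trans (+-mono-≤ (one {A₁} {Ks₁} {M₁} p₁ o₁) (+-mono-≤ (one {A₂} {Ks₂} {M₂} p₂ o₂)
          (one {A₃} {Ks₃} {M₃} p₃ o₃))) (≤-reflexive
        (trans (Nat.solve 6 (λ a b c d e f → (a Nat.:+ d) Nat.:+ ((b Nat.:+ e) Nat.:+ (c Nat.:+ f)) Nat.:=
            (a Nat.:+ (b Nat.:+ c)) Nat.:+ (d Nat.:+ (e Nat.:+ f))) refl
           (oddPieces Ks₁) (oddPieces Ks₂) (oddPieces Ks₃) (bit (par M₁)) (bit (par M₂)) (bit (par M₃)))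
          (cong (_+ (bit (par M₁) + (bit (par M₂) + bit (par M₃))))
            (sym (trans (oddPieces-++ Ks₁ (Ks₂ ++ Ks₃)) (cong (oddPieces Ks₁ +_) (oddPieces-++ Ks₂ Ks₃)))))))
        where module Nat = +-*-Solver
      all-Ks : All (TrailAt t) Ks
      all-Ks = All-++⁺ all₁ (All-++⁺ all₂ all₃)
      length-Ks : 2 * length Ks ≡ 6
      length-Ks = begin
        2 * length Ks                            ≡⟨ sym (cut-trails all-Ks) ⟩
        cut ⁅ t ⁆ (concat Ks)                    ≡⟨ sym (+-identityʳ _) ⟩
        cut ⁅ t ⁆ (concat Ks) + 0                ≡⟨ cong (cut ⁅ t ⁆ (concat Ks) +_) (sym zM) ⟩
        cut ⁅ t ⁆ (concat Ks) + cut ⁅ t ⁆ M      ≡⟨ sym (trans (cut-↭ ⁅ t ⁆ H↭) (cut-++ ⁅ t ⁆ (concat Ks) M)) ⟩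
        cut ⁅ t ⁆ H                              ≡⟨ cut-t ⟩
        6 ∎
        where open ≡-Reasoning
      bits : ∀ {a b c x y z} → a ≡ x → b ≡ y → c ≡ z → bit x + (bit y + bit z) ≡ bit (x xor (y xor z)) →
        bit a + (bit b + bit c) ≡ bit (a xor (b xor c))
      bits refl refl refl q = q
      few : ∀ P Q R → Ks ≡ P ∷ Q ∷ R ∷ [] → TrailAt t P → TrailAt t Q → TrailAt t R →
        bit (par M₁) + (bit (par M₂) + bit (par M₃)) ≡ bit (par M₁ xor (par M₂ xor par M₃)) → ⊥
      few P Q R eq tP tQ tR q =
        by-parity P Q R M
          (↭-trans (subst (λ z → H ↭ concat z ++ M) eq H↭)
            (solve 4 (λ a b c d → (a ⊕ b ⊕ c ⊕ id) ⊕ d ⊜ a ⊕ b ⊕ c ⊕ d) ↭-refl P Q R M))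
          tP tQ tR evM zM
          (≤⇒≤ᵇ (≤-trans many (≤-reflexive (cong₂ _+_ (cong oddPieces eq)
            (trans q (cong bit (sym (trans (par-++ M₁ (M₂ ++ M₃)) (cong (par M₁ xor_) (par-++ M₂ M₃)))))))))) k
      finish : ∀ P Q R → Ks ≡ P ∷ Q ∷ R ∷ [] → TrailAt t P → TrailAt t Q → TrailAt t R →
        ∀ b₁ b₂ b₃ → par M₁ ≡ b₁ → par M₂ ≡ b₂ → par M₃ ≡ b₃ → ⊥
      finish P Q R eq tP tQ tR true true _ q₁ q₂ _ =
        two-odd-parts-miss-t (concat Ks ++ M₃) M₁ M₂
          (↭-trans H↭ (solve 4 (λ a b c d → a ⊕ b ⊕ c ⊕ d ⊜ (a ⊕ d) ⊕ b ⊕ c) ↭-refl (concat Ks) M₁ M₂ M₃))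
              (evM₁ , q₁) (evM₂ , q₂) z₁ z₂
      finish P Q R eq tP tQ tR true false true q₁ _ q₃ =
        two-odd-parts-miss-t (concat Ks ++ M₂) M₁ M₃
          (↭-trans H↭ (solve 4 (λ a b c d → a ⊕ b ⊕ c ⊕ d ⊜ (a ⊕ c) ⊕ b ⊕ d) ↭-refl (concat Ks) M₁ M₂ M₃))
              (evM₁ , q₁) (evM₃ , q₃) z₁ z₃
      finish P Q R eq tP tQ tR false true true _ q₂ q₃ =
        two-odd-parts-miss-t (concat Ks ++ M₁) M₂ M₃
          (↭-trans H↭ (solve 4 (λ a b c d → a ⊕ b ⊕ c ⊕ d ⊜ (a ⊕ b) ⊕ c ⊕ d) ↭-refl (concat Ks) M₁ M₂ M₃))
              (evM₂ , q₂) (evM₃ , q₃) z₂ z₃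
      finish P Q R eq tP tQ tR true  false false q₁ q₂ q₃ = few P Q R eq tP tQ tR (bits q₁ q₂ q₃ refl)
      finish P Q R eq tP tQ tR false true  false q₁ q₂ q₃ = few P Q R eq tP tQ tR (bits q₁ q₂ q₃ refl)
      finish P Q R eq tP tQ tR false false true  q₁ q₂ q₃ = few P Q R eq tP tQ tR (bits q₁ q₂ q₃ refl)
      finish P Q R eq tP tQ tR false false false q₁ q₂ q₃ = few P Q R eq tP tQ tR (bits q₁ q₂ q₃ refl)
      three : ∀ Ls → Ks ≡ Ls → All (TrailAt t) Ls → length Ls ≡ 3 → ⊥
      three (P ∷ Q ∷ R ∷ []) eq (tP ∷ tQ ∷ tR ∷ []) _ =
        finish P Q R eq tP tQ tR (par M₁) (par M₂) (par M₃) refl refl refl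

    crossing-at : (∀ {P R} → Crossing P R → ⊥) → ⊥
    crossing-at = crossing-of three-odd

    Crossing-ends : ∀ {P R} → Crossing P R → ∀ {e y} → e ∈ P → Inc e t y → e ∈ H × U y ≡ true
    Crossing-ends cr e∈ i = e∈H , proj₂ (inside⁻ U i (within e∈H))
      where e∈H = ∈-resp-↭ (↭-sym (Crossing.parts cr)) (∈-++⁺ˡ e∈)

    Crossing-push : ∀ {P R} → Crossing P R → ∀ Y → Separates U Y → (∃ λ u → U u ≡ true × u ≢ t × Y u ≡ false) →
      Y t ≡ false → cut Y H ≤ 6 →
      (∀ {e y} → e ∈ P → Inc e t y → y ≢ t → Y y ≡ true) → (∀ {e y} → e ∈ R → Inc e t y → y ≢ t →
          Y y ≡ true) → ⊥
    Crossing-push {P} {R} (crossing {Q} {M} p oP oR oM cP cR cQ cM) Y sep out t∉ le endsP endsR =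
      push {Y = Y} {A = P ++ R} {B = Q ++ M} cuts
        (↭-trans p (solve 4 (λ a b c d → a ⊕ b ⊕ c ⊕ d ⊜ (a ⊕ b) ⊕ c ⊕ d) ↭-refl P R Q M)) sep out t∉ le leads
        (trans (cut-++ ⁅ t ⁆ P R) (cong₂ _+_ cP cR)) (trans (cut-++ ⁅ t ⁆ Q M) (cong₂ _+_ cQ cM))
      where
      leads : ∀ {e y} → e ∈ P ++ R → Inc e t y → y ≢ t → Y y ≡ true
      leads e∈ with ∈-++⁻ P e∈
      ... | inj₁ e∈P = endsP e∈P
      ... | inj₂ e∈R = endsR e∈R

    separates-U : ∀ {K Y} → Tight K Y → Separates U Y
    separates-U (tight ((u , Uu , Yu) , (v , Uv , Yv)) _ _ _) = (u , ∖-⊆ U t Uu , Yu) , (v , ∖-⊆ U t Uv , Yv)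

    outside : ∀ {K Y} → Tight K Y → ∃ λ u → U u ≡ true × u ≢ t × Y u ≡ false
    outside (tight (_ , (v , Uv , Yv)) _ _ _) = v , ∖-⊆ U t Uv , ∖-≢ U t Uv , Yv

  -- The crossing at `v` is remembered for the sake of `Y`, the tight set of the other trail. It
  -- contains neither `v` nor `u`, so a digon with an end in `Y` is a different one.
  record OddDigon (X : VSet ν) : Set where
    constructor oddDigon
    field
      {v u}   : Fin ν
      Uv      : U v ≡ true
      Uu      : U u ≡ true
      u≢v     : u ≢ v
      X∋u     : X u ≡ true
      {e f}   : Edge ν
      {L}     : List (Edge ν)
      inc-e   : Inc e v u
      inc-f   : Inc f v u
      H↭      : H ↭ e ∷ f ∷ L
      odd-ef  : sign e xor sign f ≡ true
      another : ∃ λ w → U w ≡ true × w ≢ v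
    open At Uv another public
    field
      {P R}   : List (Edge ν)
      {Z Y}   : VSet ν
      cross-v : Crossing P R
      tight-P : Tight P Z
      tight-R : Tight R Y
      Y∌u     : Y u ≡ false

  OddDigon-⊆ : {X Z : VSet ν} → (∀ {v} → U v ≡ true → Z v ≡ true → X v ≡ true) → OddDigon Z → OddDigon X
  OddDigon-⊆ sub d = oddDigon Uv Uu u≢v (sub Uu X∋u) inc-e inc-f H↭ odd-ef another cross-v tight-P tight-R Y∌u
    where open OddDigon d

  -- By uncrossing, a minimal tight set contains a single vertex of U, and then the two edges of P at t are parallel.
  digon-in : ∀ m {t} (Ut : U t ≡ true) (an : ∃ λ u → U u ≡ true × u ≢ t) → let open At Ut an in
    ∀ {P R} → Crossing P R → ∀ X Y → Tight P X → Tight R Y → count (X ∩ U) ≤ m → (OddDigon X → ⊥) → ⊥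
  digon-in m {t} Ut an {P} {R} cr X Y tX tY size k = go (any? (λ v → ((X ∩ U) ∖ u) v ≟ᵇ true))
    where
    open At Ut an
    u  = proj₁ (proj₁ (separates-U tX))
    Uu = proj₁ (proj₂ (proj₁ (separates-U tX)))
    Xu = proj₂ (proj₂ (proj₁ (separates-U tX)))
    u≢t : u ≢ t
    u≢t p = contra (subst (λ z → X z ≡ true) p Xu) (Tight.t∉ tX)

    single : (∀ {v} → X v ≡ true → U v ≡ true → v ≡ u) → ⊥
    single only = first (cut⁅⁆-incident t P (≤-trans (s≤s z≤n) (≤-reflexive (sym (Crossing.cut-P cr)))))
      where
      end : ∀ {e y} → e ∈ P → Inc e t y → y ≢ t → y ≡ u
      end e∈ i y≢t = only (Tight.ends∈ tX e∈ i y≢t) (proj₂ (Crossing-ends cr e∈ i))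
      first : (∃₂ λ e x → ∃ λ B → P ↭ e ∷ B × Inc e t x × x ≢ t) → ⊥
      first (e , x , B , p₁ , i , x≢t) with end (∈-resp-↭ (↭-sym p₁) (here refl)) i x≢t
      ... | refl = second (EvenCuts-partner (EvenCuts-↭ p₁ (proj₁ (Crossing.odd-P cr))) i x≢t)
        where
        second : (∃₂ λ f y → ∃ λ C → B ↭ f ∷ C × Inc f t y × y ≢ t) → ⊥
        second (f , y , C , p₂ , j , y≢t) with end (∈-resp-↭ (↭-sym (↭-trans p₁ (prep e p₂)))
            (there (here refl))) j y≢t
        ... | refl = by-sign (sign e xor sign f) refl
          where
          open Crossing cr using (Q; M; parts)
          P↭ : P ↭ e ∷ f ∷ C
          P↭ = ↭-trans p₁ (prep e p₂)
          evC : EvenCuts C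
          evC = EvenCuts-++⁻ʳ (e ∷ f ∷ []) {C} (EvenCuts-↭ P↭ (proj₁ (Crossing.odd-P cr))) (EvenCuts-digon i j)
          zC : cut ⁅ t ⁆ C ≡ 0
          zC = +-cancelˡ-≡ 2 _ _ (trans (cong₂ (λ a b → a + (b + cut ⁅ t ⁆ C)) (sym (cut⁅⁆-Inc i x≢t))
              (sym (cut⁅⁆-Inc j y≢t)))
                 (trans (sym (cut-↭ ⁅ t ⁆ P↭)) (Crossing.cut-P cr)))
          by-sign : ∀ b → sign e xor sign f ≡ b → ⊥
          -- With equal signs, `P` without the pair is still odd and now misses `t`, as `M` does.
          by-sign false q = two-odd-parts-miss-t (e ∷ f ∷ R ++ Q) C M
            (↭-trans parts (↭-trans (++⁺ʳ (R ++ Q ++ M) P↭)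
              (solve 5 (λ d c r q m → (d ⊕ c) ⊕ r ⊕ q ⊕ m ⊜ (d ⊕ r ⊕ q) ⊕ c ⊕ m) ↭-refl (e ∷ f ∷ []) C R Q M)))
            (evC , trans (sym (trans (sym (xor-assoc (sign e) (sign f) (par C))) (cong (_xor par C) q)))
                     (trans (sym (par-↭ P↭)) (proj₂ (Crossing.odd-P cr))))
            (Crossing.odd-M cr) zC (Crossing.cut-M cr)
          by-sign true q = k (oddDigon Ut Uu u≢t Xu i j (↭-trans parts (++⁺ʳ (R ++ Q ++ M) P↭)) q an cr tX tY
            (Y∌ (Y u) refl))
            where
            Y∌ : ∀ b → Y u ≡ b → Y u ≡ false
            Y∌ false r = r
            -- Otherwise the edges of `P` and of `R` at `t`, four in all, would enter `Y`.
            Y∌ true  r = ⊥-elim (Crossing-push cr Y (separates-U tY) (outside tY) (Tight.t∉ tY) (Tight.cut≤6 tY)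
              (λ e∈ l y≢t → trans (cong Y (end e∈ l y≢t)) r) (Tight.ends∈ tY))

    go : Dec (∃ λ v → ((X ∩ U) ∖ u) v ≡ true) → ⊥
    go (no none) = single only
      where
      only : ∀ {v} → X v ≡ true → U v ≡ true → v ≡ u
      only {v} Xv Uv with v ≟ u
      ... | yes p = p
      ... | no ¬p = ⊥-elim (none (v , ∈-∖ (X ∩ U) (cong₂ _∧_ Xv Uv) ¬p))
    -- A second vertex of `X`: tight sets at `t′` avoid `t′`, so one of them inside `X` is strictly
    -- smaller, and the search moves to `t′`.
    go (yes (t′ , t′∈)) = descend m size
      where
      X∩U∋t′ = ∖-⊆ (X ∩ U) u t′∈
      Xt′ = proj₁ (∧-true⁻ {X t′} X∩U∋t′)
      Ut′ = proj₂ (∧-true⁻ {X t′} X∩U∋t′)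
      u≢t′ : u ≢ t′
      u≢t′ p = ∖-≢ (X ∩ U) u t′∈ (sym p)
      open At Ut′ (u , Uu , u≢t′) using () renaming
        ( Crossing to Crossing′; Tight to Tight′; tight to tight′; module Tight to Tight′; Crossing-sym to Crossing-sym′
        ; crossing-at to crossing-at′; Crossing-tight to Crossing-tight′; Crossing-push to Crossing-push′
        ; Crossing-ends to Crossing-ends′; separates-U to separates-U′; outside to outside′)

      o  = proj₁ (outside tX)
      Uo = proj₁ (proj₂ (outside tX))
      Xo = proj₂ (proj₂ (proj₂ (outside tX)))

      descend : ∀ m → count (X ∩ U) ≤ m → ⊥
      descend zero le = <⇒≱ (count-strict (λ _ → false) (X ∩ U) (λ _ ()) t′ refl X∩U∋t′) (≤-trans le z≤n)
      descend (suc m) le = crossing-at′ λ {P′} {R′} cr′ →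
        Crossing-tight′ cr′ λ Yp tp → Crossing-tight′ (Crossing-sym′ cr′) λ Yr tr →
            split-cases P′ R′ cr′ Yp tp Yr tr
        where
        smaller-set : ∀ {A B} → Crossing′ A B → ∀ Z Y → Tight′ A Z → Tight′ B Y →
          (∀ {v} → U v ≡ true → Z v ≡ true → X v ≡ true) → ⊥
        smaller-set cr′ Z Y tZ tY sub = digon-in m Ut′ (u , Uu , u≢t′) cr′ Z Y tZ tY
          (s≤s⁻¹ (≤-trans (count-strict (Z ∩ U) (X ∩ U) sub′ t′ (cong (_∧ U t′) (Tight′.t∉ tZ)) X∩U∋t′) le))
          λ d → k (OddDigon-⊆ sub d)
          where
          sub′ : ∀ v → (Z ∩ U) v ≡ true → (X ∩ U) v ≡ true
          sub′ v p with ∧-true⁻ {Z v} p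
          ... | Zv , Uv = cong₂ _∧_ (sub Uv Zv) Uv

        data Position (Y : VSet ν) : Set where
          crossing : (∃ λ v → U v ≡ true × X v ≡ true × Y v ≡ true) →
              (∃ λ v → U v ≡ true × X v ≡ false × Y v ≡ false) → Position Y
          disjoint : (∀ {v} → U v ≡ true → Y v ≡ true → X v ≡ false) → Position Y
          covering : (∀ {v} → U v ≡ true → X v ≡ false → Y v ≡ true) → Position Y

        position : ∀ Y → Position Y
        position Y with member? U (X ∩ Y) | member? U (∁ (X ∪ Y))
        ... | yes (v , Uv , p) | yes (w , Uw , q) =
          crossing (v , Uv , ∧-true⁻ p) (w , Uw , ∨-false⁻ (not-true⁻ q))
        ... | no none | _ = disjoint λ Uv Yv → ¬-not λ Xv → none (_ , Uv , cong₂ _∧_ Xv Yv)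
        ... | _ | no none = covering λ {v} Uv Xv → Y-true Uv Xv (Y v) refl
          where
          Y-true : ∀ {v} → U v ≡ true → X v ≡ false → ∀ b → Y v ≡ b → Y v ≡ true
          Y-true Uv Xv true  q = q
          Y-true Uv Xv false q = ⊥-elim (none (_ , Uv , cong not (cong₂ _∨_ Xv q)))

        -- Uncrossing makes `X ∩ Y` tight. An edge of `A` from `t′` to a vertex outside `X` would
        -- run between the two differences.
        by-intersection : ∀ {A B} → Crossing′ A B → ∀ Y Z → Tight′ A Y → Tight′ B Z →
          (∃ λ v → U v ≡ true × X v ≡ true × Y v ≡ true) → (∃ λ v → U v ≡ true × X v ≡ false × Y v ≡ false) → ⊥
        by-intersection {A} cr′ Y Z tY tZ (a , Ua , Xa , Ya) (b , Ub , Xb , Yb) =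
          smaller-set cr′ (X ∩ Y) Z (tight′ sep t∉ (proj₁ un) leads) tZ (λ _ p → proj₁ (∧-true⁻ p))
          where
          t∉ : (X ∩ Y) t′ ≡ false
          t∉ = trans (cong (_∧ Y t′) Xt′) (Tight′.t∉ tY)
          s∩ : Separates U (X ∩ Y)
          s∩ = (a , Ua , cong₂ _∧_ Xa Ya) , (t′ , Ut′ , t∉)
          s∪ : Separates U (X ∪ Y)
          s∪ = (a , Ua , ∨-introˡ Xa) , (b , Ub , cong₂ _∨_ Xb Yb)
          un = uncross X Y H (Tight.cut≤6 tX) (Tight′.cut≤6 tY) (cuts _ s∩) (cuts _ s∪)
          sep : Separates (U ∖ t′) (X ∩ Y)
          sep = (a , ∈-∖ U Ua (λ p → contra (subst (λ z → Y z ≡ true) p Ya) (Tight′.t∉ tY)) , cong₂ _∧_ Xa Ya)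
              , (b , ∈-∖ U Ub (λ p → contra Xt′ (subst (λ z → X z ≡ false) p Xb)) , cong (_∧ Y b) Xb)
          leads : ∀ {e y} → e ∈ A → Inc e t′ y → y ≢ t′ → (X ∩ Y) y ≡ true
          leads {e} {y} e∈ i y≢t = by-X (X y) refl
            where
            Yy = Tight′.ends∈ tY e∈ i y≢t
            by-X : ∀ b → X y ≡ b → (X ∩ Y) y ≡ true
            by-X true  q = cong₂ _∧_ q Yy
            by-X false q = ⊥-elim (no-between X Y {H} (proj₂ (proj₂ un))
                (proj₁ (Crossing-ends′ cr′ e∈ i)) i Xt′ (Tight′.t∉ tY) q Yy)

        -- The part of `Y` outside `Z` lies in `X`, as `Z` covers the rest of `U`, and uncrossing
        -- `Y` with the complement of `Z` makes it tight. An edge of `A` from `t′` into `Y ∩ Z`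
        -- would run between the two differences.
        by-difference : ∀ {A B} → Crossing′ A B → ∀ Y Z → Tight′ A Y → Tight′ B Z →
          (∀ {v} → U v ≡ true → X v ≡ false → Z v ≡ true) →
          (∀ {v} → (U ∖ t′) v ≡ true → Y v ≡ false → Z v ≡ true) → ⊥
        by-difference {A} cr′ Y Z tY tZ cover all = from (proj₂ (Tight′.separates tY))
            (proj₂ (Tight′.separates tZ))
          where
          from : (∃ λ d → (U ∖ t′) d ≡ true × Y d ≡ false) → (∃ λ c → (U ∖ t′) c ≡ true × Z c ≡ false) → ⊥
          from (d , Ud , Yd) (c , Uc , Zc) =
            smaller-set cr′ (Y ∩ ∁ Z) Z (tight′ ((c , Uc , cong₂ _∧_ Yc (cong not Zc)) , (d , Ud , cong
                (_∧ ∁ Z d) Yd))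
              (cong (_∧ ∁ Z t′) (Tight′.t∉ tY)) (proj₁ un) leads) tZ sub
            where
            Yc : Y c ≡ true
            Yc = by (Y c) refl
              where
              by : ∀ b → Y c ≡ b → Y c ≡ true
              by true  q = q
              by false q = contra (all Uc q) Zc
            s∩ : Separates U (Y ∩ ∁ Z)
            s∩ = (c , ∖-⊆ U t′ Uc , cong₂ _∧_ Yc (cong not Zc)) , (t′ , Ut′ , cong (_∧ ∁ Z t′) (Tight′.t∉ tY))
            s∪ : Separates U (Y ∪ ∁ Z)
            s∪ = (c , ∖-⊆ U t′ Uc , ∨-introˡ Yc) , (d , ∖-⊆ U t′ Ud , cong₂ _∨_ Yd (cong not (all Ud Yd)))
            un = uncross Y (∁ Z) H (Tight′.cut≤6 tY) (≤-trans (≤-reflexive (cut-∁ Z H)) (Tight′.cut≤6 tZ))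
                (cuts _ s∩) (cuts _ s∪)
            leads : ∀ {e y} → e ∈ A → Inc e t′ y → y ≢ t′ → (Y ∩ ∁ Z) y ≡ true
            leads {e} {y} e∈ i y≢t = by-Z (Z y) refl
              where
              Yy = Tight′.ends∈ tY e∈ i y≢t
              by-Z : ∀ b → Z y ≡ b → (Y ∩ ∁ Z) y ≡ true
              by-Z false q = cong₂ _∧_ Yy (cong not q)
              by-Z true  q = ⊥-elim (no-between Y (∁ Z) {H} (proj₂ (proj₂ un))
                  (proj₁ (Crossing-ends′ cr′ e∈ i)) (Inc-sym i)
                               Yy (cong not q) (Tight′.t∉ tY) (cong not (Tight′.t∉ tZ)))
            sub : ∀ {v} → U v ≡ true → (Y ∩ ∁ Z) v ≡ true → X v ≡ true
            sub {v} Uv p = by (X v) refl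
              where
              by : ∀ b → X v ≡ b → X v ≡ true
              by true  q = q
              by false q = contra (cover Uv q) (not-true⁻ (proj₂ (∧-true⁻ {Y v} p)))

        split-cases : ∀ P R → Crossing′ P R → ∀ Yp → Tight′ P Yp → ∀ Yr → Tight′ R Yr → ⊥
        split-cases P R cr′ Yp tp Yr tr with position Yp | position Yr
        ... | crossing a b | _ = by-intersection cr′ Yp Yr tp tr a b
        ... | _ | crossing a b = by-intersection (Crossing-sym′ cr′) Yr Yp tr tp a b
        -- The complement of `X` is tight as well, avoids `t′` and contains the far ends of all four
        -- edges.
        ... | disjoint p | disjoint r =
          Crossing-push′ cr′ (∁ X) (Separates-∁ (separates-U tX)) (u , Uu , u≢t′ , cong not Xu) (cong not Xt′)
            (≤-trans (≤-reflexive (cut-∁ X H)) (Tight.cut≤6 tX))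
            (λ e∈ i q → cong not (p (proj₂ (Crossing-ends′ cr′ e∈ i)) (Tight′.ends∈ tp e∈ i q)))
            (λ e∈ i q → cong not (r (proj₂ (Crossing-ends′ (Crossing-sym′ cr′) e∈ i)) (Tight′.ends∈ tr e∈ i q)))
        -- The far ends of `P` lie outside `X`, hence in `Yr`, which then takes all four edges.
        ... | disjoint p | covering r =
          Crossing-push′ cr′ Yr (separates-U′ tr) (outside′ tr) (Tight′.t∉ tr) (Tight′.cut≤6 tr)
            (λ e∈ i q → let Uy = proj₂ (Crossing-ends′ cr′ e∈ i) in r Uy (p Uy (Tight′.ends∈ tp e∈ i q)))
                (Tight′.ends∈ tr)
        ... | covering p | disjoint r =
          Crossing-push′ cr′ Yp (separates-U′ tp) (outside′ tp) (Tight′.t∉ tp) (Tight′.cut≤6 tp)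
              (Tight′.ends∈ tp)
            (λ e∈ i q → let Uy = proj₂ (Crossing-ends′ (Crossing-sym′ cr′) e∈ i) in p Uy
                (r Uy (Tight′.ends∈ tr e∈ i q)))
        -- Both sets contain `o`, a vertex outside `X`. If their union misses some vertex besides
        -- `t′`, it is tight and takes all four edges; if not, the difference of the two is the
        -- smaller set.
        ... | covering p | covering r with member? (U ∖ t′) (∁ (Yp ∪ Yr))
        ... | yes (w , Uw , q) =
          Crossing-push′ cr′ (Yp ∪ Yr) s∪ (w , ∖-⊆ U t′ Uw , ∖-≢ U t′ Uw , not-true⁻ q)
              (cong₂ _∨_ (Tight′.t∉ tp) (Tight′.t∉ tr))
            (proj₁ (proj₂ un)) (λ e∈ i z → ∨-introˡ (Tight′.ends∈ tp e∈ i z)) (λ {_} {y} e∈ i z →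
                ∨-introʳ {Yp y} (Tight′.ends∈ tr e∈ i z))
          where
          s∩ : Separates U (Yp ∩ Yr)
          s∩ = (o , Uo , cong₂ _∧_ (p Uo Xo) (r Uo Xo)) , (t′ , Ut′ , cong (_∧ Yr t′) (Tight′.t∉ tp))
          s∪ : Separates U (Yp ∪ Yr)
          s∪ = (o , Uo , ∨-introˡ (p Uo Xo)) , (w , ∖-⊆ U t′ Uw , not-true⁻ q)
          un = uncross Yp Yr H (Tight′.cut≤6 tp) (Tight′.cut≤6 tr) (cuts _ s∩) (cuts _ s∪)
        ... | no none = by-difference cr′ Yp Yr tp tr r λ {v} Uv q → by v Uv q (Yr v) refl
          where
          by : ∀ v → (U ∖ t′) v ≡ true → Yp v ≡ false → ∀ b → Yr v ≡ b → Yr v ≡ true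
          by v Uv q true  z = z
          by v Uv q false z = ⊥-elim (none (v , Uv , cong not (cong₂ _∨_ q z)))

-- Decompositions of edge lists

Inc-end : {e : Edge ν} {a b c d : Fin ν} → Inc e a b → Inc e c d → d ≡ a ⊎ d ≡ b
Inc-end fwd fwd = inj₂ refl
Inc-end fwd bwd = inj₁ refl
Inc-end bwd fwd = inj₁ refl
Inc-end bwd bwd = inj₂ refl

two-odd-digons : {U : VSet ν} {H L : List (Edge ν)} {v u v′ u′ : Fin ν} {e f e′ f′ : Edge ν} →
  Standing U H → CutsAtLeast 6 U H → H ↭ e ∷ f ∷ e′ ∷ f′ ∷ L →
  Inc e v u → Inc f v u → Inc e′ v′ u′ → Inc f′ v′ u′ →
  sign e xor sign f ≡ true → sign e′ xor sign f′ ≡ true →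
  v ≢ u′ → v′ ≢ u′ → U v ≡ true → U v′ ≡ true → U u′ ≡ true → (Decomposable H → ⊥) → ⊥
two-odd-digons {ν = ν} {U} {H} {L} {v} {u} {v′} {u′} {e} {f} {e′} {f′}
  (standing sup ev odd-H _) c p i₁ i₂ j₁ j₂ s₁ s₂ v≢u′ v′≢u′ Uv Uv′ Uu′ k = go (v′ ≟ v)
  where
  D D′ : List (Edge ν)
  D  = e ∷ f ∷ []
  D′ = e′ ∷ f′ ∷ []
  par-D : par D ≡ true
  par-D = trans (cong (sign e xor_) (xor-identityʳ (sign f))) s₁
  par-D′ : par D′ ≡ true
  par-D′ = trans (cong (sign e′ xor_) (xor-identityʳ (sign f′))) s₂
  evL : EvenCuts L
  evL = EvenCuts-++⁻ʳ (D ++ D′) {L} (EvenCuts-↭ p ev) (EvenCuts-++ {A = D} {D′} (EvenCuts-digon i₁ i₂)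
      (EvenCuts-digon j₁ j₂))
  par-L : par L ≡ true
  par-L = trans (sym (cong (_xor par L) (trans (par-++ D D′) (cong₂ _xor_ par-D par-D′))))
            (trans (sym (par-++ (D ++ D′) L)) (trans (sym (par-↭ p)) odd-H))
  root-D : RootedPart v D
  root-D = (EvenCuts-digon i₁ i₂ , par-D) , Conn-digon i₁ i₂
  -- The two digons supply at most four of the six edges of any cut.
  conn-L : Conn v L
  conn-L X Xv z with member? U (∁ X)
  ... | yes (w , Uw , Xw) = ⊥-elim (<⇒≱ small (c X ((v , Uv , Xv) , (w , Uw , not-true⁻ Xw))))
    where
    small : cut X H < 6
    small = begin-strict
      cut X H                            ≡⟨ trans (cut-↭ X p) (trans (cut-++ X D (D′ ++ L))
          (cong (cut X D +_) (cut-++ X D′ L))) ⟩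
      cut X D + (cut X D′ + cut X L)     ≡⟨ cong (λ a → cut X D + (cut X D′ + a)) z ⟩
      cut X D + (cut X D′ + 0)           ≤⟨ +-mono-≤ (cut-pair≤2 X e f) (+-monoˡ-≤ 0 (cut-pair≤2 X e′ f′)) ⟩
      4                                  <⟨ s≤s (s≤s (s≤s (s≤s (s≤s z≤n)))) ⟩
      6 ∎
      where open ≤-Reasoning
  ... | no none = Within-⊆ {U = U} {X} all (λ g∈ → sup (∈-resp-↭ (↭-sym p) (∈-++⁺ʳ (D ++ D′) g∈)))
    where
    all : ∀ {w} → U w ≡ true → X w ≡ true
    all {w} Uw = not-false⁻ (¬-not λ q → none (w , Uw , q))
  p′ : H ↭ D ++ L ++ D′
  p′ = ↭-trans p (++⁺ˡ D (++-comm D′ L))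
  -- Removing the digon `D` costs at most two edges of a cut; this is the four in `twoParts`.
  cuts₄ : CutsAtLeast 4 U (L ++ D′)
  cuts₄ X s = +-cancelˡ-≤ 2 4 _ (≤-trans (c X s) (≤-trans (≤-reflexive (trans (cut-↭ X p′)
      (cut-++ X D (L ++ D′))))
    (+-monoˡ-≤ (cut X (L ++ D′)) (cut-pair≤2 X e f))))
  evD′ : EvenCuts D′
  evD′ = EvenCuts-digon j₁ j₂
  -- Since `L` is odd, exactly one of `A` and `B` is odd; the odd digon `D′` joins the other.
  assemble : TwoParts v D′ L → ⊥
  assemble (A , B , q , (evA , cA , cAD) , (evB , cB , cBD)) = by (par A) refl
    where
    par-AB : par A xor par B ≡ true
    par-AB = trans (sym (par-++ A B)) (trans (sym (par-↭ q)) par-L)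
    by : ∀ b → par A ≡ b → ⊥
    by true  r = k (v , D , A , B ++ D′ , ↭-trans p′ (++⁺ˡ D (↭-trans (++⁺ʳ D′ q) (↭-reflexive
        (++-assoc A B D′)))) , root-D
      , ((evA , r) , cA) , ((EvenCuts-++ {A = B} evB evD′ , trans (par-++ B D′)
          (cong₂ _xor_ par-B par-D′)) , cBD))
      where
      par-B : par B ≡ false
      par-B = trans (sym (not-involutive (par B))) (cong not (trans (sym (cong (_xor par B) r)) par-AB))
    by false r = k (v , D , A ++ D′ , B , ↭-trans p (++⁺ˡ D (↭-trans (++⁺ˡ D′ q)
        (↭-trans (↭-sym (↭-reflexive (++-assoc D′ A B)))
        (↭-trans (++⁺ʳ B (++-comm D′ A)) ↭-refl)))) , root-D
      , ((EvenCuts-++ {A = A} evA evD′ , trans (par-++ A D′) (cong₂ _xor_ r par-D′)) , cAD)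
      , ((evB , trans (sym (cong (_xor par B) r)) par-AB) , cB))
  go : Dec (v′ ≡ v) → ⊥
  go (yes q) = k (v , D , D′ , L , p , root-D , ((EvenCuts-digon j₁ j₂ , par-D′) , Conn-digon (at-v j₁)
      (at-v j₂)) , ((evL , par-L) , conn-L))
    where
    at-v : ∀ {g} → Inc g v′ u′ → Inc g v u′
    at-v = subst (λ w → Inc _ w u′) q
  go (no v′≢v) = twoParts (λ q → v′≢v (sym q)) v≢u′ v′≢u′ j₁ j₂ (count U) ≤-refl Uv Uv′ Uu′
    (λ g∈ → sup (∈-resp-↭ (↭-sym p) (∈-++⁺ʳ (D ++ D′) g∈))) evL cuts₄ assemble

-- The vertex `u′` is an end of `e′` and `f′` but of neither `e` nor `f`, so both edges of the
-- second digon are still in the list once the first digon is removed.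
disjoint-digons : {H L L′ : List (Edge ν)} {v u v′ u′ : Fin ν} {e f e′ f′ : Edge ν} →
  H ↭ e ∷ f ∷ L → H ↭ e′ ∷ f′ ∷ L′ → Inc e v u → Inc f v u → Inc e′ v′ u′ → Inc f′ v′ u′ → u′ ≢ v → u′ ≢ u →
  ∃ λ M → H ↭ e ∷ f ∷ e′ ∷ f′ ∷ M
disjoint-digons {e = e} {f} {e′} {f′} p q i₁ i₂ j₁ j₂ u′≢v u′≢u = first (∈-resp-↭ (↭-trans (↭-sym q) p)
    (here refl))
  where
  absurd : ∀ {A : Set} {g} → Inc g _ _ → Inc g _ _ → A
  absurd i j with Inc-end i j
  ... | inj₁ r = ⊥-elim (u′≢v r)
  ... | inj₂ r = ⊥-elim (u′≢u r)
  first : e′ ∈ e ∷ f ∷ _ → _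
  first (here refl)         = absurd i₁ j₁
  first (there (here refl)) = absurd i₂ j₁
  first (there (there e′∈)) with ∈⇒↭ e′∈
  ... | L₁ , r = second (∈-resp-↭ s (here refl))
    where
    r′ = prep e (prep f r)
    s = drop-∷ (↭-trans (↭-sym q) (↭-trans p (↭-trans r′ (shifts (e ∷ f ∷ []) (e′ ∷ [])))))
    second : f′ ∈ e ∷ f ∷ L₁ → _
    second (here refl)         = absurd i₁ j₂
    second (there (here refl)) = absurd i₂ j₂
    second (there (there f′∈)) with ∈⇒↭ f′∈
    ... | M , t = M , ↭-trans p (↭-trans r′ (prep e (prep f (prep e′ t))))

decompose : ∀ m {U : VSet ν} {H} → count U ≤ m → Standing U H → CutsAtLeast 6 U H → ThreeParts OddPart H →
  (Decomposable H → ⊥) → ⊥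
decompose m {H = []} size (standing _ _ () _) c three k
decompose {ν = ν} m {U} {H@(e₀ ∷ _)} size st@(standing sup _ _ _) c three k = go
    (any? (λ w → (U ∖ s) w ≟ᵇ true))
  where
  s = fstEnd e₀
  Us = proj₁ (sup (here refl))
  go : Dec (∃ λ w → (U ∖ s) w ≡ true) → ⊥
  -- With a single vertex left all edges are loops at `s`, and any three odd parts are connected
  -- through it.
  go (no none) = rooted three
    where
    conn : ∀ {A} → (∀ {g} → g ∈ A → g ∈ H) → Conn s A
    conn sub X Xs _ g∈ = at-s (proj₁ (sup (sub g∈))) , at-s (proj₂ (sup (sub g∈)))
      where
      at-s : ∀ {w} → U w ≡ true → X w ≡ true
      at-s {w} Uw with w ≟ s
      ... | yes refl = Xs
      ... | no w≢s = ⊥-elim (none (w , ∈-∖ U Uw w≢s))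
    rooted : ThreeParts OddPart H → ⊥
    rooted (A , B , C , p , oA , oB , oC) = k (s , A , B , C , p
      , (oA , conn (λ g∈ → back (∈-++⁺ˡ g∈)))
      , (oB , conn (λ g∈ → back (∈-++⁺ʳ A (∈-++⁺ˡ g∈))))
      , (oC , conn (λ g∈ → back (∈-++⁺ʳ A (∈-++⁺ʳ B g∈)))))
      where
      back : ∀ {g} → g ∈ A ++ B ++ C → g ∈ H
      back = ∈-resp-↭ (↭-sym p)
  go (yes (w , w∈)) = by-size m size
    where
    by-size : ∀ m → count U ≤ m → ⊥
    by-size zero le = <⇒≱ (count-strict (λ _ → false) U (λ _ ()) s refl Us) (≤-trans le z≤n)
    by-size (suc m) le = crossing-at λ cr → Crossing-tight cr λ X tX → Crossing-tight (Crossing-sym cr) λ Y tY →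
      digon-in (count (X ∩ U)) Us another cr X Y tX tY ≤-refl λ d → second d
      where
      another : ∃ λ w → U w ≡ true × w ≢ s
      another = w , ∖-⊆ U s w∈ , ∖-≢ U s w∈
      open Stuck st c three k (λ lt → decompose m (s≤s⁻¹ (≤-trans lt le)))
      open At Us another using (crossing-at; Crossing-tight; Crossing-sym)
      -- The search is repeated at the end `v` of the first digon with the two trails exchanged, now
      -- inside the tight set that avoids the first digon.
      second : ∀ {X} → OddDigon X → ⊥
      second d = digon-in (count (D.Y ∩ U)) D.Uv D.another
          (D.Crossing-sym D.cross-v) D.Y D.Z D.tight-R D.tight-P ≤-refl third
        where
        module D = OddDigon d
        third : OddDigon D.Y → ⊥
        third d′ = two-odd-digons st c (proj₂ both) D.inc-e D.inc-f D′.inc-e D′.inc-f D.odd-ef D′.odd-ef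
          (λ q → u′≢v (sym q)) (λ q → D′.u≢v (sym q)) D.Uv D′.Uv D′.Uu k
          where
          module D′ = OddDigon d′
          u′≢v : D′.u ≢ D.v
          u′≢v q = contra (subst (λ z → D.Y z ≡ true) q D′.X∋u) (D.Tight.t∉ D.tight-R)
          u′≢u : D′.u ≢ D.u
          u′≢u q = contra (subst (λ z → D.Y z ≡ true) q D′.X∋u) D.Y∌u
          both = disjoint-digons D.H↭ D′.H↭ D.inc-e D.inc-f D′.inc-e D′.inc-f u′≢v u′≢u

-- From graphs to edge lists and back

%2-odd : ∀ k → k % 2 ≡ bit (odd k)
%2-odd zero          = refl
%2-odd (suc zero)    = refl
%2-odd (suc (suc k)) = trans (%2-odd k) (cong bit (sym (not-involutive (odd k))))

Odd⇒odd : ∀ k → Odd k → odd k ≡ true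
Odd⇒odd k p with odd k | trans (sym (%2-odd k)) p
... | true | _ = refl

odd⇒Odd : ∀ k → odd k ≡ true → Odd k
odd⇒Odd k p = trans (%2-odd k) (cong bit p)

even⇒Even : ∀ k → odd k ≡ false → Even k
even⇒Even k p = trans (%2-odd k) (cong bit p)

total-map : {A B : Set} (f : B → ℕ) (g : A → B) → ∀ L → total f (map g L) ≡ total (λ x → f (g x)) L
total-map f g []      = refl
total-map f g (x ∷ L) = cong (f (g x) +_) (total-map f g L)

total-tabulate : ∀ {A : Set} {k} (f : A → ℕ) (g : Fin k → A) (p : Fin k → Bool) →
  (∀ i → f (g i) ≡ bit (p i)) → total f (tabulate g) ≡ count p
total-tabulate {k = zero}  f g p eq = refl
total-tabulate {k = suc k} f g p eq =
  cong₂ _+_ (eq Fin.zero) (total-tabulate f (λ i → g (Fin.suc i)) (λ i → p (Fin.suc i)) (λ i → eq (Fin.suc i)))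

par-total : (A : List (Edge ν)) → par A ≡ odd (total (λ e → bit (sign e)) A)
par-total []      = refl
par-total (e ∷ A) = trans (cong₂ _xor_ (sym (odd-bit (sign e))) (par-total A)) (sym (odd-+ (bit (sign e)) _))

⨁ : ∀ {k} → (Fin k → Bool) → Bool
⨁ {zero}  f = false
⨁ {suc k} f = f Fin.zero xor ⨁ (λ i → f (Fin.suc i))

xor-interchange : ∀ a b c d → (a xor b) xor (c xor d) ≡ (a xor c) xor (b xor d)
xor-interchange a b c d = begin
  (a xor b) xor (c xor d) ≡⟨ xor-assoc a b (c xor d) ⟩
  a xor (b xor (c xor d)) ≡⟨ cong (a xor_) (xor-swap b c d) ⟩
  a xor (c xor (b xor d)) ≡⟨ sym (xor-assoc a c (b xor d)) ⟩
  (a xor c) xor (b xor d) ∎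
  where open ≡-Reasoning

⨁-xor : ∀ {k} (f g : Fin k → Bool) → ⨁ (λ i → f i xor g i) ≡ ⨁ f xor ⨁ g
⨁-xor {zero}  f g = refl
⨁-xor {suc k} f g = trans (cong ((f Fin.zero xor g Fin.zero) xor_) (⨁-xor (λ i → f (Fin.suc i))
    (λ i → g (Fin.suc i))))
  (xor-interchange (f Fin.zero) (g Fin.zero) _ _)

⨁-cong : ∀ {k} {f g : Fin k → Bool} → (∀ i → f i ≡ g i) → ⨁ f ≡ ⨁ g
⨁-cong {zero}  eq = refl
⨁-cong {suc k} eq = cong₂ _xor_ (eq Fin.zero) (⨁-cong (λ i → eq (Fin.suc i)))

⨁-false : ∀ k → ⨁ {k} (λ _ → false) ≡ false
⨁-false zero    = refl
⨁-false (suc k) = ⨁-false k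

⨁-singleton : ∀ {k} (X : Fin k → Bool) (w : Fin k) → ⨁ (λ v → X v ∧ ⁅ v ⁆ w) ≡ X w
⨁-singleton {suc k} X Fin.zero = trans (cong₂ _xor_ (∧-identityʳ (X Fin.zero)) (trans (⨁-cong λ i → ∧-zeroʳ
    (X (Fin.suc i))) (⨁-false k)))
  (xor-identityʳ (X Fin.zero))
⨁-singleton {suc k} X (Fin.suc w) = trans (cong₂ _xor_ (∧-zeroʳ (X Fin.zero)) (⨁-cong λ i → cong
    (X (Fin.suc i) ∧_) (suc-⁅⁆ i)))
  (⨁-singleton (λ i → X (Fin.suc i)) w)
  where
  suc-⁅⁆ : ∀ i → ⁅ Fin.suc i ⁆ (Fin.suc w) ≡ ⁅ i ⁆ w
  suc-⁅⁆ i with w ≟ i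
  ... | yes _ = refl
  ... | no _  = refl

-- The handshake argument: in the degree sum over `X`, edges inside `X` count twice and cancel.
odd-cut : (X : VSet ν) (A : List (Edge ν)) → odd (cut X A) ≡ ⨁ (λ v → X v ∧ odd (deg v A))
odd-cut {ν} X [] = sym (trans (⨁-cong λ v → ∧-zeroʳ (X v)) (⨁-false ν))
odd-cut X (e ∷ A) = begin
  odd (cutE X e + cut X A)
    ≡⟨ odd-+ (cutE X e) (cut X A) ⟩
  odd (cutE X e) xor odd (cut X A)
    ≡⟨ cong₂ _xor_ (odd-cross (X a) (X b)) (odd-cut X A) ⟩
  (X a xor X b) xor ⨁ (λ v → X v ∧ odd (deg v A))
    ≡⟨ cong (_xor ⨁ (λ v → X v ∧ odd (deg v A))) (sym (trans (⨁-xor (λ v → X v ∧ ⁅ v ⁆ a)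
        (λ v → X v ∧ ⁅ v ⁆ b)) (cong₂ _xor_ (⨁-singleton X a) (⨁-singleton X b)))) ⟩
  ⨁ (λ v → (X v ∧ ⁅ v ⁆ a) xor (X v ∧ ⁅ v ⁆ b)) xor ⨁ (λ v → X v ∧ odd (deg v A))
    ≡⟨ sym (⨁-xor (λ v → (X v ∧ ⁅ v ⁆ a) xor (X v ∧ ⁅ v ⁆ b)) (λ v → X v ∧ odd (deg v A))) ⟩
  ⨁ (λ v → ((X v ∧ ⁅ v ⁆ a) xor (X v ∧ ⁅ v ⁆ b)) xor (X v ∧ odd (deg v A)))
    ≡⟨ ⨁-cong (λ v → sym (bitwise (X v) (⁅ v ⁆ a) (⁅ v ⁆ b) (deg v A))) ⟩
  ⨁ (λ v → X v ∧ odd (deg v (e ∷ A))) ∎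
  where
  open ≡-Reasoning
  a = fstEnd e
  b = sndEnd e
  bitwise : ∀ x p q d → x ∧ odd (bit p + bit q + d) ≡ ((x ∧ p) xor (x ∧ q)) xor (x ∧ odd d)
  bitwise false p     q     d = refl
  bitwise true  true  true  d = not-involutive (odd d)
  bitwise true  true  false d = refl
  bitwise true  false true  d = refl
  bitwise true  false false d = refl

odd-deg : (t : Fin ν) (A : List (Edge ν)) → odd (deg t A) ≡ odd (cut ⁅ t ⁆ A)
odd-deg t []      = refl
odd-deg t (e ∷ A) = trans (odd-+ (bit (⁅ t ⁆ (fstEnd e)) + bit (⁅ t ⁆ (sndEnd e))) (deg t A))
  (trans (cong₂ _xor_ (bool (⁅ t ⁆ (fstEnd e)) (⁅ t ⁆ (sndEnd e))) (odd-deg t A)) (sym (odd-+ (cutE ⁅ t ⁆ e)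
      (cut ⁅ t ⁆ A))))
  where
  bool : ∀ a b → odd (bit a + bit b) ≡ odd (cross a b)
  bool true  true  = refl
  bool true  false = refl
  bool false true  = refl
  bool false false = refl

odd-count : ∀ {k} (p : Fin k → Bool) → odd (count p) ≡ ⨁ p
odd-count {zero}  p = refl
odd-count {suc k} p = trans (odd-+ (bit (p Fin.zero)) (count (λ i → p (Fin.suc i))))
  (cong₂ _xor_ (odd-bit (p Fin.zero)) (odd-count (λ i → p (Fin.suc i))))

⨁-last : ∀ {k} (f : Fin (suc k) → Bool) → ⨁ f ≡ ⨁ (λ i → f (inject₁ i)) xor f (fromℕ k)
⨁-last {zero}  f = xor-identityʳ (f Fin.zero)
⨁-last {suc k} f = trans (cong (f Fin.zero xor_) (⨁-last (λ i → f (Fin.suc i))))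
    (sym (xor-assoc (f Fin.zero) _ _))

take-out : ∀ {A : Set} {k} (f : Fin k → A) → Injective _≡_ _≡_ f → ∀ ys → (∀ i → f i ∈ ys) → ∃ λ zs →
    ys ↭ tabulate f ++ zs
take-out {k = zero}  f inj ys f∈ = ys , ↭-refl
take-out {k = suc k} f inj ys f∈ with ∈⇒↭ (f∈ Fin.zero)
... | ys′ , p with take-out (λ i → f (Fin.suc i)) (λ q → suc-injective (inj q)) ys′ f∈′
  where
  f∈′ : ∀ i → f (Fin.suc i) ∈ ys′
  f∈′ i with ∈-resp-↭ p (f∈ (Fin.suc i))
  ... | there q = q
  ... | here q with () ← inj q
... | zs , q = zs , ↭-trans p (prep (f Fin.zero) q)

map-++⁻ : ∀ {A B : Set} (f : A → B) (xs : List B) {ys} zs → map f zs ≡ xs ++ ys →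
  ∃₂ λ as bs → zs ≡ as ++ bs × xs ≡ map f as × ys ≡ map f bs
map-++⁻ f []       zs       eq = [] , zs , refl , refl , sym eq
map-++⁻ f (x ∷ xs) (z ∷ zs) eq with map-++⁻ f xs zs (∷-injectiveʳ eq)
... | as , bs , refl , q , r = z ∷ as , bs , refl , cong₂ _∷_ (sym (∷-injectiveˡ eq)) q , r

no-repeat : ∀ {k} {i : Fin k} {R} → allFin k ↭ i ∷ i ∷ R → ⊥
no-repeat {k} p with ↭ₛ.Unique-resp-↭ (setoid (Fin k)) (↭.↭⇒↭ₛ p) (allFin⁺ k)
... | (i≢i ∷ _) ∷ _ = i≢i refl

module _ (G : SignedGraph) where

  private
    N M : ℕ
    N = n G
    M = m G

  toEdge : Fin M → Edge N
  toEdge e = edge (proj₁ (ends G e)) (proj₂ (ends G e)) (negative G e)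

  edgeList : List (Edge N)
  edgeList = map toEdge (allFin M)

  total-edgeList : (f : Edge N → ℕ) (p : Fin M → Bool) → (∀ e → f (toEdge e) ≡ bit (p e)) →
      total f edgeList ≡ count p
  total-edgeList f p eq = trans (total-map f toEdge (allFin M)) (total-tabulate (λ e → f (toEdge e))
      (λ e → e) p eq)

  deg-edgeList : ∀ t → deg t edgeList ≡ degIn G (allEdges G) t
  deg-edgeList t = trans (total-+ (λ e → bit (⁅ t ⁆ (fstEnd e))) (λ e → bit (⁅ t ⁆ (sndEnd e))) edgeList)
    (cong₂ _+_ (total-edgeList _ (λ e → ⁅ t ⁆ (proj₁ (ends G e))) (λ _ → refl)) (total-edgeList _
        (λ e → ⁅ t ⁆ (proj₂ (ends G e))) (λ _ → refl)))

  standing-edgeList : Regular G 6 → Odd (negCount G (allEdges G)) → Standing (λ _ → true) edgeList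
  standing-edgeList reg o = standing (λ _ → refl , refl) ev
    (trans (par-total edgeList) (trans (cong odd (total-edgeList (λ e → bit (sign e)) (negative G)
        (λ _ → refl))) (Odd⇒odd (count (negative G)) o)))
    (λ t → ≤-reflexive (six t))
    where
    six : ∀ t → deg t edgeList ≡ 6
    six t = trans (deg-edgeList t) (reg t)
    ev : EvenCuts edgeList
    ev X = trans (odd-cut X edgeList) (trans (⨁-cong λ v → trans (cong (λ d → X v ∧ odd d) (six v))
        (∧-zeroʳ (X v))) (⨁-false N))

  -- Delete the edges of the cut: if they were fewer than `k`, a walk from `u` to `v` would remain,
  -- yet no remaining edge leaves `X`.
  cuts-edgeList : ∀ {k} → EdgeConnected G k → CutsAtLeast k (λ _ → true) edgeList
  cuts-edgeList {k} conn X ((u , _ , Xu) , (v , _ , Xv)) = ℕ.≮⇒≥ λ small →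
    contra (closed (proj₂ (conn R (subst (_< k) (total-edgeList (cutE X) R
        (λ _ → refl)) small)) u v refl refl) Xu) Xv
    where
    R : Fin M → Bool
    R e = X (proj₁ (ends G e)) xor X (proj₂ (ends G e))
    xor-false : ∀ a b → (if a xor b then false else true) ≡ true → a ≡ b
    xor-false true  true  _ = refl
    xor-false false false _ = refl
    closed : ∀ {a b} → Reach G (λ e → if R e then false else true) a b → X a ≡ true → X b ≡ true
    closed here Xa = Xa
    closed (step e p (inj₁ (refl , refl)) r) Xa = closed r (trans (sym (xor-false (X _) (X _) p)) Xa)
    closed (step e p (inj₂ (refl , refl)) r) Xa = closed r (trans (xor-false (X _) (X _) p) Xa)

  csuc-inject₁ : ∀ {j} (i : Fin j) → csuc G (inject₁ i) ≡ Fin.suc i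
  csuc-inject₁ {j} i = toℕ-injective (begin
    toℕ (csuc G (inject₁ i))       ≡⟨ toℕ-fromℕ< (m%n<n (suc (toℕ (inject₁ i))) (suc j)) ⟩
    suc (toℕ (inject₁ i)) % suc j  ≡⟨ cong (λ z → suc z % suc j) (toℕ-inject₁ i) ⟩
    suc (toℕ i) % suc j            ≡⟨ m<n⇒m%n≡m (s≤s (toℕ<n i)) ⟩
    suc (toℕ i)                    ∎)
    where open ≡-Reasoning

  csuc-last : ∀ j → csuc G (fromℕ j) ≡ Fin.zero
  csuc-last j = toℕ-injective (begin
    toℕ (csuc G (fromℕ j))       ≡⟨ toℕ-fromℕ< (m%n<n (suc (toℕ (fromℕ j))) (suc j)) ⟩
    suc (toℕ (fromℕ j)) % suc j  ≡⟨ cong (λ z → suc z % suc j) (toℕ-fromℕ j) ⟩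
    suc j % suc j                ≡⟨ n%n≡0 (suc j) ⟩
    0                            ∎)
    where open ≡-Reasoning

  ⨁-csuc : ∀ {j} (f : Fin (suc j) → Bool) → ⨁ (λ i → f (csuc G i)) ≡ ⨁ f
  ⨁-csuc {j} f = begin
    ⨁ (λ i → f (csuc G i))                                         ≡⟨ ⨁-last (λ i → f (csuc G i)) ⟩
    ⨁ (λ i → f (csuc G (inject₁ i))) xor f (csuc G (fromℕ j))      ≡⟨ cong₂ _xor_ (⨁-cong λ i → cong f
        (csuc-inject₁ i)) (cong f (csuc-last j)) ⟩
    ⨁ (λ i → f (Fin.suc i)) xor f Fin.zero                         ≡⟨ xor-comm _ (f Fin.zero) ⟩
    ⨁ f                                                            ∎
    where open ≡-Reasoning

  circuitEdges : Circuit G → List (Fin M)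
  circuitEdges C = tabulate (Circuit.edges C)

  cutE-Joins : ∀ X {e u w} → Joins G e u w → cutE X (toEdge e) ≡ cross (X u) (X w)
  cutE-Joins X (inj₁ (refl , refl)) = refl
  cutE-Joins X (inj₂ (refl , refl)) = cross-comm (X _) (X _)

  -- Going once around, the starts of the steps and their ends are the same vertices up to a cyclic
  -- shift, so their contributions to a cut cancel modulo two.
  circuit-odd : (C : Circuit G) → Unbalanced G C → OddPart (map toEdge (circuitEdges C))
  circuit-odd C unb = ev , par-C
    where
    open Circuit C
    L = map toEdge (circuitEdges C)
    total-C : ∀ f p → (∀ i → f (toEdge (edges i)) ≡ bit (p i)) → total f L ≡ count p
    total-C f p eq = trans (total-map f toEdge (circuitEdges C)) (total-tabulate
        (λ e → f (toEdge e)) edges p eq)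
    par-C : par L ≡ true
    par-C = trans (par-total L) (trans (cong odd (total-C (λ e → bit (sign e)) (λ i → negative G (edges i))
        (λ _ → refl)))
      (Odd⇒odd (count (λ i → negative G (edges i))) unb))
    ev : EvenCuts L
    ev X = begin
      odd (cut X L)
        ≡⟨ cong odd (total-C (cutE X) (λ i → X (verts i) xor X (verts (csuc G i))) (λ i → cutE-Joins X
            (joins i))) ⟩
      odd (count (λ i → X (verts i) xor X (verts (csuc G i))))
        ≡⟨ odd-count (λ i → X (verts i) xor X (verts (csuc G i))) ⟩
      ⨁ (λ i → X (verts i) xor X (verts (csuc G i)))
        ≡⟨ ⨁-xor (λ i → X (verts i)) (λ i → X (verts (csuc G i))) ⟩
      ⨁ (λ i → X (verts i)) xor ⨁ (λ i → X (verts (csuc G i)))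
        ≡⟨ cong (⨁ (λ i → X (verts i)) xor_) (⨁-csuc (λ i → X (verts i))) ⟩
      ⨁ (λ i → X (verts i)) xor ⨁ (λ i → X (verts i))
        ≡⟨ xor-same (⨁ (λ i → X (verts i))) ⟩
      false ∎
      where open ≡-Reasoning

  three-odd-parts : Standing (λ _ → true) edgeList → (C D : Circuit G) → Unbalanced G C → Unbalanced G D →
      EdgeDisjoint G C D →
    ThreeParts OddPart edgeList
  three-odd-parts st C D uC uD dis with take-out (Circuit.edges C) (Circuit.einj C) (allFin M)
      (λ i → ∈-allFin _)
  ... | R , p with take-out (Circuit.edges D) (Circuit.einj D) R D∈R
    where
    D∈R : ∀ i → Circuit.edges D i ∈ R
    D∈R i with ∈-++⁻ (circuitEdges C) (∈-resp-↭ p (∈-allFin (Circuit.edges D i)))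
    ... | inj₂ q = q
    ... | inj₁ q with ∈-tabulate⁻ q
    ... | j , eq = ⊥-elim (dis j i (sym eq))
  ... | S , q = A , B , C′ , H↭ , oA , oB , evC , par-C
    where
    A  = map toEdge (circuitEdges C)
    B  = map toEdge (circuitEdges D)
    C′ = map toEdge S
    H↭ : edgeList ↭ A ++ B ++ C′
    H↭ = subst (edgeList ↭_)
      (trans (map-++ toEdge (circuitEdges C) _) (cong (A ++_) (map-++ toEdge (circuitEdges D) S)))
      (↭-map⁺ toEdge (↭-trans p (++⁺ˡ (circuitEdges C) q)))
    oA = circuit-odd C uC
    oB = circuit-odd D uD
    evC : EvenCuts C′
    evC = EvenCuts-++⁻ʳ B {C′} (EvenCuts-++⁻ʳ A {B ++ C′} (EvenCuts-↭ H↭ (Standing.even st)) (proj₁ oA))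
        (proj₁ oB)
    par-C : par C′ ≡ true
    par-C = begin
      par C′                        ≡⟨ sym (not-involutive (par C′)) ⟩
      true xor (true xor par C′)    ≡⟨ sym (cong₂ (λ a b → a xor (b xor par C′)) (proj₂ oA) (proj₂ oB)) ⟩
      par A xor (par B xor par C′)  ≡⟨ sym (trans (par-++ A (B ++ C′)) (cong (par A xor_) (par-++ B C′))) ⟩
      par (A ++ B ++ C′)            ≡⟨ sym (par-↭ H↭) ⟩
      par edgeList                  ≡⟨ Standing.odd-H st ⟩
      true                          ∎
      where open ≡-Reasoning

  -- Components and the search for a colouring

  Joins-sym : ∀ {e u w} → Joins G e u w → Joins G e w u
  Joins-sym (inj₁ p) = inj₂ p
  Joins-sym (inj₂ p) = inj₁ p

  Reach-trans : ∀ {S u v w} → Reach G S u v → Reach G S v w → Reach G S u w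
  Reach-trans here           r = r
  Reach-trans (step e p j q) r = step e p j (Reach-trans q r)

  Reach-sym : ∀ {S u v} → Reach G S u v → Reach G S v u
  Reach-sym here           = here
  Reach-sym (step e p j q) = Reach-trans (Reach-sym q) (step e p (Joins-sym j) here)

  record Component (S : Fin M → Bool) (r : Fin N) : Set where
    field
      vertices : VSet N
      root∈    : vertices r ≡ true
      reach    : ∀ {v} → vertices v ≡ true → Reach G S r v
      closed   : ∀ e → S e ≡ true → vertices (proj₁ (ends G e)) ≡ vertices (proj₂ (ends G e))

  component : ∀ S r → Component S r
  component S r = grow (count (∁ ⁅ r ⁆)) ⁅ r ⁆ ≤-refl (∈⁅⁆ r) (λ q → subst (Reach G S r) (sym (∈⁅⁆⁻ q)) here)
    where
    grow : ∀ k X → count (∁ X) ≤ k → X r ≡ true → (∀ {v} → X v ≡ true → Reach G S r v) → Component S r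
    add : ∀ k X → count (∁ X) ≤ k → X r ≡ true → (∀ {v} → X v ≡ true → Reach G S r v) →
      ∀ {e u w} → S e ≡ true → Joins G e u w → X u ≡ true → X w ≡ false → Component S r
    grow k X le Xr reach with any? (λ e → (S e ≟ᵇ true) ×-dec ((X (proj₁ (ends G e)) xor X
        (proj₂ (ends G e))) ≟ᵇ true))
    ... | no none = record { vertices = X ; root∈ = Xr ; reach = reach ; closed = λ e Se → same (X _) (X _)
        (λ q → none (e , Se , q)) }
      where
      same : ∀ a b → (a xor b ≡ true → ⊥) → a ≡ b
      same true  true  q = refl
      same true  false q = ⊥-elim (q refl)
      same false true  q = ⊥-elim (q refl)
      same false false q = refl
    ... | yes (e , Se , q) with X (proj₁ (ends G e)) in p₁ | X (proj₂ (ends G e)) in p₂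
    ... | true  | false = add k X le Xr reach Se (inj₁ (refl , refl)) p₁ p₂
    ... | false | true  = add k X le Xr reach Se (inj₂ (refl , refl)) p₂ p₁
    add zero X le Xr reach {w = w} Se j Xu Xw =
      ⊥-elim (<⇒≱ (count-strict (λ _ → false) (∁ X) (λ _ ()) w refl (cong not Xw)) (≤-trans le z≤n))
    add (suc k) X le Xr reach {e} {u} {w} Se j Xu Xw = grow k (X ∪ ⁅ w ⁆) le′ (∨-introˡ Xr) reach′
      where
      le′ : count (∁ (X ∪ ⁅ w ⁆)) ≤ k
      le′ = s≤s⁻¹ (≤-trans (count-strict (∁ (X ∪ ⁅ w ⁆)) (∁ X)
        (λ v q → cong not (proj₁ (∨-false⁻ {X v} (not-true⁻ q)))) w (cong not (∨-introʳ {X w} (∈⁅⁆ w)))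
            (cong not Xw)) le)
      reach′ : ∀ {v} → (X ∪ ⁅ w ⁆) v ≡ true → Reach G S r v
      reach′ {v} q with X v in Xv
      ... | true  = reach Xv
      ... | false = subst (Reach G S r) (sym (∈⁅⁆⁻ q)) (Reach-trans (reach Xu) (step e Se j here))

  -- Instead of asking for some vertex set, it takes the computed component of the root. This makes
  -- the condition decidable.
  Good : (Fin M → Bool) → Fin N → Set
  Good S r = (∀ v → Even (degIn G S v)) × Odd (negCount G S) × (∀ e → S e ≡ true → Inside (Component.vertices
      (component S r)) (toEdge e))

  good? : ∀ S r → Dec (Good S r)
  good? S r = all? (λ v → degIn G S v % 2 ℕ.≟ 0) ×-dec ((negCount G S % 2 ℕ.≟ 1) ×-dec
    all? (λ e → (S e ≟ᵇ true) →-dec ((X (proj₁ (ends G e)) ≟ᵇ true) ×-dec (X (proj₂ (ends G e)) ≟ᵇ true))))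
    where X = Component.vertices (component S r)

  Good⇒eulerian : ∀ {S r} → Good S r → Σ (Fin N → Bool) λ V → EulerianSub G V S × Odd
      (negCount G S) × V r ≡ true
  Good⇒eulerian {S} {r} (ev , o , inside) = vertices ,
    (inside , ((r , root∈) , λ u v Vu Vv → Reach-trans (Reach-sym (reach Vu)) (reach Vv)) , λ v _ →
        ev v) , o , root∈
    where open Component (component S r)

  -- No edge of `I` leaves the component of `r`, so `Conn`, applied to the component, puts all of
  -- `I` inside it.
  selected-Good : ∀ S r I J → allFin M ↭ I ++ J → (∀ {e} → e ∈ I → S e ≡ true) → (∀ {e} → e ∈ J → S e ≡ false) →
    RootedPart r (map toEdge I) → Good S r
  selected-Good S r I J p inI inJ ((ev , o) , conn) =
    (λ v → even⇒Even (degIn G S v) (trans (cong odd (deg-I v)) (trans (odd-deg v A) (ev ⁅ v ⁆)))) ,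
    odd⇒Odd (negCount G S) (trans (cong odd (count-I (negative G)))
        (trans (cong odd (sym (total-map (λ e → bit (sign e)) toEdge I))) (trans (sym (par-total A)) o))) ,
    λ e Se → conn vertices root∈ closed-I (∈-map⁺ toEdge (in-I Se))
    where
    open Component (component S r)
    A = map toEdge I
    in-I : ∀ {e} → S e ≡ true → e ∈ I
    in-I {e} Se with ∈-++⁻ I (∈-resp-↭ p (∈-allFin e))
    ... | inj₁ q = q
    ... | inj₂ q = contra Se (inJ q)
    count-I : ∀ q → count (λ e → S e ∧ q e) ≡ total (λ e → bit (q e)) I
    count-I q = begin
      count (λ e → S e ∧ q e)
        ≡⟨ sym (total-tabulate (λ e → bit (S e ∧ q e)) (λ e → e) (λ e → S e ∧ q e) (λ _ → refl)) ⟩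
      total (λ e → bit (S e ∧ q e)) (allFin M)
        ≡⟨ trans (total-↭ _ p) (total-++ _ I J) ⟩
      total (λ e → bit (S e ∧ q e)) I + total (λ e → bit (S e ∧ q e)) J
        ≡⟨ cong₂ _+_ (total-≡ I (λ {e} e∈ → cong (λ b → bit (b ∧ q e)) (inI e∈))) (0-total J (λ {e} e∈ → cong
            (λ b → bit (b ∧ q e)) (inJ e∈))) ⟩
      total (λ e → bit (q e)) I + 0
        ≡⟨ +-identityʳ _ ⟩
      total (λ e → bit (q e)) I ∎
      where open ≡-Reasoning
    deg-I : ∀ v → degIn G S v ≡ deg v A
    deg-I v = trans (cong₂ _+_ (count-I (λ e → ⁅ v ⁆ (proj₁ (ends G e))))
        (count-I (λ e → ⁅ v ⁆ (proj₂ (ends G e)))))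
      (trans (sym (total-+ _ _ I)) (sym (total-map _ toEdge I)))
    closed-I : cut vertices A ≡ 0
    closed-I = trans (total-map (cutE vertices) toEdge I)
      (0-total I λ {e} e∈ → trans (cong (λ b → cross b (vertices (proj₂ (ends G e)))) (closed e (inI e∈)))
          (cross-same (vertices (proj₂ (ends G e)))))

  Partition : (Fin M → Fin 3) → Fin N → Set
  Partition part r = ∀ i → Good (λ e → ⌊ part e ≟ i ⌋) r

  -- The conclusion covers every colouring that agrees pointwise with `part`, because encoding a
  -- colouring as a number and decoding it gives back only such a colouring.
  partition-by : ∀ r I₀ I₁ I₂ → allFin M ↭ I₀ ++ I₁ ++ I₂ →
    RootedPart r (map toEdge I₀) → RootedPart r (map toEdge I₁) → RootedPart r (map toEdge I₂) →
    ∃ λ part → ∀ part′ → (∀ e → part′ e ≡ part e) → Partition part′ r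
  partition-by r I₀ I₁ I₂ p a₀ a₁ a₂ = part , parts
    where
    open import Data.List.Membership.DecPropositional (_≟_ {M}) using (_∈?_)
    #0 #1 #2 : Fin 3
    #0 = Fin.zero
    #1 = Fin.suc Fin.zero
    #2 = Fin.suc (Fin.suc Fin.zero)
    part : Fin M → Fin 3
    part e with e ∈? I₀ | e ∈? I₁
    ... | yes _ | _     = #0
    ... | no _  | yes _ = #1
    ... | no _  | no _  = #2
    twice : ∀ {e A B} C → allFin M ↭ A ++ B ++ C → e ∈ A → e ∈ B → ⊥
    twice {e} {A} {B} C q eA eB with ∈⇒↭ eA | ∈⇒↭ eB
    ... | A′ , s | B′ , t = no-repeat (↭-trans q (↭-trans (++⁺ s (++⁺ʳ C t)) (prep e (shift e A′ (B′ ++ C)))))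
    p₁₂ : allFin M ↭ I₁ ++ I₂ ++ I₀
    p₁₂ = ↭-trans p (↭-trans (++-comm I₀ (I₁ ++ I₂)) (↭-reflexive (++-assoc I₁ I₂ I₀)))
    p₂₀ : allFin M ↭ I₂ ++ I₀ ++ I₁
    p₂₀ = ↭-trans p₁₂ (↭-trans (++-comm I₁ (I₂ ++ I₀)) (↭-reflexive (++-assoc I₂ I₀ I₁)))
    in₀ : ∀ {e} → e ∈ I₀ → part e ≡ #0
    in₀ {e} q with e ∈? I₀
    ... | yes _ = refl
    ... | no ¬q = ⊥-elim (¬q q)
    in₁ : ∀ {e} → e ∈ I₁ → part e ≡ #1
    in₁ {e} q with e ∈? I₀ | e ∈? I₁
    ... | yes q₀ | _     = ⊥-elim (twice I₂ p q₀ q)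
    ... | no _   | yes _ = refl
    ... | no _   | no ¬q = ⊥-elim (¬q q)
    in₂ : ∀ {e} → e ∈ I₂ → part e ≡ #2
    in₂ {e} q with e ∈? I₀ | e ∈? I₁
    ... | yes q₀ | _      = ⊥-elim (twice I₁ p₂₀ q q₀)
    ... | no _   | yes q₁ = ⊥-elim (twice I₀ p₁₂ q₁ q)
    ... | no _   | no _   = refl
    parts : ∀ part′ → (∀ e → part′ e ≡ part e) → Partition part′ r
    parts part′ eq i = sel i
      where
      is : ∀ {e j} i → part e ≡ j → ⌊ part′ e ≟ i ⌋ ≡ ⌊ j ≟ i ⌋
      is {e} i q = cong (λ z → ⌊ z ≟ i ⌋) (trans (eq e) q)
      either : ∀ {A B : List (Fin M)} {P : Fin M → Set} → (∀ {e} → e ∈ A → P e) → (∀ {e} → e ∈ B → P e) →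
          ∀ {e} → e ∈ A ++ B → P e
      either {A} f g e∈ with ∈-++⁻ A e∈
      ... | inj₁ q = f q
      ... | inj₂ q = g q
      sel : ∀ i → Good (λ e → ⌊ part′ e ≟ i ⌋) r
      sel Fin.zero = selected-Good _ r I₀ (I₁ ++ I₂) p (λ q → is #0 (in₀ q)) (either {I₁} (λ q → is #0
          (in₁ q)) (λ q → is #0 (in₂ q))) a₀
      sel (Fin.suc Fin.zero) = selected-Good _ r I₁ (I₂ ++ I₀) p₁₂ (λ q → is #1 (in₁ q)) (either {I₂}
          (λ q → is #1 (in₂ q)) (λ q → is #1 (in₀ q))) a₁
      sel (Fin.suc (Fin.suc Fin.zero)) = selected-Good _ r I₂ (I₀ ++ I₁) p₂₀ (λ q → is #2 (in₂ q))
          (either {I₀} (λ q → is #2 (in₀ q)) (λ q → is #2 (in₁ q))) a₂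

  Decomposable⇒Partition : Decomposable edgeList → ∃₂ λ k r → Partition (finToFun {3} {M} k) r
  Decomposable⇒Partition (r , A , B , C , p , a , b , c) with ↭-map-inv toEdge p
  ... | ys , eq , q with map-++⁻ toEdge A ys (sym eq)
  ... | I₀ , ys′ , refl , refl , eq′ with map-++⁻ toEdge B ys′ (sym eq′)
  ... | I₁ , I₂ , refl , refl , refl with partition-by r I₀ I₁ I₂ q a b c
  ... | part , good = funToFin part , r , good (finToFun (funToFin part)) (finToFun-funToFin part)

  -- decompose only yields ¬¬; a search through all colourings removes it.
  partition? : Dec (∃₂ λ k r → Partition (finToFun {3} {M} k) r)
  partition? = any? λ k → any? λ r → all? λ i → good? _ r

  Partition⇒Rooted3OddDecomposition : (∃₂ λ k r → Partition (finToFun {3} {M} k) r) → Rooted3OddDecomposition G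
  Partition⇒Rooted3OddDecomposition (k , r , good) = finToFun k , r , λ i → Good⇒eulerian (good i)

theorem5p2 : (G : SignedGraph) → EdgeConnected G 6 → Regular G 6 →
    Odd (negCount G (allEdges G)) →
    (Σ (Circuit G) λ C → Σ (Circuit G) λ D →
    Unbalanced G C × Unbalanced G D × EdgeDisjoint G C D) →
    Rooted3OddDecomposition G
theorem5p2 G conn reg o (C , D , uC , uD , dis) = Partition⇒Rooted3OddDecomposition G (decidable-stable
    (partition? G) ¬¬partition)
  where
  st : Standing (λ _ → true) (edgeList G)
  st = standing-edgeList G reg o
  ¬¬partition : ¬ ¬ (∃₂ λ k r → Partition G (finToFun {3} {m G} k) r)
  ¬¬partition none = decompose (count {n G} (λ _ → true)) ≤-refl st (cuts-edgeList G conn)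
    (three-odd-parts G st C D uC uD dis) λ d → none (Decomposable⇒Partition G d)
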